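{- Let $\Phi=(A;\{E_i\}_{i=0}^d;A^*;\{E^*_i\}_{i=0}^d)$ be a tridiagonal system on $V$ with diameter $d\geq 1$ that has $q$-Serre type, and regard $V$ as a $U^+_q$-module on which $W_0$ acts as $A$ and $W_1$ acts as $A^*$. Let $\{\mathcal V_i\}_{i=0}^d$ be one of the six decompositions of $V$ listed below (with $\mathcal V_{ -1}=\mathcal V_{d+1}=0$). Then for all $k\in\mathbb N$ and $0\leq i\leq d$: (a) for $[0,D]$, $[0^*,D^*]$ and $[0^*,D]$: $G_{k+1}\mathcal V_i\subseteq\mathcal V_{i-1}+\mathcal V_i$ and $\tilde G_{k+1}\mathcal V_i\subseteq \mathcal V_i+\mathcal V_{i+1}$; (b) for $[0^*,0]$: $G_{k+1}\mathcal V_i\subseteq \mathcal V_i$ and $\tilde G_{k+1}\mathcal V_i\subseteq\mathcal V_{i-1}+\mathcal V_i+\mathcal V_{i+1}$; (c) for $[D^*,0]$: $G_{k+1}\mathcal V_i\subseteq \mathcal V_i+\mathcal V_{i+1}$ and $\tilde G_{k+1}\mathcal V_i\subseteq\mathcal V_{i-1}+\mathcal V_i$; (d) for $[D^*,D]$: $G_{k+1}\mathcal V_i\subseteq \mathcal V_{i-1}+\mathcal V_i+\mathcal V_{i+1}$ and $\tilde G_{k+1}\mathcal V_i\subseteq\mathcal V_i$.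
   Context: $\mathbb F$ is a field, $V$ a nonzero finite-dimensional $\mathbb F$-vector space. A tridiagonal (TD) pair on $V$ is an ordered pair $A,A^*\in\mathrm{End}(V)$ such that: (i) each of $A,A^*$ is diagonalizable; (ii) there is an ordering $\{V_i\}_{i=0}^d$ of the eigenspaces of $A$ with $A^*V_i\subseteq V_{i-1}+V_i+V_{i+1}$ ($V_{ -1}=V_{d+1}=0$); (iii) there is an ordering $\{V^*_i\}_{i=0}^\delta$ of the eigenspaces of $A^*$ with $AV^*_i\subseteq V^*_{i-1}+V^*_i+V^*_{i+1}$; (iv) there is no subspace $W\neq 0,V$ with $AW\subseteq W$, $A^*W\subseteq W$. Such orderings are called standard. A TD system on $V$ is a sequence $(A;\{E_i\}_{i=0}^d;A^*;\{E^*_i\}_{i=0}^\delta)$ where $A,A^*$ is a TD pair, $\{E_i\}$ are the primitive idempotents of $A$ in a standard ordering and $\{E^*_i\}$ those of $A^*$ in a standard ordering; one always has $d=\delta$ (the diameter). Let $\theta_i$ (resp. $\theta^*_i$) be the eigenvalue of $A$ for $E_i$ (resp. of $A^*$ for $E^*_i$). Fix a nonzero $q$ in the algebraic closure of $\mathbb F$, not a root of unity, with $b=q^2\in\mathbb F$. $\Phi$ has $q$-Serre type if $\theta_i=b\theta_{i-1}$ and $\theta^*_i=b^{ -1}\theta^*_{i-1}$ for $1\leq i\leq d$. $U^+_q$ is the $\mathbb F$-algebra with generators $W_0,W_1$ and relations $[W_0,[W_0,[W_0,W_1]_b]_{b^{ -1}}]=0$, $[W_1,[W_1,[W_1,W_0]_b]_{b^{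 -1}}]=0$, where $[X,Y]=XY-YX$ and $[X,Y]_b=bXY-YX$. When $\Phi$ has $q$-Serre type, $A,A^*$ satisfy these relations, so $V$ is a $U^+_q$-module with $W_0\mapsto A$, $W_1\mapsto A^*$. The alternating elements $W_{ -k},W_{k+1},G_{k+1},\tilde G_{k+1}$ ($k\in\mathbb N$) of $U^+_q$ are defined recursively, in the order $W_0,W_1,G_1,\tilde G_1,W_{ -1},W_2,G_2,\tilde G_2,\dots$, with $G_0=\tilde G_0=1$, by: for $n\geq1$, $G_n=\frac{\sum_{k=0}^{n-1}W_{ -k}W_{n-k}b^{ -k}-\sum_{k=1}^{n-1}G_k\tilde G_{n-k}b^{ -k}}{1+b^{ -n}}+\frac{[W_n,W_0]}{(1+b^{ -n})(1-b^{ -1})}$, $\tilde G_n=G_n+\frac{[W_0,W_n]}{1-b^{ -1}}$, $W_{ -n}=\frac{[W_0,G_n]_b}{b-1}$, $W_{n+1}=\frac{[G_n,W_1]_b}{b-1}$. The six decompositions of $V$ have $i$-th components: $[0,D]$: $E_iV$; $[0^*,D^*]$: $E^*_iV$; $[0^*,0]$: $(E^*_0V+\cdots+E^*_iV)\cap(E_0V+\cdots+E_{d-i}V)$; $[0^*,D]$: $(E^*_0V+\cdots+E^*_iV)\cap(E_iV+\cdots+E_dV)$; $[D^*,0]$: $(E^*_{d-i}V+\cdots+E^*_dV)\cap(E_0V+\cdots+E_{d-i}V)$; $[D^*,D]$: $(E^*_{d-i}V+\cdots+E^*_dV)\cap(E_iV+\cdots+E_dV)$. -}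

module Defs where

open import Level using (Level; _⊔_; Lift) renaming (suc to lsuc)
open import Algebra.Bundles using (CommutativeRing)
open import Data.Nat using (ℕ; zero; suc; _∸_; _≤ᵇ_; _≡ᵇ_) renaming (_+_ to _+ℕ_)
open import Data.Bool using (Bool; true; false; if_then_else_; _∧_)
open import Data.Fin using (Fin; toℕ; inject₁) renaming (zero to fz; suc to fs)
open import Data.Fin.Properties using () renaming (_≟_ to _≟F_)
open import Data.Product using (Σ; _×_; _,_)
open import Relation.Nullary using (¬_; does)
open import Relation.Binary.PropositionalEquality using (_≢_)

-- Fields: a commutative ring with 0 ≠ 1 in which every nonzero element
-- has a multiplicative inverse (given by a total function _⁻¹, whose
-- value at 0 is irrelevant).

record Field (c ℓ : Level) : Set (lsuc (c ⊔ ℓ)) where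
  field
    commutativeRing : CommutativeRing c ℓ
  open CommutativeRing commutativeRing public
  field
    _⁻¹        : Carrier → Carrier
    0≉1        : ¬ (0# ≈ 1#)
    ⁻¹-inverse : ∀ x → ¬ (x ≈ 0#) → x * (x ⁻¹) ≈ 1#

data Kind : Set where
  [0,D] [0*,D*] [0*,0] [0*,D] [D*,0] [D*,D] : Kind

module _ {c ℓ : Level} (F : Field c ℓ) where
  open Field F

  _−_ : Carrier → Carrier → Carrier
  x − y = x + (- y)

  pow : Carrier → ℕ → Carrier
  pow x zero    = 1#
  pow x (suc m) = x * pow x m

  sumF : ∀ {m} → (Fin m → Carrier) → Carrier
  sumF {zero}  f = 0#
  sumF {suc m} f = f fz + sumF (λ j → f (fs j))

  module _ (n : ℕ) where
    -- V = F^n, End(V) = n × n matrices over F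
    Vect : Set c
    Vect = Fin n → Carrier

    Mat : Set c
    Mat = Fin n → Fin n → Carrier

  module _ {n : ℕ} where
    _≈v_ : Vect n → Vect n → Set ℓ
    u ≈v v = ∀ i → u i ≈ v i

    _≈m_ : Mat n → Mat n → Set ℓ
    M ≈m N = ∀ i j → M i j ≈ N i j

    0v : Vect n
    0v = λ _ → 0#

    _+v_ : Vect n → Vect n → Vect n
    (u +v v) i = u i + v i

    _•v_ : Carrier → Vect n → Vect n
    (a •v v) i = a * v i

    app : Mat n → Vect n → Vect n
    app M v i = sumF (λ j → M i j * v j)

    0m : Mat n
    0m = λ _ _ → 0#

    Im : Mat n
    Im i j = if does (i ≟F j) then 1# else 0#

    _⊕_ : Mat n → Mat n → Mat n
    (M ⊕ N) i j = M i j + N i j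

    _⊖_ : Mat n → Mat n → Mat n
    (M ⊖ N) i j = M i j − N i j

    _•_ : Carrier → Mat n → Mat n
    (a • M) i j = a * M i j

    _·_ : Mat n → Mat n → Mat n
    (M · N) i j = sumF (λ k → M i k * N k j)

    comm : Mat n → Mat n → Mat n
    comm X Y = (X · Y) ⊖ (Y · X)

    commb : Carrier → Mat n → Mat n → Mat n
    commb b X Y = (b • (X · Y)) ⊖ (Y · X)

    sumVF : ∀ {m} → (Fin m → Vect n) → Vect n
    sumVF {zero}  f = 0v
    sumVF {suc m} f = f fz +v sumVF (λ j → f (fs j))

    sumMF : ∀ {m} → (Fin m → Mat n) → Mat n
    sumMF {zero}  f = 0m
    sumMF {suc m} f = f fz ⊕ sumMF (λ j → f (fs j))

    sumFrom : ℕ → ℕ → (ℕ → Mat n) → Mat n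
    sumFrom a zero    f = 0m
    sumFrom a (suc m) f = if a ≤ᵇ m then sumFrom a m f ⊕ f m else sumFrom a m f

    Sub : Set (lsuc (c ⊔ ℓ))
    Sub = Vect n → Set (c ⊔ ℓ)

    zeroSub : Sub
    zeroSub v = Lift c (v ≈v 0v)

    _+S_ : Sub → Sub → Sub
    (S +S T) v = Σ (Vect n) λ x → Σ (Vect n) λ y → S x × T y × Lift c (v ≈v (x +v y))

    _∩S_ : Sub → Sub → Sub
    (S ∩S T) v = S v × T v

    MapsInto : Mat n → Sub → Sub → Set (c ⊔ ℓ)
    MapsInto M S T = ∀ v → S v → T (app M v)

    IsSubspace : Sub → Set (c ⊔ ℓ)
    IsSubspace W = (∀ u v → u ≈v v → W u → W v)
                 × W 0v
                 × (∀ u v → W u → W v → W (u +v v))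
                 × (∀ a v → W v → W (a •v v))

    -- E_a V + E_{a+1} V + ... + E_b V  (indices outside 0..d contribute 0):
    -- all vectors of the form Σ_{a ≤ j ≤ b} E_j w_j
    span : {d : ℕ} → (Fin (suc d) → Mat n) → ℕ → ℕ → Sub
    span {d} E a b v =
      Σ (Fin (suc d) → Vect n) λ w →
        Lift c (v ≈v sumVF (λ j → if (a ≤ᵇ toℕ j) ∧ (toℕ j ≤ᵇ b) then app (E j) (w j) else 0v))

  record TDSystem (n d : ℕ) : Set (lsuc (c ⊔ ℓ)) where
    field
      A  : Mat n
      A* : Mat n
      E  : Fin (suc d) → Mat n
      E* : Fin (suc d) → Mat n
      θ  : Fin (suc d) → Carrier
      θ* : Fin (suc d) → Carrier
      -- {E_i} are the primitive idempotents of A (so A is diagonalizable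
      -- with eigenvalues θ_0..θ_d and eigenspaces E_i V)
      E-idem     : ∀ i → (E i · E i) ≈m E i
      E-orth     : ∀ i j → i ≢ j → (E i · E j) ≈m 0m
      E-sum      : sumMF E ≈m Im
      E-nonzero  : ∀ i → ¬ (E i ≈m 0m)
      E-eigen    : ∀ i → (A · E i) ≈m (θ i • E i)
      θ-distinct : ∀ i j → i ≢ j → ¬ (θ i ≈ θ j)
      E*-idem     : ∀ i → (E* i · E* i) ≈m E* i
      E*-orth     : ∀ i j → i ≢ j → (E* i · E* j) ≈m 0m
      E*-sum      : sumMF E* ≈m Im
      E*-nonzero  : ∀ i → ¬ (E* i ≈m 0m)
      E*-eigen    : ∀ i → (A* · E* i) ≈m (θ* i • E* i)
      θ*-distinct : ∀ i j → i ≢ j → ¬ (θ* i ≈ θ* j)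
      A*-tridiag : ∀ (i : Fin (suc d)) →
        MapsInto A* (span E (toℕ i) (toℕ i)) (span E (toℕ i ∸ 1) (toℕ i +ℕ 1))
      A-tridiag  : ∀ (i : Fin (suc d)) →
        MapsInto A (span E* (toℕ i) (toℕ i)) (span E* (toℕ i ∸ 1) (toℕ i +ℕ 1))
      irreducible : ¬ (Σ (Sub {n}) λ W →
                        IsSubspace W
                      × (∀ v → W v → W (app A v))
                      × (∀ v → W v → W (app A* v))
                      × (Σ (Vect n) λ v → W v × ¬ (v ≈v 0v))
                      × (Σ (Vect n) λ v → ¬ W v))

  -- q-Serre type, with b = q²
  SerreType : {n d : ℕ} → TDSystem n d → Carrier → Set ℓ
  SerreType {n} {d} Φ b =
    (∀ (i : Fin d) → θ (fs i) ≈ b * θ (inject₁ i))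
    × (∀ (i : Fin d) → θ* (fs i) ≈ (b ⁻¹) * θ* (inject₁ i))
    where open TDSystem Φ

  -- Alternating elements, computed in End(V) (i.e. their images under
  -- the U⁺_q-action W₀ ↦ W0, W₁ ↦ W1).
  -- Quad m = (W_{-m}, W_{m+1}, G_m, G̃_m); Quad 0 = (W₀, W₁, 1, 1).

  record Quad (n : ℕ) : Set c where
    constructor quad
    field
      Wneg : Mat n
      Wpos : Mat n
      Gq   : Mat n
      Gtq  : Mat n

  module _ {n : ℕ} (W0 W1 : Mat n) (b : Carrier) where
    private
      bi : Carrier
      bi = b ⁻¹

      next : ℕ → (ℕ → Quad n) → Quad n
      next m h = quad Wm Wp Gm Gtm
        where
          Wn : ℕ → Mat n
          Wn k = Quad.Wneg (h k)
          Wq : ℕ → Mat n          -- W_{k}, k ≥ 1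
          Wq k = Quad.Wpos (h (k ∸ 1))
          Gk : ℕ → Mat n
          Gk k = Quad.Gq (h k)
          Gtk : ℕ → Mat n
          Gtk k = Quad.Gtq (h k)
          c1 : Carrier
          c1 = 1# + pow bi m
          c2 : Carrier
          c2 = 1# − bi
          Gm : Mat n
          Gm = ((c1 ⁻¹) • (sumFrom 0 m (λ k → pow bi k • (Wn k · Wq (m ∸ k)))
                          ⊖ sumFrom 1 m (λ k → pow bi k • (Gk k · Gtk (m ∸ k)))))
               ⊕ (((c1 * c2) ⁻¹) • comm (Wq m) W0)
          Gtm : Mat n
          Gtm = Gm ⊕ ((c2 ⁻¹) • comm W0 (Wq m))
          Wm : Mat n
          Wm = ((b − 1#) ⁻¹) • commb b W0 Gm
          Wp : Mat n
          Wp = ((b − 1#) ⁻¹) • commb b Gm W1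

      table : ℕ → ℕ → Quad n
      table zero    = λ _ → quad W0 W1 Im Im
      table (suc m) = λ k → if k ≡ᵇ suc m then next (suc m) (table m) else table m k

    altQuad : ℕ → Quad n
    altQuad m = table m m

    G : ℕ → Mat n
    G m = Quad.Gq (altQuad m)

    G̃ : ℕ → Mat n
    G̃ m = Quad.Gtq (altQuad m)

  module _ {n d : ℕ} (Φ : TDSystem n d) where
    open TDSystem Φ

    rawComp : Kind → ℕ → Sub {n}
    rawComp [0,D]   i = span E i i
    rawComp [0*,D*] i = span E* i i
    rawComp [0*,0]  i = span E* 0 i ∩S span E 0 (d ∸ i)
    rawComp [0*,D]  i = span E* 0 i ∩S span E i d
    rawComp [D*,0]  i = span E* (d ∸ i) d ∩S span E 0 (d ∸ i)
    rawComp [D*,D]  i = span E* (d ∸ i) d ∩S span E i d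

    comp : Kind → ℕ → Sub {n}
    comp κ i = if i ≤ᵇ d then rawComp κ i else zeroSub

    compPrev : Kind → ℕ → Sub {n}
    compPrev κ zero    = zeroSub
    compPrev κ (suc i) = comp κ i

    lo mid hi tri : Kind → ℕ → Sub {n}
    lo  κ i = compPrev κ i +S comp κ i
    mid κ i = comp κ i
    hi  κ i = comp κ i +S comp κ (suc i)
    tri κ i = (compPrev κ i +S comp κ i) +S comp κ (suc i)

    GTarget : Kind → ℕ → Sub {n}
    GTarget [0,D]   = lo [0,D]
    GTarget [0*,D*] = lo [0*,D*]
    GTarget [0*,D]  = lo [0*,D]
    GTarget [0*,0]  = mid [0*,0]
    GTarget [D*,0]  = hi [D*,0]
    GTarget [D*,D]  = tri [D*,D]

    G̃Target : Kind → ℕ → Sub {n}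
    G̃Target [0,D]   = hi [0,D]
    G̃Target [0*,D*] = hi [0*,D*]
    G̃Target [0*,D]  = hi [0*,D]
    G̃Target [0*,0]  = tri [0*,0]
    G̃Target [D*,0]  = lo [D*,0]
    G̃Target [D*,D]  = mid [D*,D]

{-# OPTIONS --safe #-}
module Submission where

-- Write x, y for A, A* and g k, h k for G_k, G̃_k. The alternating elements
-- satisfy [x,[x,g k]_b] = [x,[h k,x]_b] = 0 and [y,[g k,y]_b] = [y,[y,h k]_b] = 0.
-- Comparing eigenvalues, E_i (g k) E_j = 0 unless j ∈ {i,i+1} and
-- E_i (h k) E_j = 0 unless i ∈ {j,j+1}, and likewise for the E*_i. Every
-- component of the six decompositions is an eigenspace or an intersection of a
-- member of a flag of sums of E*_iV with a member of a flag of sums of E_iV, so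
-- the inclusions follow once these flags are known to be transversal.
--
-- The relations are proved by induction on k. Taking brackets of the quadratic
-- relation that defines g n with x and y yields [x,g n] and [y,h n] in terms of
-- g (n-1) and h (n-1), via a telescoping identity for convolution sums. What is
-- missing is that g n commutes with γ = b y x - x y, a multiple of g 1. Both the
-- commutation rules and the quadratic relation express [g n,γ] as a multiple of
-- one and the same element Δ; the two coefficients differ by a factor that is
-- nonzero because b is not a root of unity, so Δ = 0.
--
-- The equality of F is neither decidable nor stable, so irreducibility only
-- shows that intersections of opposite flags are not nonzero. For the
-- projections P, Q onto opposite members this makes det (P - Q) nonzero, and
-- Cramer's rule then produces the splitting of a vector explicitly.

-- The commutation rules are governed by z = g 1 / (b-1): [x, g (k+1)] = b [x,z] g k - g k [x,z],
-- and similarly for y. They control commutators with x, y and their iterated brackets with z, but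
-- do not give [g n, z] directly. At level n a single unknown is left, Δ = [ψ (n-1) 0, z], where ψ i
-- j = x_i y_j - b y_j x_i for x and y bracketed i and j times with z. The computation uses only
-- central scalars and the cancellability of b^n - 1. It is therefore carried out in an arbitrary
-- ring, where each identity is checked by an ideal membership certificate free of denominators.
-- Matrices enter through the q-Serre relations, which are read off the tridiagonal block shape and
-- the geometric eigenvalues.

open import Level using (Level; _⊔_; lift) renaming (suc to lsuc)
open import Algebra.Bundles using (Ring)
import Algebra.Properties.CommutativeMonoid.Sum as CommutativeMonoidSum
import Algebra.Properties.Ring as RingProperties
import Algebra.Properties.Semiring.Exp as Exponentiation
import Algebra.Properties.Semiring.Sum as SemiringSum
open import Data.Bool using (Bool; true; false; if_then_else_; _∧_; not; _xor_) renaming (T to IsTrue)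
open import Data.Empty using (⊥; ⊥-elim)
open import Data.Fin using (Fin; toℕ; fromℕ<; opposite; inject₁) renaming (zero to fz; suc to fs)
open import Data.Fin.Permutation using (reverse)
open import Data.Fin.Properties using (toℕ-injective; toℕ-fromℕ<; toℕ<n; toℕ-inject₁; opposite-prop; opposite-involutive)
  renaming (_≟_ to _≟F_; suc-injective to fs-injective)
open import Data.List using (List; []; _∷_; _++_)
open import Data.Nat using (ℕ; zero; suc; _≤_; _<_; z≤n; s≤s; _∸_; _<?_; _≤?_; _≤ᵇ_; _<ᵇ_; _≡ᵇ_) renaming (_+_ to _+ℕ_)
import Data.Nat.Properties as ℕ
open import Data.Product using (Σ; ∃; _×_; _,_; proj₁; proj₂)
open import Data.Sum using (_⊎_; inj₁; inj₂)
open import Data.Unit using (tt)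
open import Data.Vec using (Vec; replicate) renaming ([] to []ᵛ; _∷_ to _∷ᵛ_)
open import Relation.Binary using (tri<; tri≈; tri>)
open import Relation.Binary.Bundles using (Setoid)
open import Relation.Binary.PropositionalEquality using (_≡_; _≢_)
  renaming (refl to ≡-refl; cong to ≡-cong; sym to ≡-sym; trans to ≡-trans; cong₂ to ≡-cong₂; subst to ≡-subst)
import Relation.Binary.Reasoning.Setoid as SetoidReasoning
open import Relation.Nullary using (¬_; Dec; does; yes; no)

-- Reflective proofs of identities in a noncommutative ring with central scalars

module NoncommutativeSolver {c ℓ} (R : Ring c ℓ) where
  open Ring R
  open RingProperties R using (-‿distribˡ-*; -‿distribʳ-*; -‿+-comm; -0#≈0#; -‿involutive; x≈y⇒x∙y⁻¹≈ε; x∙y⁻¹≈ε⇒x≈y)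
  open SetoidReasoning setoid

  Central : Carrier → Set (c ⊔ ℓ)
  Central a = ∀ x → a * x ≈ x * a

  infixl 6 _:+_ _:-_
  infixl 7 _:*_

  data Expr : Set where
    cvar var : ℕ → Expr
    :0 :1    : Expr
    _:+_ _:*_ _:-_ : Expr → Expr → Expr

  record Monomial : Set where
    constructor monomial
    field
      negative : Bool
      scalars  : List ℕ
      word     : List ℕ
  open Monomial

  _≡ˡ_ : List ℕ → List ℕ → Bool
  []       ≡ˡ []       = true
  (i ∷ is) ≡ˡ (j ∷ js) = (i ≡ᵇ j) ∧ (is ≡ˡ js)
  _        ≡ˡ _        = false

  ≡ˡ-sound : ∀ is js → IsTrue (is ≡ˡ js) → is ≡ js
  ≡ˡ-sound []       []       _ = ≡-refl
  ≡ˡ-sound (i ∷ is) (j ∷ js) p with i ≡ᵇ j in eq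
  ... | true = ≡-cong₂ _∷_ (ℕ.≡ᵇ⇒≡ i j (≡-T eq)) (≡ˡ-sound is js p)
    where
    ≡-T : ∀ {b} → b ≡ true → IsTrue b
    ≡-T ≡-refl = tt

  cancels : Monomial → Monomial → Bool
  cancels m m′ = (negative m xor negative m′) ∧ ((word m ≡ˡ word m′) ∧ (scalars m ≡ˡ scalars m′))

  -- Integer coefficients are represented by repetition, so deleting a pair of opposite monomials is
  -- the only simplification. The list is not a canonical form; only its emptiness is ever tested.
  insert : Monomial → List Monomial → List Monomial
  insert m []        = m ∷ []
  insert m (m′ ∷ ms) = if cancels m m′ then ms else m′ ∷ insert m ms

  collect : List Monomial → List Monomial → List Monomial
  collect []       acc = acc
  collect (m ∷ ms) acc = collect ms (insert m acc)

  -- Central scalars are kept sorted, so that products differing in their order become equal lists.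
  insertScalar : ℕ → List ℕ → List ℕ
  insertScalar i []       = i ∷ []
  insertScalar i (j ∷ js) = if i <ᵇ j then i ∷ j ∷ js else j ∷ insertScalar i js

  mergeScalars : List ℕ → List ℕ → List ℕ
  mergeScalars []       js = js
  mergeScalars (i ∷ is) js = insertScalar i (mergeScalars is js)

  mulMono : Monomial → Monomial → Monomial
  mulMono (monomial n s w) (monomial n′ s′ w′) = monomial (n xor n′) (mergeScalars s s′) (w ++ w′)

  mulMonos : Monomial → List Monomial → List Monomial
  mulMonos m []        = []
  mulMonos m (m′ ∷ ms) = mulMono m m′ ∷ mulMonos m ms

  mul : List Monomial → List Monomial → List Monomial
  mul []       ms′ = []
  mul (m ∷ ms) ms′ = mulMonos m ms′ ++ mul ms ms′

  negate : List Monomial → List Monomial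
  negate []                      = []
  negate (monomial n s w ∷ ms) = monomial (not n) s w ∷ negate ms

  normalise : Expr → List Monomial
  normalise (cvar i)  = monomial false (i ∷ []) [] ∷ []
  normalise (var i)   = monomial false [] (i ∷ []) ∷ []
  normalise :0        = []
  normalise :1        = monomial false [] [] ∷ []
  normalise (e :+ e′) = collect (normalise e) (normalise e′)
  normalise (e :* e′) = collect (mul (normalise e) (normalise e′)) []
  normalise (e :- e′) = collect (negate (normalise e′)) (normalise e)

  module Evaluation (γ : List (Σ Carrier Central)) (ρ : List Carrier) where

    lookupScalar : List (Σ Carrier Central) → ℕ → Carrier
    lookupScalar []            _       = 0#
    lookupScalar ((a , _) ∷ _) zero    = a
    lookupScalar (_ ∷ γ)       (suc i) = lookupScalar γ i

    lookupScalar-central : ∀ γ i → Central (lookupScalar γ i)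
    lookupScalar-central []            _       x = trans (zeroˡ x) (sym (zeroʳ x))
    lookupScalar-central ((_ , p) ∷ _) zero      = p
    lookupScalar-central (_ ∷ γ)       (suc i)   = lookupScalar-central γ i

    lookupVar : List Carrier → ℕ → Carrier
    lookupVar []      _       = 0#
    lookupVar (a ∷ _) zero    = a
    lookupVar (_ ∷ ρ) (suc i) = lookupVar ρ i

    ⟦_⟧ : Expr → Carrier
    ⟦ cvar i ⟧  = lookupScalar γ i
    ⟦ var i ⟧   = lookupVar ρ i
    ⟦ :0 ⟧      = 0#
    ⟦ :1 ⟧      = 1#
    ⟦ e :+ e′ ⟧ = ⟦ e ⟧ + ⟦ e′ ⟧
    ⟦ e :* e′ ⟧ = ⟦ e ⟧ * ⟦ e′ ⟧
    ⟦ e :- e′ ⟧ = ⟦ e ⟧ - ⟦ e′ ⟧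

    ⟦_⟧ˢ : List ℕ → Carrier
    ⟦ [] ⟧ˢ     = 1#
    ⟦ i ∷ is ⟧ˢ = lookupScalar γ i * ⟦ is ⟧ˢ

    ⟦_⟧ʷ : List ℕ → Carrier
    ⟦ [] ⟧ʷ     = 1#
    ⟦ i ∷ is ⟧ʷ = lookupVar ρ i * ⟦ is ⟧ʷ

    signed : Bool → Carrier → Carrier
    signed false a = a
    signed true  a = - a

    ⟦_⟧ᵐ : Monomial → Carrier
    ⟦ monomial n s w ⟧ᵐ = signed n (⟦ s ⟧ˢ * ⟦ w ⟧ʷ)

    ⟦_⟧ᵖ : List Monomial → Carrier
    ⟦ [] ⟧ᵖ     = 0#
    ⟦ m ∷ ms ⟧ᵖ = ⟦ m ⟧ᵐ + ⟦ ms ⟧ᵖ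

    T-split : ∀ b {b′} → IsTrue (b ∧ b′) → IsTrue b × IsTrue b′
    T-split true q = tt , q

    signed-cong : ∀ n {a a′} → a ≈ a′ → signed n a ≈ signed n a′
    signed-cong false p = p
    signed-cong true  p = -‿cong p

    cancels-sound : ∀ m m′ → IsTrue (cancels m m′) → ⟦ m ⟧ᵐ + ⟦ m′ ⟧ᵐ ≈ 0#
    cancels-sound (monomial n s w) (monomial n′ s′ w′) p
      with word-eq , scalar-eq ← T-split (w ≡ˡ w′) (proj₂ (T-split (n xor n′) p))
      with ≡-refl ← ≡ˡ-sound w w′ word-eq | ≡-refl ← ≡ˡ-sound s s′ scalar-eq
      = cancel n n′ (proj₁ (T-split (n xor n′) p))
      where
      cancel : ∀ n n′ → IsTrue (n xor n′) → signed n (⟦ s ⟧ˢ * ⟦ w ⟧ʷ) + signed n′ (⟦ s ⟧ˢ * ⟦ w ⟧ʷ) ≈ 0#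
      cancel false true  _ = -‿inverseʳ _
      cancel true  false _ = -‿inverseˡ _

    exchange : ∀ a b d → a + (b + d) ≈ b + (a + d)
    exchange a b d = trans (sym (+-assoc a b d)) (trans (+-congʳ (+-comm a b)) (+-assoc b a d))

    insert-sound : ∀ m ms → ⟦ insert m ms ⟧ᵖ ≈ ⟦ m ⟧ᵐ + ⟦ ms ⟧ᵖ
    insert-sound m []        = refl
    insert-sound m (m′ ∷ ms) with cancels m m′ in eq
    ... | true  = begin
      ⟦ ms ⟧ᵖ                       ≈⟨ +-identityˡ _ ⟨
      0# + ⟦ ms ⟧ᵖ                  ≈⟨ +-congʳ (cancels-sound m m′ (toT eq)) ⟨
      ⟦ m ⟧ᵐ + ⟦ m′ ⟧ᵐ + ⟦ ms ⟧ᵖ    ≈⟨ +-assoc _ _ _ ⟩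
      ⟦ m ⟧ᵐ + (⟦ m′ ⟧ᵐ + ⟦ ms ⟧ᵖ)  ∎
      where
      toT : ∀ {b} → b ≡ true → IsTrue b
      toT ≡-refl = tt
    ... | false = trans (+-congˡ (insert-sound m ms)) (exchange _ _ _)

    collect-sound : ∀ ms acc → ⟦ collect ms acc ⟧ᵖ ≈ ⟦ ms ⟧ᵖ + ⟦ acc ⟧ᵖ
    collect-sound []       acc = sym (+-identityˡ _)
    collect-sound (m ∷ ms) acc = begin
      ⟦ collect ms (insert m acc) ⟧ᵖ    ≈⟨ collect-sound ms (insert m acc) ⟩
      ⟦ ms ⟧ᵖ + ⟦ insert m acc ⟧ᵖ       ≈⟨ +-congˡ (insert-sound m acc) ⟩
      ⟦ ms ⟧ᵖ + (⟦ m ⟧ᵐ + ⟦ acc ⟧ᵖ)     ≈⟨ exchange _ _ _ ⟩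
      ⟦ m ⟧ᵐ + (⟦ ms ⟧ᵖ + ⟦ acc ⟧ᵖ)     ≈⟨ +-assoc _ _ _ ⟨
      ⟦ m ∷ ms ⟧ᵖ + ⟦ acc ⟧ᵖ            ∎

    ++-sound : ∀ ms ms′ → ⟦ ms ++ ms′ ⟧ᵖ ≈ ⟦ ms ⟧ᵖ + ⟦ ms′ ⟧ᵖ
    ++-sound []       ms′ = sym (+-identityˡ _)
    ++-sound (m ∷ ms) ms′ = trans (+-congˡ (++-sound ms ms′)) (sym (+-assoc _ _ _))

    insertScalar-sound : ∀ i js → ⟦ insertScalar i js ⟧ˢ ≈ lookupScalar γ i * ⟦ js ⟧ˢ
    insertScalar-sound i []       = refl
    insertScalar-sound i (j ∷ js) with i <ᵇ j
    ... | true  = refl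
    ... | false = begin
      b * ⟦ insertScalar i js ⟧ˢ  ≈⟨ *-congˡ (insertScalar-sound i js) ⟩
      b * (a * ⟦ js ⟧ˢ)           ≈⟨ *-assoc _ _ _ ⟨
      b * a * ⟦ js ⟧ˢ             ≈⟨ *-congʳ (lookupScalar-central γ j a) ⟩
      a * b * ⟦ js ⟧ˢ             ≈⟨ *-assoc _ _ _ ⟩
      a * (b * ⟦ js ⟧ˢ)           ∎
      where
      a = lookupScalar γ i
      b = lookupScalar γ j

    mergeScalars-sound : ∀ is js → ⟦ mergeScalars is js ⟧ˢ ≈ ⟦ is ⟧ˢ * ⟦ js ⟧ˢ
    mergeScalars-sound []       js = sym (*-identityˡ _)
    mergeScalars-sound (i ∷ is) js = trans (insertScalar-sound i (mergeScalars is js))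
      (trans (*-congˡ (mergeScalars-sound is js)) (sym (*-assoc _ _ _)))

    scalars-central : ∀ is → Central ⟦ is ⟧ˢ
    scalars-central []       x = trans (*-identityˡ x) (sym (*-identityʳ x))
    scalars-central (i ∷ is) x = begin
      a * ⟦ is ⟧ˢ * x    ≈⟨ *-assoc _ _ _ ⟩
      a * (⟦ is ⟧ˢ * x)  ≈⟨ *-congˡ (scalars-central is x) ⟩
      a * (x * ⟦ is ⟧ˢ)  ≈⟨ *-assoc _ _ _ ⟨
      a * x * ⟦ is ⟧ˢ    ≈⟨ *-congʳ (lookupScalar-central γ i x) ⟩
      x * a * ⟦ is ⟧ˢ    ≈⟨ *-assoc _ _ _ ⟩
      x * (a * ⟦ is ⟧ˢ)  ∎
      where a = lookupScalar γ i

    words-sound : ∀ is js → ⟦ is ++ js ⟧ʷ ≈ ⟦ is ⟧ʷ * ⟦ js ⟧ʷ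
    words-sound []       js = sym (*-identityˡ _)
    words-sound (i ∷ is) js = trans (*-congˡ (words-sound is js)) (sym (*-assoc _ _ _))

    signed-mul : ∀ n n′ a b → signed (n xor n′) (a * b) ≈ signed n a * signed n′ b
    signed-mul false false a b = refl
    signed-mul false true  a b = -‿distribʳ-* a b
    signed-mul true  false a b = -‿distribˡ-* a b
    signed-mul true  true  a b = sym (trans (sym (-‿distribˡ-* a (- b)))
      (trans (-‿cong (sym (-‿distribʳ-* a b))) (-‿involutive _)))

    mulMono-sound : ∀ m m′ → ⟦ mulMono m m′ ⟧ᵐ ≈ ⟦ m ⟧ᵐ * ⟦ m′ ⟧ᵐ
    mulMono-sound (monomial n s w) (monomial n′ s′ w′) = trans
      (signed-cong (n xor n′) (begin
        ⟦ mergeScalars s s′ ⟧ˢ * ⟦ w ++ w′ ⟧ʷ        ≈⟨ *-cong (mergeScalars-sound s s′) (words-sound w w′) ⟩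
        ⟦ s ⟧ˢ * ⟦ s′ ⟧ˢ * (⟦ w ⟧ʷ * ⟦ w′ ⟧ʷ)        ≈⟨ *-assoc _ _ _ ⟩
        ⟦ s ⟧ˢ * (⟦ s′ ⟧ˢ * (⟦ w ⟧ʷ * ⟦ w′ ⟧ʷ))      ≈⟨ *-congˡ (*-assoc _ _ _) ⟨
        ⟦ s ⟧ˢ * (⟦ s′ ⟧ˢ * ⟦ w ⟧ʷ * ⟦ w′ ⟧ʷ)        ≈⟨ *-congˡ (*-congʳ (scalars-central s′ _)) ⟩
        ⟦ s ⟧ˢ * (⟦ w ⟧ʷ * ⟦ s′ ⟧ˢ * ⟦ w′ ⟧ʷ)        ≈⟨ *-congˡ (*-assoc _ _ _) ⟩
        ⟦ s ⟧ˢ * (⟦ w ⟧ʷ * (⟦ s′ ⟧ˢ * ⟦ w′ ⟧ʷ))      ≈⟨ *-assoc _ _ _ ⟨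
        ⟦ s ⟧ˢ * ⟦ w ⟧ʷ * (⟦ s′ ⟧ˢ * ⟦ w′ ⟧ʷ)        ∎))
      (signed-mul n n′ _ _)

    mulMonos-sound : ∀ m ms → ⟦ mulMonos m ms ⟧ᵖ ≈ ⟦ m ⟧ᵐ * ⟦ ms ⟧ᵖ
    mulMonos-sound m []        = sym (zeroʳ _)
    mulMonos-sound m (m′ ∷ ms) = trans (+-cong (mulMono-sound m m′) (mulMonos-sound m ms)) (sym (distribˡ _ _ _))

    mul-sound : ∀ ms ms′ → ⟦ mul ms ms′ ⟧ᵖ ≈ ⟦ ms ⟧ᵖ * ⟦ ms′ ⟧ᵖ
    mul-sound []       ms′ = sym (zeroˡ _)
    mul-sound (m ∷ ms) ms′ = begin
      ⟦ mulMonos m ms′ ++ mul ms ms′ ⟧ᵖ              ≈⟨ ++-sound (mulMonos m ms′) _ ⟩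
      ⟦ mulMonos m ms′ ⟧ᵖ + ⟦ mul ms ms′ ⟧ᵖ          ≈⟨ +-cong (mulMonos-sound m ms′) (mul-sound ms ms′) ⟩
      ⟦ m ⟧ᵐ * ⟦ ms′ ⟧ᵖ + ⟦ ms ⟧ᵖ * ⟦ ms′ ⟧ᵖ         ≈⟨ distribʳ _ _ _ ⟨
      ⟦ m ∷ ms ⟧ᵖ * ⟦ ms′ ⟧ᵖ                         ∎

    signed-not : ∀ n a → signed (not n) a ≈ - signed n a
    signed-not false a = refl
    signed-not true  a = sym (-‿involutive a)

    negate-sound : ∀ ms → ⟦ negate ms ⟧ᵖ ≈ - ⟦ ms ⟧ᵖ
    negate-sound []                    = sym -0#≈0#
    negate-sound (monomial n s w ∷ ms) = trans (+-cong (signed-not n _) (negate-sound ms)) (-‿+-comm _ _)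

    normalise-sound : ∀ e → ⟦ normalise e ⟧ᵖ ≈ ⟦ e ⟧
    normalise-sound (cvar i)  = trans (+-identityʳ _) (trans (*-identityʳ _) (*-identityʳ _))
    normalise-sound (var i)   = trans (+-identityʳ _) (trans (*-identityˡ _) (*-identityʳ _))
    normalise-sound :0        = refl
    normalise-sound :1        = trans (+-identityʳ _) (*-identityˡ _)
    normalise-sound (e :+ e′) = trans (collect-sound (normalise e) _) (+-cong (normalise-sound e) (normalise-sound e′))
    normalise-sound (e :* e′) = trans (collect-sound (mul (normalise e) (normalise e′)) [])
      (trans (+-identityʳ _) (trans (mul-sound (normalise e) (normalise e′)) (*-cong (normalise-sound e) (normalise-sound e′))))
    normalise-sound (e :- e′) = begin
      ⟦ collect (negate (normalise e′)) (normalise e) ⟧ᵖ  ≈⟨ collect-sound (negate (normalise e′)) _ ⟩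
      ⟦ negate (normalise e′) ⟧ᵖ + ⟦ normalise e ⟧ᵖ       ≈⟨ +-comm _ _ ⟩
      ⟦ normalise e ⟧ᵖ + ⟦ negate (normalise e′) ⟧ᵖ       ≈⟨ +-cong (normalise-sound e) (trans (negate-sound (normalise e′)) (-‿cong (normalise-sound e′))) ⟩
      ⟦ e ⟧ - ⟦ e′ ⟧                                      ∎

    solve : ∀ e e′ → normalise (e :- e′) ≡ [] → ⟦ e ⟧ ≈ ⟦ e′ ⟧
    solve e e′ p = x∙y⁻¹≈ε⇒x≈y _ _ (trans (sym (normalise-sound (e :- e′))) (empty p))
      where
      empty : ∀ {ms} → ms ≡ [] → ⟦ ms ⟧ᵖ ≈ 0#
      empty ≡-refl = refl

    -- A two-sided multiple `left` (`lhs` - `rhs`) `right` of a known equation: one summand of an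
    -- ideal membership certificate.
    record Multiple : Set ℓ where
      constructor _⟨_≋_∣_⟩_
      field
        left lhs rhs : Expr
        equation     : ⟦ lhs ⟧ ≈ ⟦ rhs ⟧
        right        : Expr
    infix 4 _⟨_≋_∣_⟩_

    total : List Multiple → Expr
    total []                            = :0
    total ((l ⟨ p ≋ q ∣ _ ⟩ r) ∷ hyps) = l :* (p :- q) :* r :+ total hyps

    total-vanishes : ∀ hyps → ⟦ total hyps ⟧ ≈ 0#
    total-vanishes []                             = refl
    total-vanishes ((l ⟨ p ≋ q ∣ p≈q ⟩ r) ∷ hyps) = begin
      ⟦ l ⟧ * (⟦ p ⟧ - ⟦ q ⟧) * ⟦ r ⟧ + ⟦ total hyps ⟧  ≈⟨ +-cong (*-congʳ (*-congˡ (x≈y⇒x∙y⁻¹≈ε p≈q))) (total-vanishes hyps) ⟩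
      ⟦ l ⟧ * 0# * ⟦ r ⟧ + 0#                          ≈⟨ +-identityʳ _ ⟩
      ⟦ l ⟧ * 0# * ⟦ r ⟧                               ≈⟨ *-congʳ (zeroʳ _) ⟩
      0# * ⟦ r ⟧                                       ≈⟨ zeroˡ _ ⟩
      0#                                               ∎

    -- Proves e ≈ e′ from an explicit certificate that e - e′ lies in the
    -- two-sided ideal generated by the given equations.
    solveModulo : ∀ e e′ hyps → normalise (e :- e′ :- total hyps) ≡ [] → ⟦ e ⟧ ≈ ⟦ e′ ⟧
    solveModulo e e′ hyps p = x∙y⁻¹≈ε⇒x≈y _ _ (trans
      (solve (e :- e′) (total hyps) p) (total-vanishes hyps))

-- Sums over k + l = m

module Convolution {c ℓ} (R : Ring c ℓ) where
  open Ring R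
  open SetoidReasoning setoid
  open NoncommutativeSolver R

  conv : ℕ → (ℕ → ℕ → Carrier) → Carrier
  conv zero    f = f 0 0
  conv (suc m) f = f 0 (suc m) + conv m (λ k l → f (suc k) l)

  conv-cong : ∀ m {f f′} → (∀ k l → k +ℕ l ≡ m → f k l ≈ f′ k l) → conv m f ≈ conv m f′
  conv-cong zero    p = p 0 0 ≡-refl
  conv-cong (suc m) p = +-cong (p 0 (suc m) ≡-refl) (conv-cong m (λ k l q → p (suc k) l (≡-cong suc q)))

  -- Inductive hypotheses cover every index below the current level, so exactly one end term is out
  -- of reach. It is kept as an explicit correction.
  conv-congFirst : ∀ m {f f′} → (∀ k l → suc k +ℕ l ≡ m → f (suc k) l ≈ f′ (suc k) l) →
                   conv m f ≈ conv m f′ + (f 0 m - f′ 0 m)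
  conv-congFirst zero    {f} {f′} p = solve (var 0) (var 1 :+ (var 0 :- var 1)) ≡-refl
    where open Evaluation [] (f 0 0 ∷ f′ 0 0 ∷ [])
  conv-congFirst (suc m) {f} {f′} p = trans (+-congˡ (conv-cong m (λ k l q → p k l (≡-cong suc q))))
    (solve (var 0 :+ var 2) (var 1 :+ var 2 :+ (var 0 :- var 1)) ≡-refl)
    where open Evaluation [] (f 0 (suc m) ∷ f′ 0 (suc m) ∷ conv m (λ k l → f′ (suc k) l) ∷ [])

  conv-congLast : ∀ m {f f′} → (∀ k l → k +ℕ suc l ≡ m → f k (suc l) ≈ f′ k (suc l)) →
                  conv m f ≈ conv m f′ + (f m 0 - f′ m 0)
  conv-congLast zero    {f} {f′} p = solve (var 0) (var 1 :+ (var 0 :- var 1)) ≡-refl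
    where open Evaluation [] (f 0 0 ∷ f′ 0 0 ∷ [])
  conv-congLast (suc m) p = trans
    (+-cong (p 0 m ≡-refl) (conv-congLast m (λ k l q → p (suc k) l (≡-cong suc q)))) (sym (+-assoc _ _ _))

  conv-last : ∀ m f → conv (suc m) f ≈ conv m (λ k l → f k (suc l)) + f (suc m) 0
  conv-last zero    f = refl
  conv-last (suc m) f = trans (+-congˡ (conv-last m (λ k l → f (suc k) l))) (sym (+-assoc _ _ _))

  conv-+ : ∀ m f f′ → conv m (λ k l → f k l + f′ k l) ≈ conv m f + conv m f′
  conv-+ zero    f f′ = refl
  conv-+ (suc m) f f′ = trans (+-congˡ (conv-+ m _ _))
    (solve (var 0 :+ var 1 :+ (var 2 :+ var 3)) (var 0 :+ var 2 :+ (var 1 :+ var 3)) ≡-refl)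
    where open Evaluation [] (f 0 (suc m) ∷ f′ 0 (suc m) ∷ conv m (λ k l → f (suc k) l) ∷ conv m (λ k l → f′ (suc k) l) ∷ [])

  conv-- : ∀ m f f′ → conv m (λ k l → f k l - f′ k l) ≈ conv m f - conv m f′
  conv-- zero    f f′ = refl
  conv-- (suc m) f f′ = trans (+-congˡ (conv-- m _ _))
    (solve (var 0 :- var 1 :+ (var 2 :- var 3)) (var 0 :+ var 2 :- (var 1 :+ var 3)) ≡-refl)
    where open Evaluation [] (f 0 (suc m) ∷ f′ 0 (suc m) ∷ conv m (λ k l → f (suc k) l) ∷ conv m (λ k l → f′ (suc k) l) ∷ [])

  conv-*ˡ : ∀ m a f → a * conv m f ≈ conv m (λ k l → a * f k l)
  conv-*ˡ zero    a f = refl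
  conv-*ˡ (suc m) a f = trans (distribˡ _ _ _) (+-congˡ (conv-*ˡ m a _))

  conv-*ʳ : ∀ m a f → conv m f * a ≈ conv m (λ k l → f k l * a)
  conv-*ʳ zero    a f = refl
  conv-*ʳ (suc m) a f = trans (distribʳ _ _ _) (+-congˡ (conv-*ʳ m a _))

  conv-0 : ∀ m {f} → (∀ k l → k +ℕ l ≡ m → f k l ≈ 0#) → conv m f ≈ 0#
  conv-0 zero    p = p 0 0 ≡-refl
  conv-0 (suc m) p = trans (+-cong (p 0 (suc m) ≡-refl) (conv-0 m (λ k l q → p (suc k) l (≡-cong suc q)))) (+-identityˡ 0#)

-- Ring identities behind one step of the induction

module LevelIdentities {c ℓ} (R : Ring c ℓ)
  (b : Ring.Carrier R) (b-central : NoncommutativeSolver.Central R b) where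
  open Ring R
  open NoncommutativeSolver R

  bracket : Carrier → Carrier → Carrier
  bracket p q = p * q - q * p

  bracketᵇ : Carrier → Carrier → Carrier
  bracketᵇ p q = b * p * q - q * p

  B : Expr
  B = cvar 0

  :bracket :bracketᵇ : Expr → Expr → Expr
  :bracket p q  = p :* q :- q :* p
  :bracketᵇ p q = B :* p :* q :- q :* p

  scalars : List (Σ Carrier Central)
  scalars = (b , b-central) ∷ []

  module _ (x y g : Carrier) where
    private
      γ = bracketᵇ y x
      ξ = bracket x γ
      η = bracket γ y
      :x = var 0
      :y = var 1
      :g = var 2
      :γ = :bracketᵇ :y :x
      :ξ = :bracket :x :γ
      :η = :bracket :γ :y
      :ad = :bracket :x (:bracketᵇ :x :g)
      :adʸ = :bracket :y (:bracketᵇ :g :y)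
    open Evaluation scalars (x ∷ y ∷ g ∷ [])

    -- The two sides differ by exactly [γ, g].
    bracket-exchange : bracket γ g ≈ 0# → bracket x (bracketᵇ g y) ≈ bracket (bracketᵇ x g) y
    bracket-exchange p = solveModulo (:bracket :x (:bracketᵇ :g :y)) (:bracket (:bracketᵇ :x :g) :y)
      ((:1 ⟨ :bracket :γ :g ≋ :0 ∣ p ⟩ :1) ∷ []) ≡-refl

    -- Put w = [x,g]_b and d = [x,[g,y]_b]. By the exchange d = [w,y]; as w commutes with x, b d x -
    -- x d = [w,γ], and γ passes through g.
    bracketᵇ-reduce : bracket x (bracketᵇ x g) ≈ 0# → bracket γ g ≈ 0# →
      bracketᵇ (bracket x (bracketᵇ g y)) x ≈ b * ξ * g - g * ξ
    bracketᵇ-reduce p q = solveModulo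
      (:bracketᵇ (:bracket :x (:bracketᵇ :g :y)) :x) (B :* :ξ :* :g :- :g :* :ξ)
      ( (B :* :y ⟨ :ad ≋ :0 ∣ p ⟩ :1)
      ∷ (B :+ :1 ⟨ :bracket :γ :g ≋ :0 ∣ q ⟩ :x)
      ∷ (:0 :- (B :+ :1) :* :x ⟨ :bracket :γ :g ≋ :0 ∣ q ⟩ :1)
      ∷ (:0 :- :1 ⟨ :ad ≋ :0 ∣ p ⟩ :y) ∷ []) ≡-refl

    -- Put v = [g,y]_b, so that the inner bracket is d = [x,v]. As v commutes with y, b y d - d y =
    -- [γ,v].
    bracketᵇ-reduceʸ : bracket y (bracketᵇ g y) ≈ 0# → bracket γ g ≈ 0# →
      bracketᵇ y (bracket (bracketᵇ x g) y) ≈ b * g * η - η * g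
    bracketᵇ-reduceʸ p q = solveModulo
      (:bracketᵇ :y (:bracket (:bracketᵇ :x :g) :y)) (B :* :g :* :η :- :η :* :g)
      ( (:0 :- :1 ⟨ :adʸ ≋ :0 ∣ p ⟩ B :* :x)
      ∷ (:0 :- (B :+ :1) :* :y ⟨ :bracket :γ :g ≋ :0 ∣ q ⟩ :1)
      ∷ ((B :+ :1) ⟨ :bracket :γ :g ≋ :0 ∣ q ⟩ :y)
      ∷ (:x ⟨ :adʸ ≋ :0 ∣ p ⟩ :1) ∷ []) ≡-refl

    Bsq : Expr
    Bsq = B :* B :+ B :+ :1

    -- By the reduction and ξ x = b x ξ, the double bracket equals b [ξ,[x,g]]. Applying the
    -- derivation ad γ to [x,[x,g]_b] = 0 gives (b+1) [ξ,[x,g]] = 0, which is the origin of the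
    -- factor b+1.
    serre-step : bracketᵇ x ξ ≈ 0# → bracket x (bracketᵇ x g) ≈ 0# → bracket γ g ≈ 0# →
      (b + 1#) * bracketᵇ x (bracketᵇ (bracket x (bracketᵇ g y)) x) ≈ 0#
    serre-step s p q = solveModulo ((B :+ :1) :* :bracketᵇ :x (:bracketᵇ (:bracket :x (:bracketᵇ :g :y)) :x)) :0
      ( (B :* B ⟨ :s ≋ :0 ∣ s ⟩ :g)
      ∷ (:0 :- B :* B :* :y :* :x ⟨ :ad ≋ :0 ∣ p ⟩ :1)
      ∷ (:0 :- (B :+ :1) :* B :* :y ⟨ :ad ≋ :0 ∣ p ⟩ :x)
      ∷ (:0 :- Bsq ⟨ :bracket :γ :g ≋ :0 ∣ q ⟩ :x :* :x)
      ∷ (B :* Bsq :* :x :* :y ⟨ :ad ≋ :0 ∣ p ⟩ :1)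
      ∷ ((B :+ :1) :* Bsq :* :x ⟨ :bracket :γ :g ≋ :0 ∣ q ⟩ :x)
      ∷ (:0 :- B :* Bsq :* :x :* :x ⟨ :bracket :γ :g ≋ :0 ∣ q ⟩ :1)
      ∷ (Bsq ⟨ :ad ≋ :0 ∣ p ⟩ :y :* :x)
      ∷ (:0 :- B ⟨ :ad ≋ :0 ∣ p ⟩ :x :* :y)
      ∷ (:0 :- (B :+ :1) :* B :* :x ⟨ :ad ≋ :0 ∣ p ⟩ :y)
      ∷ (:0 :- :g ⟨ :s ≋ :0 ∣ s ⟩ :1) ∷ []) ≡-refl
      where :s = :bracketᵇ :x :ξ

module WeightedSums {c ℓ} (R : Ring c ℓ) (b b⁻¹ ρ : Ring.Carrier R)
  (b-central : NoncommutativeSolver.Central R b)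
  (b⁻¹-central : NoncommutativeSolver.Central R b⁻¹)
  (ρ-central : NoncommutativeSolver.Central R ρ)
  (b*b⁻¹≈1 : Ring._≈_ R (Ring._*_ R b b⁻¹) (Ring.1# R)) where
  open Ring R
  open NoncommutativeSolver R
  open LevelIdentities R b b-central using (bracket; bracketᵇ; B; :bracket; :bracketᵇ) public
  open Convolution R public
  open Exponentiation semiring public using (_^_)
  open SetoidReasoning setoid

  B⁻ P : Expr
  B⁻ = cvar 1
  P  = cvar 2

  weight : ℕ → Carrier
  weight k = b⁻¹ ^ k

  weight-central : ∀ k → Central (weight k)
  weight-central zero    a = trans (*-identityˡ a) (sym (*-identityʳ a))
  weight-central (suc k) a = solveModulo (cvar 1 :* var 1 :* var 0) (var 0 :* (cvar 1 :* var 1))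
    ((cvar 1 ⟨ var 1 :* var 0 ≋ var 0 :* var 1 ∣ weight-central k a ⟩ :1) ∷ []) ≡-refl
    where open Evaluation ((b , b-central) ∷ (b⁻¹ , b⁻¹-central) ∷ []) (a ∷ weight k ∷ [])

  scalars : List (Σ Carrier Central)
  scalars = (b , b-central) ∷ (b⁻¹ , b⁻¹-central) ∷ (ρ , ρ-central) ∷ []

  weighted : ℕ → List (Σ Carrier Central)
  weighted k = scalars ++ (weight k , weight-central k) ∷ []

  β : Expr
  β = cvar 3

  <-fromʳ : ∀ {k l m} → k +ℕ suc l ≡ m → k < m
  <-fromʳ {k} ≡-refl = ℕ.m<m+n k (s≤s z≤n)

  <-fromˡ : ∀ {k l m} → suc k +ℕ l ≡ m → l < m
  <-fromˡ {k} {l} ≡-refl = s≤s (ℕ.m≤n+m l k)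

  ≤-fromʳ : ∀ {k l m} → k +ℕ l ≡ m → k ≤ m
  ≤-fromʳ {k} ≡-refl = ℕ.m≤m+n k _

  ≤-fromˡ : ∀ {k l m} → k +ℕ l ≡ m → l ≤ m
  ≤-fromˡ {k} ≡-refl = ℕ.m≤n+m _ k

  module _ (x γ : Carrier) (g : ℕ → Carrier) (g₀≈1 : g 0 ≈ 1#) where

    -- Equal to both [x,p]_b q - p [x,q]_b and b [x,p] q - p [x,q]. The first form arises from the
    -- quadratic relation, the second is adapted to the commutation rule.
    Θ : Carrier → Carrier → Carrier
    Θ p q = b * x * p * q - (b + 1#) * p * x * q + p * q * x

    ΘSum : ℕ → Carrier
    ΘSum m = conv m (λ k l → weight k * Θ (g k) (g l))

    private
      z x₁ : Carrier
      z  = ρ * γ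
      x₁ = bracket x z

    ΘSum-zero : ΘSum 0 ≈ 0#
    ΘSum-zero = trans (*-identityˡ _) (solveModulo
        (B :* var 0 :* var 1 :* var 1 :- (B :+ :1) :* var 1 :* var 0 :* var 1 :+ var 1 :* var 1 :* var 0) :0
        ( (:0 :- :1 ⟨ var 1 ≋ :1 ∣ g₀≈1 ⟩ var 0 :* var 1)
        ∷ (:0 :- B ⟨ var 1 ≋ :1 ∣ g₀≈1 ⟩ var 0 :* var 1)
        ∷ (B :* var 0 ⟨ var 1 ≋ :1 ∣ g₀≈1 ⟩ var 1)
        ∷ (:0 :- var 0 ⟨ var 1 ≋ :1 ∣ g₀≈1 ⟩ :1)
        ∷ (:1 ⟨ var 1 ≋ :1 ∣ g₀≈1 ⟩ var 0)
        ∷ (var 1 ⟨ var 1 ≋ :1 ∣ g₀≈1 ⟩ var 0) ∷ []) ≡-refl)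
      where open Evaluation scalars (x ∷ g 0 ∷ [])

    -- The commutation rule turns the sum for suc m into the bracket of the
    -- sum for m with z, except at the two ends, where g (suc m) enters.
    ΘSum-suc : ∀ m →
      (∀ k → k < m → bracket x (g (suc k)) ≈ b * x₁ * g k - g k * x₁) →
      (∀ k → k ≤ m → bracket γ (g k) ≈ 0#) →
      ΘSum m ≈ 0# →
      ΘSum (suc m) ≈ (b * weight (suc m) - 1#) * (bracket x (g (suc m)) - (b * x₁ * g m - g m * x₁))
    ΘSum-suc m rule γ-comm Θ≈0 = begin
      ΘSum (suc m)                                      ≈⟨ conv-cong (suc m) (λ k l _ → splitΘ k l) ⟩
      conv (suc m) (λ k l → F k l - F′ k l)             ≈⟨ conv-- (suc m) F F′ ⟩
      conv (suc m) F - conv (suc m) F′                  ≈⟨ +-cong F-sum (-‿cong F′-sum) ⟩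
      (conv m Ĝ + (G m 0 - Ĝ m 0)) - (conv m Ĝ′ + (G′ 0 m - Ĝ′ 0 m))
                                                        ≈⟨ finish ⟩
      (b * weight (suc m) - 1#) * (A (suc m) - Â (suc m)) ∎
      where
      A Â : ℕ → Carrier
      A k = bracket x (g k)
      Â zero    = 0#
      Â (suc k) = b * x₁ * g k - g k * x₁

      F F′ G G′ Ĝ Ĝ′ : ℕ → ℕ → Carrier
      F  k l = weight k * (b * A k * g l)
      F′ k l = weight k * (g k * A l)
      G  k l = weight k * (A (suc k) * g l)
      G′ k l = weight k * (g k * A (suc l))
      Ĝ  k l = weight k * (Â (suc k) * g l)
      Ĝ′ k l = weight k * (g k * Â (suc l))

      splitΘ : ∀ k l → weight k * Θ (g k) (g l) ≈ F k l - F′ k l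
      splitΘ k l = solve
        (β :* (B :* X :* p :* q :- (B :+ :1) :* p :* X :* q :+ p :* q :* X))
        (β :* (B :* :bracket X p :* q) :- β :* (p :* :bracket X q)) ≡-refl
        where
        open Evaluation (weighted k) (x ∷ g k ∷ g l ∷ [])
        X = var 0
        p = var 1
        q = var 2

      A₀≈0 : A 0 ≈ 0#
      A₀≈0 = solveModulo (:bracket (var 0) (var 1)) :0
        ((var 0 ⟨ var 1 ≋ :1 ∣ g₀≈1 ⟩ :1) ∷ (:0 :- :1 ⟨ var 1 ≋ :1 ∣ g₀≈1 ⟩ var 0) ∷ []) ≡-refl
        where open Evaluation [] (x ∷ g 0 ∷ [])

      F-sum : conv (suc m) F ≈ conv m Ĝ + (G m 0 - Ĝ m 0)
      F-sum = begin
        F 0 (suc m) + conv m (λ k l → F (suc k) l)  ≈⟨ +-cong F₀≈0 (conv-cong m (λ k l _ → shift k l)) ⟩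
        0# + conv m G                               ≈⟨ +-identityˡ _ ⟩
        conv m G                                    ≈⟨ conv-congLast m (λ k l q → *-congˡ (*-congʳ (rule k (<-fromʳ q)))) ⟩
        conv m Ĝ + (G m 0 - Ĝ m 0)                  ∎
        where
        F₀≈0 : F 0 (suc m) ≈ 0#
        F₀≈0 = solveModulo (var 0 :* (var 1 :* var 2 :* var 3)) :0
          ((var 0 :* var 1 ⟨ var 2 ≋ :0 ∣ A₀≈0 ⟩ var 3) ∷ []) ≡-refl
          where open Evaluation [] (weight 0 ∷ b ∷ A 0 ∷ g (suc m) ∷ [])
        shift : ∀ k l → F (suc k) l ≈ G k l
        shift k l = solveModulo (B⁻ :* β :* (B :* var 0 :* var 1)) (β :* (var 0 :* var 1))
          ((β ⟨ B :* B⁻ ≋ :1 ∣ b*b⁻¹≈1 ⟩ var 0 :* var 1) ∷ []) ≡-refl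
          where open Evaluation (weighted k) (A (suc k) ∷ g l ∷ [])

      F′-sum : conv (suc m) F′ ≈ conv m Ĝ′ + (G′ 0 m - Ĝ′ 0 m)
      F′-sum = begin
        conv (suc m) F′              ≈⟨ conv-last m F′ ⟩
        conv m G′ + F′ (suc m) 0     ≈⟨ +-congˡ (trans (*-congˡ (trans (*-congˡ A₀≈0) (zeroʳ _))) (zeroʳ _)) ⟩
        conv m G′ + 0#               ≈⟨ +-identityʳ _ ⟩
        conv m G′                    ≈⟨ conv-congFirst m (λ k l q → *-congˡ (*-congˡ (rule l (<-fromˡ q)))) ⟩
        conv m Ĝ′ + (G′ 0 m - Ĝ′ 0 m) ∎

      -- z commutes with every g of index at most m, so bracketing Θ with z affects only its single
      -- letter x.
      bracketΘ : ∀ k l → k +ℕ l ≡ m → Ĝ k l - Ĝ′ k l ≈ bracket (weight k * Θ (g k) (g l)) z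
      bracketΘ k l eq = solveModulo
        (β :* ((B :* X₁ :* p :- p :* X₁) :* q) :- β :* (p :* (B :* X₁ :* q :- q :* X₁)))
        (:bracket (β :* (B :* X :* p :* q :- (B :+ :1) :* p :* X :* q :+ p :* q :* X)) Z)
        ( (:0 :- β :* P :* B :* X ⟨ :bracket Γ p ≋ :0 ∣ γ-comm k (≤-fromʳ eq) ⟩ (:0 :- q))
        ∷ (β :* P :* B :* X :* p ⟨ :bracket Γ q ≋ :0 ∣ γ-comm l (≤-fromˡ eq) ⟩ :1)
        ∷ (:0 :- β :* P :* (B :+ :1) ⟨ :bracket Γ p ≋ :0 ∣ γ-comm k (≤-fromʳ eq) ⟩ X :* q)
        ∷ (:0 :- β :* P :* (B :+ :1) :* p :* X ⟨ :bracket Γ q ≋ :0 ∣ γ-comm l (≤-fromˡ eq) ⟩ :1)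
        ∷ (β :* P ⟨ :bracket Γ p ≋ :0 ∣ γ-comm k (≤-fromʳ eq) ⟩ q :* X)
        ∷ (β :* P :* p ⟨ :bracket Γ q ≋ :0 ∣ γ-comm l (≤-fromˡ eq) ⟩ X) ∷ []) ≡-refl
        where
        open Evaluation (weighted k) (x ∷ γ ∷ g k ∷ g l ∷ [])
        X  = var 0
        Γ  = var 1
        Z  = P :* Γ
        X₁ = :bracket X Z
        p  = var 2
        q  = var 3

      inner≈0 : conv m Ĝ - conv m Ĝ′ ≈ 0#
      inner≈0 = begin
        conv m Ĝ - conv m Ĝ′                               ≈⟨ conv-- m Ĝ Ĝ′ ⟨
        conv m (λ k l → Ĝ k l - Ĝ′ k l)                    ≈⟨ conv-cong m bracketΘ ⟩
        conv m (λ k l → T k l * z - z * T k l)             ≈⟨ conv-- m _ _ ⟩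
        conv m (λ k l → T k l * z) - conv m (λ k l → z * T k l) ≈⟨ +-cong (conv-*ʳ m z T) (-‿cong (conv-*ˡ m z T)) ⟨
        ΘSum m * z - z * ΘSum m                            ≈⟨ +-cong (*-congʳ Θ≈0) (-‿cong (*-congˡ Θ≈0)) ⟩
        0# * z - z * 0#                                    ≈⟨ solve (:0 :* var 0 :- var 0 :* :0) :0 ≡-refl ⟩
        0#                                                 ∎
        where
        open Evaluation [] (z ∷ [])
        T : ℕ → ℕ → Carrier
        T k l = weight k * Θ (g k) (g l)

      finish : (conv m Ĝ + (G m 0 - Ĝ m 0)) - (conv m Ĝ′ + (G′ 0 m - Ĝ′ 0 m)) ≈
               (b * weight (suc m) - 1#) * (A (suc m) - Â (suc m))
      finish = solveModulo
        ((var 0 :+ (β :* (var 2 :* var 4) :- β :* (var 3 :* var 4))) :-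
         (var 1 :+ (:1 :* (var 4 :* var 2) :- :1 :* (var 4 :* var 3))))
        ((B :* (B⁻ :* β) :- :1) :* (var 2 :- var 3))
        ( (:1 ⟨ var 0 :- var 1 ≋ :0 ∣ inner≈0 ⟩ :1)
        ∷ (β :* (var 2 :- var 3) ⟨ var 4 ≋ :1 ∣ g₀≈1 ⟩ :1)
        ∷ (:0 :- :1 ⟨ var 4 ≋ :1 ∣ g₀≈1 ⟩ (var 2 :- var 3))
        ∷ (:0 :- β ⟨ B :* B⁻ ≋ :1 ∣ b*b⁻¹≈1 ⟩ (var 2 :- var 3)) ∷ []) ≡-refl
        where open Evaluation (weighted m) (conv m Ĝ ∷ conv m Ĝ′ ∷ A (suc m) ∷ Â (suc m) ∷ g 0 ∷ [])

  record AlternatingPair : Set (c ⊔ ℓ) where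
    field
      ρ-equation    : (b + 1#) * ((b - 1#) * (b - 1#)) * ρ ≈ b
      bⁿ-1-regular  : ∀ n a → (b ^ suc n - 1#) * a ≈ 0# → a ≈ 0#
      x y           : Carrier
      serreˣ        : bracketᵇ x (bracket x (bracketᵇ y x)) ≈ 0#
      serreʸ        : bracketᵇ y (bracket y (bracketᵇ x y)) ≈ 0#
      g h           : ℕ → Carrier
      g₀≈1          : g 0 ≈ 1#
      h₀≈1          : h 0 ≈ 1#
      difference    : ∀ n → (b - 1#) * (b - 1#) * (h (suc n) - g (suc n)) ≈ b * bracket x (bracketᵇ (g n) y)
      quadratic     : ∀ n → (b - 1#) * (b - 1#) * conv (suc n) (λ k l → weight k * (g k * h l)) ≈
                            conv n (λ k l → weight k * (bracketᵇ x (g k) * bracketᵇ (g l) y))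

-- Induction on the level: commutation relations of the alternating elements

module AlternatingRelations {c ℓ} (R : Ring c ℓ) (b b⁻¹ ρ : Ring.Carrier R)
  (b-central : NoncommutativeSolver.Central R b)
  (b⁻¹-central : NoncommutativeSolver.Central R b⁻¹)
  (ρ-central : NoncommutativeSolver.Central R ρ)
  (b*b⁻¹≈1 : Ring._≈_ R (Ring._*_ R b b⁻¹) (Ring.1# R))
  (pair : WeightedSums.AlternatingPair R b b⁻¹ ρ b-central b⁻¹-central ρ-central b*b⁻¹≈1) where
  open Ring R
  open WeightedSums R b b⁻¹ ρ b-central b⁻¹-central ρ-central b*b⁻¹≈1
  open AlternatingPair pair
  open NoncommutativeSolver R
  open SetoidReasoning setoid
  open LevelIdentities R b b-central using (bracket-exchange; bracketᵇ-reduce; bracketᵇ-reduceʸ; serre-step)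

  s² : Carrier
  s² = (b - 1#) * (b - 1#)

  :s² : Expr
  :s² = (B :- :1) :* (B :- :1)

  γ γ̃ z z̃ x₁ y₁ ỹ₁ : Carrier
  γ  = bracketᵇ y x
  γ̃  = bracketᵇ x y
  z  = ρ * γ
  z̃  = ρ * γ̃
  x₁ = bracket x z
  y₁ = bracket z y
  ỹ₁ = bracket y z̃

  w w̃ v ṽ D : ℕ → Carrier
  w k = bracketᵇ x (g k)
  w̃ k = bracketᵇ (h k) x
  v k = bracketᵇ (g k) y
  ṽ k = bracketᵇ y (h k)
  D k = h k - g k

  Regular : Carrier → Set _
  Regular s = ∀ a → s * a ≈ 0# → a ≈ 0#

  regular-≈ : ∀ {s t} → s ≈ t → Regular s → Regular t
  regular-≈ s≈t r a p = r a (trans (*-congʳ s≈t) p)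

  regular-* : ∀ {s t} → Regular s → Regular t → Regular (s * t)
  regular-* r r′ a p = r′ a (r _ (trans (sym (*-assoc _ _ _)) p))

  regular-factorʳ : ∀ {s t} → Regular (s * t) → Regular t
  regular-factorʳ {s} {t} r a p = r a (trans (*-assoc _ _ _) (trans (*-congˡ p) (zeroʳ s)))

  regular-cancel : ∀ {s a a′} → Regular s → s * a ≈ s * a′ → a ≈ a′
  regular-cancel {s} {a} {a′} r p = solveModulo (var 0) (var 1) ((:1 ⟨ var 0 :- var 1 ≋ :0 ∣ diff ⟩ :1) ∷ []) ≡-refl
    where
    open Evaluation [] (a ∷ a′ ∷ s ∷ [])
    diff : a - a′ ≈ 0#
    diff = r _ (solveModulo (var 2 :* (var 0 :- var 1)) :0 ((:1 ⟨ var 2 :* var 0 ≋ var 2 :* var 1 ∣ p ⟩ :1) ∷ []) ≡-refl)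

  b-1-regular : Regular (b - 1#)
  b-1-regular = regular-≈ (+-congʳ (*-identityʳ b)) (bⁿ-1-regular 0)

  b+1-regular : Regular (b + 1#)
  b+1-regular = regular-factorʳ {b - 1#} (regular-≈
    (solve (B :* (B :* :1) :- :1) ((B :- :1) :* (B :+ :1)) ≡-refl) (bⁿ-1-regular 1))
    where open Evaluation scalars []

  s²-regular : Regular s²
  s²-regular = regular-* b-1-regular b-1-regular

  b-regular : Regular b
  b-regular a p = solveModulo (var 0) :0
    ((:0 :- :1 ⟨ B :* B⁻ ≋ :1 ∣ b*b⁻¹≈1 ⟩ var 0) ∷ (B⁻ ⟨ B :* var 0 ≋ :0 ∣ p ⟩ :1) ∷ []) ≡-refl
    where open Evaluation scalars (a ∷ [])

  b^*weight : ∀ n → b ^ n * weight n ≈ 1#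
  b^*weight zero    = *-identityˡ 1#
  b^*weight (suc n) = solveModulo (B :* var 0 :* (B⁻ :* β)) :1
    ((B :* B⁻ ⟨ var 0 :* β ≋ :1 ∣ b^*weight n ⟩ :1) ∷ (:1 ⟨ B :* B⁻ ≋ :1 ∣ b*b⁻¹≈1 ⟩ :1) ∷ []) ≡-refl
    where open Evaluation (weighted n) (b ^ n ∷ [])

  -- b^{n+1} + 1 is a factor of b^{2n+2} - 1.
  bⁿ+1-regular : ∀ n → Regular (b ^ suc n + 1#)
  bⁿ+1-regular n = regular-factorʳ {b ^ suc n - 1#} (regular-≈
    (trans (+-congʳ (^-homo-* b (suc n) (suc n)))
      (solve (var 0 :* var 0 :- :1) ((var 0 :- :1) :* (var 0 :+ :1)) ≡-refl))
    (bⁿ-1-regular (n +ℕ suc n)))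
    where
    open Exponentiation semiring using (^-homo-*)
    open Evaluation [] (b ^ suc n ∷ [])

  1+weight-regular : ∀ n → Regular (1# + weight (suc n))
  1+weight-regular n = regular-factorʳ {b ^ suc n} (regular-≈
    (solveModulo (var 0 :+ :1) (var 0 :* (:1 :+ β))
      ((:0 :- :1 ⟨ var 0 :* β ≋ :1 ∣ b^*weight (suc n) ⟩ :1) ∷ []) ≡-refl)
    (bⁿ+1-regular n))
    where open Evaluation (weighted (suc n)) (b ^ suc n ∷ [])

  x[_] y[_] : ℕ → Carrier
  x[ zero ]  = x
  x[ suc i ] = bracket x[ i ] z
  y[ zero ]  = y
  y[ suc j ] = bracket z y[ j ]

  -- ψ 0 0 is -γ. By `ψ-derivation`, commuting with z amounts to ψ i j being unchanged when one
  -- bracket moves from x to y; this dependence on i + j alone is the field `ψ-shift` below.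
  ψ : ℕ → ℕ → Carrier
  ψ i j = x[ i ] * y[ j ] - b * y[ j ] * x[ i ]

  ψ-derivation : ∀ i j → bracket (ψ i j) z ≈ ψ (suc i) j - ψ i (suc j)
  ψ-derivation i j = solve (:bracket (X :* Y :- B :* Y :* X) Z)
    ((:bracket X Z :* Y :- B :* Y :* :bracket X Z) :- (X :* :bracket Z Y :- B :* :bracket Z Y :* X)) ≡-refl
    where
    open Evaluation scalars (x[ i ] ∷ y[ j ] ∷ z ∷ [])
    X = var 0
    Y = var 1
    Z = var 2

  -- Exchanging x with y and g with h turns γ into γ̃ and matches most fields in pairs. The rule
  -- `[g,y]` serves to move g past the letters y_j of ψ. Rules that express level k+1 through level
  -- k carry the strict bound.
  record Relations (m : ℕ) : Set (c ⊔ ℓ) where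
    field
      w≈w̃    : ∀ k → k ≤ m → w k ≈ w̃ k
      v≈ṽ    : ∀ k → k ≤ m → v k ≈ ṽ k
      [x,w]  : ∀ k → k ≤ m → bracket x (w k) ≈ 0#
      [y,ṽ]  : ∀ k → k ≤ m → bracket y (ṽ k) ≈ 0#
      [γ,g]  : ∀ k → k ≤ m → bracket γ (g k) ≈ 0#
      [γ̃,h]  : ∀ k → k ≤ m → bracket γ̃ (h k) ≈ 0#
      [x,g]  : ∀ k → k < m → bracket x (g (suc k)) ≈ b * x₁ * g k - g k * x₁
      [g,y]  : ∀ k → k < m → bracket (g (suc k)) y ≈ b * g k * y₁ - y₁ * g k
      [y,h]  : ∀ k → k < m → bracket y (h (suc k)) ≈ b * ỹ₁ * h k - h k * ỹ₁
      Θˣ     : ΘSum x γ g g₀≈1 m ≈ 0#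
      Θʸ     : ΘSum y γ̃ h h₀≈1 m ≈ 0#
      ψ-shift : ∀ i j → i +ℕ j < m → ψ (suc i) j ≈ ψ i (suc j)

  relations-zero : Relations 0
  relations-zero = record
    { w≈w̃ = λ { zero z≤n → solveModulo (:bracketᵇ X G) (:bracketᵇ H X)
        ((B :* X ⟨ G ≋ :1 ∣ g₀≈1 ⟩ :1) ∷ (:0 :- :1 ⟨ G ≋ :1 ∣ g₀≈1 ⟩ X) ∷
         (:0 :- B ⟨ H ≋ :1 ∣ h₀≈1 ⟩ X) ∷ (X ⟨ H ≋ :1 ∣ h₀≈1 ⟩ :1) ∷ []) ≡-refl }
    ; v≈ṽ = λ { zero z≤n → solveModulo (:bracketᵇ G Y) (:bracketᵇ Y H)
        ((:0 :- B :* Y ⟨ H ≋ :1 ∣ h₀≈1 ⟩ :1) ∷ (:1 ⟨ H ≋ :1 ∣ h₀≈1 ⟩ Y) ∷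
         (B ⟨ G ≋ :1 ∣ g₀≈1 ⟩ Y) ∷ (:0 :- Y ⟨ G ≋ :1 ∣ g₀≈1 ⟩ :1) ∷ []) ≡-refl }
    ; [x,w] = λ { zero z≤n → solveModulo (:bracket X (:bracketᵇ X G)) :0
        ((B :* X :* X ⟨ G ≋ :1 ∣ g₀≈1 ⟩ :1) ∷ (:0 :- (B :+ :1) :* X ⟨ G ≋ :1 ∣ g₀≈1 ⟩ X)
         ∷ (:1 ⟨ G ≋ :1 ∣ g₀≈1 ⟩ X :* X) ∷ []) ≡-refl }
    ; [y,ṽ] = λ { zero z≤n → solveModulo (:bracket Y (:bracketᵇ Y H)) :0
        ((B :* Y :* Y ⟨ H ≋ :1 ∣ h₀≈1 ⟩ :1) ∷ (:0 :- (B :+ :1) :* Y ⟨ H ≋ :1 ∣ h₀≈1 ⟩ Y)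
         ∷ (:1 ⟨ H ≋ :1 ∣ h₀≈1 ⟩ Y :* Y) ∷ []) ≡-refl }
    ; [γ,g] = λ { zero z≤n → solveModulo (:bracket (:bracketᵇ Y X) G) :0
        ((:bracketᵇ Y X ⟨ G ≋ :1 ∣ g₀≈1 ⟩ :1) ∷ (:0 :- :1 ⟨ G ≋ :1 ∣ g₀≈1 ⟩ :bracketᵇ Y X) ∷ []) ≡-refl }
    ; [γ̃,h] = λ { zero z≤n → solveModulo (:bracket (:bracketᵇ X Y) H) :0
        ((:bracketᵇ X Y ⟨ H ≋ :1 ∣ h₀≈1 ⟩ :1) ∷ (:0 :- :1 ⟨ H ≋ :1 ∣ h₀≈1 ⟩ :bracketᵇ X Y) ∷ []) ≡-refl }
    ; [x,g] = λ _ ()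
    ; [g,y] = λ _ ()
    ; [y,h] = λ _ ()
    ; Θˣ = ΘSum-zero x γ g g₀≈1
    ; Θʸ = ΘSum-zero y γ̃ h h₀≈1
    ; ψ-shift = λ _ _ ()
    }
    where
    open Evaluation scalars (x ∷ y ∷ g 0 ∷ h 0 ∷ [])
    X = var 0
    Y = var 1
    G = var 2
    H = var 3

  D₀≈0 : D 0 ≈ 0#
  D₀≈0 = trans (+-cong h₀≈1 (-‿cong g₀≈1)) (-‿inverseʳ 1#)

  conv-bracketˡ : ∀ a m f → bracket a (conv m f) ≈ conv m (λ k l → bracket a (f k l))
  conv-bracketˡ a m f = trans (+-cong (conv-*ˡ m a f) (-‿cong (conv-*ʳ m a f))) (sym (conv-- m _ _))

  conv-bracketʳ : ∀ a m f → bracket (conv m f) a ≈ conv m (λ k l → bracket (f k l) a)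
  conv-bracketʳ a m f = trans (+-cong (conv-*ʳ m a f) (-‿cong (conv-*ˡ m a f))) (sym (conv-- m _ _))

  -- Since b / (b-1)² = (b+1) ρ, dividing by (b-1)² replaces [x,γ] by (b+1) [x, ργ].
  end-defect : ∀ x γ g D d → s² * D ≈ b * d →
    bracketᵇ d x ≈ b * bracket x γ * g - g * bracket x γ →
    b * D * x - x * D ≈ (b + 1#) * (b * bracket x (ρ * γ) * g - g * bracket x (ρ * γ))
  end-defect x γ g D d p q = regular-cancel s²-regular (S.solveModulo
    (:s² :* (B :* var 3 :* X :- X :* var 3))
    (:s² :* ((B :+ :1) :* (B :* :bracket X (P :* Γ) :* G :- G :* :bracket X (P :* Γ))))
    ( (B S.⟨ :s² :* var 3 ≋ B :* var 4 ∣ p ⟩ X)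
    ∷ (:0 :- X S.⟨ :s² :* var 3 ≋ B :* var 4 ∣ p ⟩ :1)
    ∷ (B S.⟨ :bracketᵇ (var 4) X ≋ B :* :bracket X Γ :* G :- G :* :bracket X Γ ∣ q ⟩ :1)
    ∷ (:0 :- :1 S.⟨ (B :+ :1) :* :s² :* P ≋ B ∣ ρ-equation ⟩ B :* :bracket X Γ :* G :- G :* :bracket X Γ)
    ∷ []) ≡-refl)
    where
    module S = Evaluation scalars (x ∷ γ ∷ g ∷ D ∷ d ∷ [])
    X = var 0
    Γ = var 1
    G = var 2

  -- As x commutes with itself, [x,[x,g⁺]_b] = [x,[x,g⁺]]_b. Up to cancellable scalars this is
  -- [x,[D,x]_b]_b, hence a multiple of the expression that the Serre relation annihilates.
  end-commutes : ∀ x g⁺ D d → s² * D ≈ b * d → b * D * x - x * D ≈ (b + 1#) * bracket x g⁺ →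
    (b + 1#) * bracketᵇ x (bracketᵇ d x) ≈ 0# → bracket x (bracketᵇ x g⁺) ≈ 0#
  end-commutes x g⁺ D d p q r = regular-* (regular-* s²-regular b+1-regular) b+1-regular _ (S.solveModulo
    (:s² :* (B :+ :1) :* (B :+ :1) :* :bracket X (:bracketᵇ X G)) :0
    ( (:0 :- :s² :* (B :+ :1) :* B :* X S.⟨ B :* D′ :* X :- X :* D′ ≋ (B :+ :1) :* :bracket X G ∣ q ⟩ :1)
    ∷ (:s² :* (B :+ :1) S.⟨ B :* D′ :* X :- X :* D′ ≋ (B :+ :1) :* :bracket X G ∣ q ⟩ X)
    ∷ ((B :+ :1) :* B :* B :* X S.⟨ :s² :* D′ ≋ B :* d′ ∣ p ⟩ X)
    ∷ (:0 :- (B :+ :1) :* B :* X :* X S.⟨ :s² :* D′ ≋ B :* d′ ∣ p ⟩ :1)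
    ∷ (:0 :- (B :+ :1) :* B S.⟨ :s² :* D′ ≋ B :* d′ ∣ p ⟩ X :* X)
    ∷ ((B :+ :1) :* X S.⟨ :s² :* D′ ≋ B :* d′ ∣ p ⟩ X)
    ∷ (B S.⟨ (B :+ :1) :* :bracketᵇ X (:bracketᵇ d′ X) ≋ :0 ∣ r ⟩ :1) ∷ []) ≡-refl)
    where
    module S = Evaluation scalars (x ∷ g⁺ ∷ D ∷ d ∷ [])
    X = var 0
    G = var 1
    D′ = var 2
    d′ = var 3

  module Step (m : ℕ) (rel : Relations m) where
    open Relations rel

    n : ℕ
    n = suc m

    gh : ℕ → ℕ → Carrier
    gh k l = weight k * (g k * h l)

    [x,v]-exchange : ∀ k → k ≤ m → bracket x (v k) ≈ bracket (w k) y
    [x,v]-exchange k k≤m = bracket-exchange x y (g k) ([γ,g] k k≤m)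

    [v,y] : ∀ k → k ≤ m → bracket (v k) y ≈ 0#
    [v,y] k k≤m = solveModulo (:bracket (var 0) (var 1)) :0
      ((:1 ⟨ var 0 ≋ var 2 ∣ v≈ṽ k k≤m ⟩ var 1) ∷ (:0 :- var 1 ⟨ var 0 ≋ var 2 ∣ v≈ṽ k k≤m ⟩ :1)
       ∷ (:0 :- :1 ⟨ :bracket (var 1) (var 2) ≋ :0 ∣ [y,ṽ] k k≤m ⟩ :1) ∷ []) ≡-refl
      where open Evaluation [] (v k ∷ y ∷ ṽ k ∷ [])

    -- The quadratic relation is bracketed with x. On the left b [x, g_k h_l] = w_k h_l - g_k w̃_l;
    -- on the right b [x, w_k v_l] = (b-1)² w_k D_{l+1}, because w_k commutes with x. The terms with
    -- h cancel, and w̃_l = w_l below level n leaves only end terms.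
    Θˣ-defect : ΘSum x γ g g₀≈1 n ≈ w̃ n - w n
    Θˣ-defect = begin
      ΘSum x γ g g₀≈1 n            ≈⟨ conv-cong n (λ k l _ → splitΘ k l) ⟩
      conv n (λ k l → wg k l - gw k l)  ≈⟨ conv-- n wg gw ⟩
      conv n wg - conv n gw        ≈⟨ combine ⟩
      w̃ n - w n                    ∎
      where
      wg gw wh gw̃ : ℕ → ℕ → Carrier
      wg k l = weight k * (w k * g l)
      gw k l = weight k * (g k * w l)
      wh k l = weight k * (w k * h l)
      gw̃ k l = weight k * (g k * w̃ l)

      splitΘ : ∀ k l → weight k * (b * x * g k * g l - (b + 1#) * g k * x * g l + g k * g l * x) ≈ wg k l - gw k l
      splitΘ k l = solve
        (β :* (B :* X :* p :* q :- (B :+ :1) :* p :* X :* q :+ p :* q :* X))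
        (β :* (:bracketᵇ X p :* q) :- β :* (p :* :bracketᵇ X q)) ≡-refl
        where
        open Evaluation (weighted k) (x ∷ g k ∷ g l ∷ [])
        X = var 0
        p = var 1
        q = var 2

      commuted : conv n (λ k l → wh k l - gw̃ k l) ≈ conv m (λ k l → weight k * (w k * D (suc l)))
      commuted = regular-cancel s²-regular (begin
        s² * conv n (λ k l → wh k l - gw̃ k l)
          ≈⟨ *-congˡ (conv-cong n (λ k l _ → left k l)) ⟩
        s² * conv n (λ k l → b * bracket x (gh k l))
          ≈⟨ *-congˡ (trans (*-congˡ (conv-bracketˡ x n gh)) (conv-*ˡ n b (λ k l → bracket x (gh k l)))) ⟨
        s² * (b * bracket x (conv n gh))
          ≈⟨ solve (:s² :* (B :* :bracket (var 0) (var 1))) (B :* :bracket (var 0) (:s² :* var 1)) ≡-refl ⟩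
        b * bracket x (s² * conv n gh)
          ≈⟨ *-congˡ (+-cong (*-congˡ (quadratic m)) (-‿cong (*-congʳ (quadratic m)))) ⟩
        b * bracket x (conv m (λ k l → weight k * (w k * v l)))
          ≈⟨ trans (*-congˡ (conv-bracketˡ x m _)) (conv-*ˡ m b _) ⟩
        conv m (λ k l → b * bracket x (weight k * (w k * v l)))
          ≈⟨ conv-cong m right ⟩
        conv m (λ k l → s² * (weight k * (w k * D (suc l))))
          ≈⟨ conv-*ˡ m s² _ ⟨
        s² * conv m (λ k l → weight k * (w k * D (suc l))) ∎)
        where
        open Evaluation scalars (x ∷ conv n gh ∷ [])
        left : ∀ k l → wh k l - gw̃ k l ≈ b * bracket x (gh k l)
        left k l = S.solve
          (β :* (:bracketᵇ (var 0) (var 1) :* var 2) :- β :* (var 1 :* :bracketᵇ (var 2) (var 0)))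
          (B :* :bracket (var 0) (β :* (var 1 :* var 2))) ≡-refl
          where module S = Evaluation (weighted k) (x ∷ g k ∷ h l ∷ [])
        right : ∀ k l → k +ℕ l ≡ m → b * bracket x (weight k * (w k * v l)) ≈ s² * (weight k * (w k * D (suc l)))
        right k l eq = S.solveModulo
          (B :* :bracket (var 0) (β :* (var 1 :* var 2))) (:s² :* (β :* (var 1 :* var 3)))
          ( (B :* β S.⟨ :bracket (var 0) (var 1) ≋ :0 ∣ [x,w] k (≤-fromʳ eq) ⟩ var 2)
          ∷ (:0 :- β :* var 1 S.⟨ :s² :* var 3 ≋ B :* :bracket (var 0) (var 2) ∣ difference l ⟩ :1) ∷ []) ≡-refl
          where module S = Evaluation (weighted k) (x ∷ w k ∷ v l ∷ D (suc l) ∷ [])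

      combine : conv n wg - conv n gw ≈ w̃ n - w n
      combine = S.solveModulo (var 0 :- var 1) (var 7 :- var 6)
        ( (:1 S.⟨ var 0 ≋ var 5 :+ β :* (var 6 :* var 8) ∣ conv-last m wg ⟩ :1)
        ∷ (:1 S.⟨ var 2 :- var 3 ≋ var 4 :- var 5 ∣ peeled ⟩ :1)
        ∷ (:0 :- :1 S.⟨ var 2 ≋ var 4 :+ β :* (var 6 :* var 9) ∣ conv-last m wh ⟩ :1)
        ∷ (:1 S.⟨ var 3 ≋ var 1 :+ (:1 :* (var 8 :* var 7) :- :1 :* (var 8 :* var 6)) ∣ replaced ⟩ :1)
        ∷ (β :* var 6 S.⟨ var 8 ≋ :1 ∣ g₀≈1 ⟩ :1)
        ∷ (:0 :- β :* var 6 S.⟨ var 9 ≋ :1 ∣ h₀≈1 ⟩ :1)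
        ∷ (:1 S.⟨ var 8 ≋ :1 ∣ g₀≈1 ⟩ var 7 :- var 6) ∷ []) ≡-refl
        where
        module S = Evaluation (weighted n)
          ( conv n wg ∷ conv n gw ∷ conv n wh ∷ conv n gw̃ ∷ conv m (λ k l → wh k (suc l))
          ∷ conv m (λ k l → wg k (suc l)) ∷ w n ∷ w̃ n ∷ g 0 ∷ h 0 ∷ [])
        peeled : conv n wh - conv n gw̃ ≈ conv m (λ k l → wh k (suc l)) - conv m (λ k l → wg k (suc l))
        peeled = begin
          conv n wh - conv n gw̃                                                ≈⟨ conv-- n wh gw̃ ⟨
          conv n (λ k l → wh k l - gw̃ k l)                                     ≈⟨ commuted ⟩
          conv m (λ k l → weight k * (w k * D (suc l)))                         ≈⟨ conv-cong m (λ k l _ → spread k l) ⟩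
          conv m (λ k l → wh k (suc l) - wg k (suc l))                          ≈⟨ conv-- m _ _ ⟩
          conv m (λ k l → wh k (suc l)) - conv m (λ k l → wg k (suc l))         ∎
          where
          spread : ∀ k l → weight k * (w k * D (suc l)) ≈ wh k (suc l) - wg k (suc l)
          spread k l = T.solve (var 0 :* (var 1 :* (var 2 :- var 3))) (var 0 :* (var 1 :* var 2) :- var 0 :* (var 1 :* var 3)) ≡-refl
            where module T = Evaluation [] (weight k ∷ w k ∷ h (suc l) ∷ g (suc l) ∷ [])
        replaced : conv n gw̃ ≈ conv n gw + (gw̃ 0 n - gw 0 n)
        replaced = conv-congFirst n {gw̃} {gw} (λ k l eq → *-congˡ (*-congˡ (sym (w≈w̃ l (ℕ.≤-pred (<-fromˡ eq))))))

    Θʸ-defect : ΘSum y γ̃ h h₀≈1 n ≈ weight n * (ṽ n - v n)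
    Θʸ-defect = begin
      ΘSum y γ̃ h h₀≈1 n                ≈⟨ conv-cong n (λ k l _ → splitΘ k l) ⟩
      conv n (λ k l → ṽh k l - hṽ k l) ≈⟨ conv-- n ṽh hṽ ⟩
      conv n ṽh - conv n hṽ            ≈⟨ combine ⟩
      weight n * (ṽ n - v n)           ∎
      where
      ṽh hṽ vh hv gṽ gv : ℕ → ℕ → Carrier
      ṽh k l = weight k * (ṽ k * h l)
      hṽ k l = weight k * (h k * ṽ l)
      vh k l = weight k * (v k * h l)
      hv k l = weight k * (h k * v l)
      gṽ k l = weight k * (g k * ṽ l)
      gv k l = weight k * (g k * v l)

      splitΘ : ∀ k l → weight k * (b * y * h k * h l - (b + 1#) * h k * y * h l + h k * h l * y) ≈ ṽh k l - hṽ k l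
      splitΘ k l = S.solve
        (β :* (B :* X :* p :* q :- (B :+ :1) :* p :* X :* q :+ p :* q :* X))
        (β :* (:bracketᵇ X p :* q) :- β :* (p :* :bracketᵇ X q)) ≡-refl
        where
        module S = Evaluation (weighted k) (y ∷ h k ∷ h l ∷ [])
        X = var 0
        p = var 1
        q = var 2

      commuted : conv n (λ k l → vh k l - gṽ k l) ≈ conv n (λ k l → hv k l - gv k l)
      commuted = regular-cancel (regular-* s²-regular b-regular) (begin
        s² * b * conv n (λ k l → vh k l - gṽ k l)
          ≈⟨ *-congˡ (conv-cong n (λ k l _ → left k l)) ⟩
        s² * b * conv n (λ k l → bracket (gh k l) y)
          ≈⟨ *-congˡ (conv-bracketʳ y n gh) ⟨
        s² * b * bracket (conv n gh) y
          ≈⟨ S.solve (:s² :* B :* :bracket (var 1) (var 0)) (B :* :bracket (:s² :* var 1) (var 0)) ≡-refl ⟩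
        b * bracket (s² * conv n gh) y
          ≈⟨ *-congˡ (+-cong (*-congʳ (quadratic m)) (-‿cong (*-congˡ (quadratic m)))) ⟩
        b * bracket (conv m (λ k l → weight k * (w k * v l))) y
          ≈⟨ trans (*-congˡ (conv-bracketʳ y m _)) (conv-*ˡ m b _) ⟩
        conv m (λ k l → b * bracket (weight k * (w k * v l)) y)
          ≈⟨ conv-cong m right ⟩
        conv m (λ k l → s² * b * (hv (suc k) l - gv (suc k) l))
          ≈⟨ conv-*ˡ m (s² * b) _ ⟨
        s² * b * conv m (λ k l → hv (suc k) l - gv (suc k) l)
          ≈⟨ *-congˡ (trans (+-congʳ first≈0) (+-identityˡ _)) ⟨
        s² * b * conv n (λ k l → hv k l - gv k l) ∎)
        where
        module S = Evaluation scalars (y ∷ conv n gh ∷ [])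
        left : ∀ k l → vh k l - gṽ k l ≈ bracket (gh k l) y
        left k l = L.solve
          (β :* (:bracketᵇ (var 1) (var 0) :* var 2) :- β :* (var 1 :* :bracketᵇ (var 0) (var 2)))
          (:bracket (β :* (var 1 :* var 2)) (var 0)) ≡-refl
          where module L = Evaluation (weighted k) (y ∷ g k ∷ h l ∷ [])
        right : ∀ k l → k +ℕ l ≡ m → b * bracket (weight k * (w k * v l)) y ≈ s² * b * (hv (suc k) l - gv (suc k) l)
        right k l eq = L.solveModulo
          (B :* :bracket (β :* (var 1 :* var 2)) (var 0))
          (:s² :* B :* (B⁻ :* β :* (var 3 :* var 2) :- B⁻ :* β :* (var 4 :* var 2)))
          ( (:0 :- B :* β L.⟨ :bracket (var 5) (var 6) ≋ :bracket (var 1) (var 0) ∣ [x,v]-exchange k (≤-fromʳ eq) ⟩ var 2)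
          ∷ (:0 :- β L.⟨ :s² :* (var 3 :- var 4) ≋ B :* :bracket (var 5) (var 6) ∣ difference k ⟩ var 2)
          ∷ (B :* β :* var 1 L.⟨ :bracket (var 2) (var 0) ≋ :0 ∣ [v,y] l (≤-fromˡ eq) ⟩ :1)
          ∷ (:0 :- β :* :s² :* (var 3 :- var 4) L.⟨ B :* B⁻ ≋ :1 ∣ b*b⁻¹≈1 ⟩ var 2) ∷ []) ≡-refl
          where module L = Evaluation (weighted k) (y ∷ w k ∷ v l ∷ h (suc k) ∷ g (suc k) ∷ x ∷ v k ∷ [])
        first≈0 : hv 0 n - gv 0 n ≈ 0#
        first≈0 = L.solveModulo (:1 :* (var 0 :* var 2) :- :1 :* (var 1 :* var 2)) :0
          ((:1 L.⟨ var 0 :- var 1 ≋ :0 ∣ D₀≈0 ⟩ var 2) ∷ []) ≡-refl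
          where module L = Evaluation [] (h 0 ∷ g 0 ∷ v n ∷ [])

      combine : conv n ṽh - conv n hṽ ≈ weight n * (ṽ n - v n)
      combine = S.solveModulo (var 0 :- var 1) (β :* (var 7 :- var 6))
        ( (:1 S.⟨ var 0 ≋ var 2 :+ (β :* (var 7 :* var 9) :- β :* (var 6 :* var 9)) ∣ replacedLast ⟩ :1)
        ∷ (:0 :- :1 S.⟨ var 1 ≋ var 3 :+ (:1 :* (var 9 :* var 7) :- :1 :* (var 9 :* var 6)) ∣ replacedFirst {hṽ} {hv} ṽ≈v-hv ⟩ :1)
        ∷ (:1 S.⟨ var 2 :- var 4 ≋ var 3 :- var 5 ∣ trans (sym (conv-- n vh gṽ)) (trans commuted (conv-- n hv gv)) ⟩ :1)
        ∷ (:1 S.⟨ var 4 ≋ var 5 :+ (:1 :* (var 8 :* var 7) :- :1 :* (var 8 :* var 6)) ∣ replacedFirst {gṽ} {gv} ṽ≈v-gv ⟩ :1)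
        ∷ (β :* (var 7 :- var 6) S.⟨ var 9 ≋ :1 ∣ h₀≈1 ⟩ :1)
        ∷ (:0 :- :1 S.⟨ var 9 ≋ :1 ∣ h₀≈1 ⟩ var 7 :- var 6)
        ∷ (:1 S.⟨ var 8 ≋ :1 ∣ g₀≈1 ⟩ var 7 :- var 6) ∷ []) ≡-refl
        where
        module S = Evaluation (weighted n)
          ( conv n ṽh ∷ conv n hṽ ∷ conv n vh ∷ conv n hv ∷ conv n gṽ ∷ conv n gv
          ∷ v n ∷ ṽ n ∷ g 0 ∷ h 0 ∷ [])
        replacedLast : conv n ṽh ≈ conv n vh + (ṽh n 0 - vh n 0)
        replacedLast = conv-congLast n {ṽh} {vh} (λ k l eq → *-congˡ (*-congʳ (sym (v≈ṽ k (ℕ.≤-pred (<-fromʳ eq))))))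
        replacedFirst : ∀ {f f′ : ℕ → ℕ → Carrier} → (∀ k l → l ≤ m → f (suc k) l ≈ f′ (suc k) l) → conv n f ≈ conv n f′ + (f 0 n - f′ 0 n)
        replacedFirst {f} {f′} p = conv-congFirst n {f} {f′} (λ k l eq → p k l (ℕ.≤-pred (<-fromˡ eq)))
        ṽ≈v-hv : ∀ k l → l ≤ m → hṽ (suc k) l ≈ hv (suc k) l
        ṽ≈v-hv k l l≤m = *-congˡ (*-congˡ (sym (v≈ṽ l l≤m)))
        ṽ≈v-gv : ∀ k l → l ≤ m → gṽ (suc k) l ≈ gv (suc k) l
        ṽ≈v-gv k l l≤m = *-congˡ (*-congˡ (sym (v≈ṽ l l≤m)))

    d d̃ : Carrier
    d = bracket x (v m)
    d̃ = bracket y (w̃ m)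

    -- The mirror image of `difference`, obtained from it by the exchange identity and w m = w̃ m.
    d̃-difference : s² * (g n - h n) ≈ b * d̃
    d̃-difference = S.solveModulo (:s² :* (var 0 :- var 1)) (B :* :bracket (var 2) (var 3))
      ( (:0 :- :1 S.⟨ :s² :* (var 1 :- var 0) ≋ B :* :bracket (var 4) (var 5) ∣ difference m ⟩ :1)
      ∷ (:0 :- B S.⟨ :bracket (var 4) (var 5) ≋ :bracket (var 6) (var 2) ∣ [x,v]-exchange m ℕ.≤-refl ⟩ :1)
      ∷ (B :* var 2 S.⟨ var 6 ≋ var 3 ∣ w≈w̃ m ℕ.≤-refl ⟩ :1)
      ∷ (:0 :- B S.⟨ var 6 ≋ var 3 ∣ w≈w̃ m ℕ.≤-refl ⟩ var 2) ∷ []) ≡-refl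
      where module S = Evaluation scalars (g n ∷ h n ∷ y ∷ w̃ m ∷ x ∷ v m ∷ w m ∷ [])

    [y,v] : ∀ k → k ≤ m → bracket y (v k) ≈ 0#
    [y,v] k k≤m = trans (+-cong (*-congˡ (v≈ṽ k k≤m)) (-‿cong (*-congʳ (v≈ṽ k k≤m)))) ([y,ṽ] k k≤m)

    X̂ Ŷ : Carrier
    X̂ = b * x₁ * g m - g m * x₁
    Ŷ = b * ỹ₁ * h m - h m * ỹ₁

    D-X̂ : b * D n * x - x * D n ≈ (b + 1#) * X̂
    D-X̂ = end-defect x γ (g m) (D n) d (difference m)
      (bracketᵇ-reduce x y (g m) ([x,w] m ℕ.≤-refl) ([γ,g] m ℕ.≤-refl))

    D-Ŷ : b * (g n - h n) * y - y * (g n - h n) ≈ (b + 1#) * Ŷ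
    D-Ŷ = end-defect y γ̃ (h m) (g n - h n) d̃ d̃-difference
      (bracketᵇ-reduce y x (h m) ([y,ṽ] m ℕ.≤-refl) ([γ̃,h] m ℕ.≤-refl))

    [x,gₙ] : bracket x (g n) ≈ X̂
    [x,gₙ] = regular-cancel (regular-* b-regular (1+weight-regular m)) (S.solveModulo
      (B :* (:1 :+ β) :* :bracket (var 0) (var 1)) (B :* (:1 :+ β) :* var 3)
      ( (:1 S.⟨ B :* (var 2 :- var 1) :* var 0 :- var 0 :* (var 2 :- var 1) ≋ (B :+ :1) :* var 3 ∣ D-X̂ ⟩ :1)
      ∷ (:0 :- :1 S.⟨ var 4 ≋ (B :* β :- :1) :* (:bracket (var 0) (var 1) :- var 3) ∣ ΘSum-suc x γ g g₀≈1 m [x,g] [γ,g] Θˣ ⟩ :1)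
      ∷ (:1 S.⟨ var 4 ≋ :bracketᵇ (var 2) (var 0) :- :bracketᵇ (var 0) (var 1) ∣ Θˣ-defect ⟩ :1) ∷ []) ≡-refl)
      where module S = Evaluation (weighted n) (x ∷ g n ∷ h n ∷ X̂ ∷ ΘSum x γ g g₀≈1 n ∷ [])

    [y,hₙ] : bracket y (h n) ≈ Ŷ
    [y,hₙ] = regular-cancel (1+weight-regular m) (S.solveModulo
      ((:1 :+ β) :* :bracket (var 0) (var 1)) ((:1 :+ β) :* var 3)
      ( (β S.⟨ B :* (var 2 :- var 1) :* var 0 :- var 0 :* (var 2 :- var 1) ≋ (B :+ :1) :* var 3 ∣ D-Ŷ ⟩ :1)
      ∷ (:1 S.⟨ var 4 ≋ (B :* β :- :1) :* (:bracket (var 0) (var 1) :- var 3) ∣ ΘSum-suc y γ̃ h h₀≈1 m [y,h] [γ̃,h] Θʸ ⟩ :1)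
      ∷ (:0 :- :1 S.⟨ var 4 ≋ β :* (:bracketᵇ (var 0) (var 1) :- :bracketᵇ (var 2) (var 0)) ∣ Θʸ-defect ⟩ :1) ∷ []) ≡-refl)
      where module S = Evaluation (weighted n) (y ∷ h n ∷ g n ∷ Ŷ ∷ ΘSum y γ̃ h h₀≈1 n ∷ [])

    wₙ≈w̃ₙ : w n ≈ w̃ n
    wₙ≈w̃ₙ = S.solveModulo (:bracketᵇ (var 0) (var 1)) (:bracketᵇ (var 2) (var 0))
      ( ((B :+ :1) S.⟨ :bracket (var 0) (var 1) ≋ var 3 ∣ [x,gₙ] ⟩ :1)
      ∷ (:0 :- :1 S.⟨ B :* (var 2 :- var 1) :* var 0 :- var 0 :* (var 2 :- var 1) ≋ (B :+ :1) :* var 3 ∣ D-X̂ ⟩ :1) ∷ []) ≡-refl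
      where module S = Evaluation scalars (x ∷ g n ∷ h n ∷ X̂ ∷ [])

    vₙ≈ṽₙ : v n ≈ ṽ n
    vₙ≈ṽₙ = S.solveModulo (:bracketᵇ (var 1) (var 0)) (:bracketᵇ (var 0) (var 2))
      ( (:0 :- (B :+ :1) S.⟨ :bracket (var 0) (var 2) ≋ var 3 ∣ [y,hₙ] ⟩ :1)
      ∷ (:1 S.⟨ B :* (var 1 :- var 2) :* var 0 :- var 0 :* (var 1 :- var 2) ≋ (B :+ :1) :* var 3 ∣ D-Ŷ ⟩ :1) ∷ []) ≡-refl
      where module S = Evaluation scalars (y ∷ g n ∷ h n ∷ Ŷ ∷ [])

    [x,wₙ] : bracket x (w n) ≈ 0#
    [x,wₙ] = end-commutes x (g n) (D n) d (difference m) (trans D-X̂ (*-congˡ (sym [x,gₙ])))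
      (serre-step x y (g m) serreˣ ([x,w] m ℕ.≤-refl) ([γ,g] m ℕ.≤-refl))

    [y,ṽₙ] : bracket y (ṽ n) ≈ 0#
    [y,ṽₙ] = end-commutes y (h n) (g n - h n) d̃ d̃-difference (trans D-Ŷ (*-congˡ (sym [y,hₙ])))
      (serre-step y x (h m) serreʸ ([y,ṽ] m ℕ.≤-refl) ([γ̃,h] m ℕ.≤-refl))

    -- v n = ṽ n rewrites (b+1) [g n, y] as b y D - D y with D = h n - g n, and D is a multiple of
    -- d, to which the reduction on the y side applies.
    [gₙ,y] : bracket (g n) y ≈ b * g m * y₁ - y₁ * g m
    [gₙ,y] = regular-cancel (regular-* s²-regular b+1-regular) (S.solveModulo
      (:s² :* (B :+ :1) :* :bracket (var 1) Y)
      (:s² :* (B :+ :1) :* (B :* G :* :bracket (P :* Γ) Y :- :bracket (P :* Γ) Y :* G))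
      ( (:s² S.⟨ :bracketᵇ (var 1) Y ≋ :bracketᵇ Y (var 2) ∣ vₙ≈ṽₙ ⟩ :1)
      ∷ (B :* Y S.⟨ :s² :* (var 2 :- var 1) ≋ B :* var 5 ∣ difference m ⟩ :1)
      ∷ (:0 :- :1 S.⟨ :s² :* (var 2 :- var 1) ≋ B :* var 5 ∣ difference m ⟩ Y)
      ∷ (B :* B :* Y S.⟨ var 5 ≋ var 6 ∣ [x,v]-exchange m ℕ.≤-refl ⟩ :1)
      ∷ (:0 :- B S.⟨ var 5 ≋ var 6 ∣ [x,v]-exchange m ℕ.≤-refl ⟩ Y)
      ∷ (B S.⟨ :bracketᵇ Y (var 6) ≋ B :* G :* :bracket Γ Y :- :bracket Γ Y :* G
           ∣ bracketᵇ-reduceʸ x y (g m) ([y,v] m ℕ.≤-refl) ([γ,g] m ℕ.≤-refl) ⟩ :1)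
      ∷ (:0 :- :1 S.⟨ (B :+ :1) :* :s² :* P ≋ B ∣ ρ-equation ⟩ B :* G :* :bracket Γ Y :- :bracket Γ Y :* G)
      ∷ []) ≡-refl)
      where
      module S = Evaluation scalars (y ∷ g n ∷ h n ∷ γ ∷ g m ∷ d ∷ bracket (w m) y ∷ [])
      Y = var 0
      Γ = var 3
      G = var 4

    -- The two sides differ by [w n - w̃ n, y] + [v n - ṽ n, x].
    γ̃-exchange : bracket γ̃ (h n) ≈ bracket γ (g n)
    γ̃-exchange = S.solveModulo (:bracket (:bracketᵇ X Y) H) (:bracket (:bracketᵇ Y X) G)
      ( (:0 :- Y S.⟨ :bracketᵇ X G ≋ :bracketᵇ H X ∣ wₙ≈w̃ₙ ⟩ :1)
      ∷ (:1 S.⟨ :bracketᵇ X G ≋ :bracketᵇ H X ∣ wₙ≈w̃ₙ ⟩ Y)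
      ∷ (:0 :- X S.⟨ :bracketᵇ G Y ≋ :bracketᵇ Y H ∣ vₙ≈ṽₙ ⟩ :1)
      ∷ (:1 S.⟨ :bracketᵇ G Y ≋ :bracketᵇ Y H ∣ vₙ≈ṽₙ ⟩ X) ∷ []) ≡-refl
      where
      module S = Evaluation scalars (x ∷ y ∷ g n ∷ h n ∷ [])
      X = var 0
      Y = var 1
      G = var 2
      H = var 3

    [g,z] : ∀ k → k ≤ m → bracket (g k) z ≈ 0#
    [g,z] k k≤m = S.solveModulo (:bracket (var 0) (P :* var 1)) :0
      ((:0 :- P S.⟨ :bracket (var 1) (var 0) ≋ :0 ∣ [γ,g] k k≤m ⟩ :1) ∷ []) ≡-refl
      where module S = Evaluation scalars (g k ∷ γ ∷ [])

    -- The rule for x is bracketed i times with z. Each bracket has to pass through g (k+1) and g k,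
    -- which is possible up to level m; for i = 0 nothing is passed, so there level n is reached
    -- too.
    [xᵢ,g] : ∀ i k → i +ℕ suc k ≤ n → bracket x[ i ] (g (suc k)) ≈ b * x[ suc i ] * g k - g k * x[ suc i ]
    [xᵢ,g] zero    k p with ℕ.m≤n⇒m<n∨m≡n (ℕ.≤-pred p)
    ... | inj₁ k<m    = [x,g] k k<m
    ... | inj₂ ≡-refl = [x,gₙ]
    [xᵢ,g] (suc i) k p = S.solveModulo (:bracket (:bracket X Z) G⁺)
      (B :* :bracket X′ Z :* G :- G :* :bracket X′ Z)
      ( (:1 S.⟨ :bracket X G⁺ ≋ B :* X′ :* G :- G :* X′ ∣ [xᵢ,g] i k (ℕ.m≤n⇒m≤1+n (ℕ.≤-pred p)) ⟩ Z)
      ∷ (:0 :- Z S.⟨ :bracket X G⁺ ≋ B :* X′ :* G :- G :* X′ ∣ [xᵢ,g] i k (ℕ.m≤n⇒m≤1+n (ℕ.≤-pred p)) ⟩ :1)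
      ∷ (X S.⟨ :bracket G⁺ Z ≋ :0 ∣ [g,z] (suc k) suc-k≤m ⟩ :0 :- :1)
      ∷ (:1 S.⟨ :bracket G⁺ Z ≋ :0 ∣ [g,z] (suc k) suc-k≤m ⟩ X)
      ∷ (B :* X′ S.⟨ :bracket G Z ≋ :0 ∣ [g,z] k (ℕ.≤-trans (ℕ.n≤1+n k) suc-k≤m) ⟩ :1)
      ∷ (:0 :- :1 S.⟨ :bracket G Z ≋ :0 ∣ [g,z] k (ℕ.≤-trans (ℕ.n≤1+n k) suc-k≤m) ⟩ X′) ∷ []) ≡-refl
      where
      suc-k≤m : suc k ≤ m
      suc-k≤m = ℕ.≤-trans (ℕ.m≤n+m (suc k) i) (ℕ.≤-pred p)
      module S = Evaluation scalars (x[ i ] ∷ x[ suc i ] ∷ g k ∷ g (suc k) ∷ z ∷ [])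
      X  = var 0
      X′ = var 1
      G  = var 2
      G⁺ = var 3
      Z  = var 4

    [g,yⱼ] : ∀ j k → j +ℕ suc k ≤ n → bracket (g (suc k)) y[ j ] ≈ b * g k * y[ suc j ] - y[ suc j ] * g k
    [g,yⱼ] zero    k p with ℕ.m≤n⇒m<n∨m≡n (ℕ.≤-pred p)
    ... | inj₁ k<m    = [g,y] k k<m
    ... | inj₂ ≡-refl = [gₙ,y]
    [g,yⱼ] (suc j) k p = S.solveModulo (:bracket G⁺ (:bracket Z Y))
      (B :* G :* :bracket Z Y′ :- :bracket Z Y′ :* G)
      ( (Z S.⟨ :bracket G⁺ Y ≋ B :* G :* Y′ :- Y′ :* G ∣ [g,yⱼ] j k (ℕ.m≤n⇒m≤1+n (ℕ.≤-pred p)) ⟩ :1)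
      ∷ (:0 :- :1 S.⟨ :bracket G⁺ Y ≋ B :* G :* Y′ :- Y′ :* G ∣ [g,yⱼ] j k (ℕ.m≤n⇒m≤1+n (ℕ.≤-pred p)) ⟩ Z)
      ∷ (:1 S.⟨ :bracket G⁺ Z ≋ :0 ∣ [g,z] (suc k) suc-k≤m ⟩ Y)
      ∷ (:0 :- Y S.⟨ :bracket G⁺ Z ≋ :0 ∣ [g,z] (suc k) suc-k≤m ⟩ :1)
      ∷ (:0 :- B S.⟨ :bracket G Z ≋ :0 ∣ [g,z] k (ℕ.≤-trans (ℕ.n≤1+n k) suc-k≤m) ⟩ Y′)
      ∷ (Y′ S.⟨ :bracket G Z ≋ :0 ∣ [g,z] k (ℕ.≤-trans (ℕ.n≤1+n k) suc-k≤m) ⟩ :1) ∷ []) ≡-refl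
      where
      suc-k≤m : suc k ≤ m
      suc-k≤m = ℕ.≤-trans (ℕ.m≤n+m (suc k) j) (ℕ.≤-pred p)
      module S = Evaluation scalars (y[ j ] ∷ y[ suc j ] ∷ g k ∷ g (suc k) ∷ z ∷ [])
      Y  = var 0
      Y′ = var 1
      G  = var 2
      G⁺ = var 3
      Z  = var 4

    -- The only obstruction to ψ i j depending on i + j alone when i + j = n.
    Δ : Carrier
    Δ = bracket (ψ m 0) z

    -- `ψ-shift` at level i + j = m moves all brackets from y to x one by one, ending at ψ m 0.
    [ψ,z] : ∀ i j → i +ℕ j ≡ m → bracket (ψ i j) z ≈ Δ
    [ψ,z] i zero    eq with ≡-refl ← ≡-trans (≡-sym (ℕ.+-identityʳ i)) eq = refl
    [ψ,z] i (suc j) eq = begin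
      bracket (ψ i (suc j)) z  ≈⟨ +-cong (*-congʳ shift) (-‿cong (*-congˡ shift)) ⟨
      bracket (ψ (suc i) j) z  ≈⟨ [ψ,z] (suc i) j eq′ ⟩
      Δ                        ∎
      where
      eq′ : suc i +ℕ j ≡ m
      eq′ = ≡-trans (≡-sym (ℕ.+-suc i j)) eq
      shift : ψ (suc i) j ≈ ψ i (suc j)
      shift = ψ-shift i j (ℕ.≤-reflexive eq′)

    ψ-shift-top : ∀ i j → i +ℕ j ≡ m → ψ (suc i) j - ψ i (suc j) ≈ Δ
    ψ-shift-top i j eq = trans (sym (ψ-derivation i j)) ([ψ,z] i j eq)

    -- Moving g (k+2) past x_i and y_j gives c_{k+2} = (b+1) c_{k+1} - b c_k along i + j + k = n.
    -- The characteristic roots are 1 and b, and c_0 = 0, c_1 = (b-1) Δ select b^k - 1.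
    [ψ,g] : ∀ k i j → i +ℕ j +ℕ k ≡ n → bracket (ψ i j) (g k) ≈ (b ^ k - 1#) * Δ
    [ψ,g] zero i j eq = S.solveModulo (:bracket (var 0) (var 1)) ((:1 :- :1) :* var 2)
      ((var 0 S.⟨ var 1 ≋ :1 ∣ g₀≈1 ⟩ :1) ∷ (:0 :- :1 S.⟨ var 1 ≋ :1 ∣ g₀≈1 ⟩ var 0) ∷ []) ≡-refl
      where module S = Evaluation [] (ψ i j ∷ g 0 ∷ Δ ∷ [])
    [ψ,g] (suc zero) i j eq = S.solveModulo
      (:bracket (X :* Y :- B :* Y :* X) G⁺) ((B :* :1 :- :1) :* var 6)
      ( (:1 S.⟨ :bracket X G⁺ ≋ B :* X′ :* G :- G :* X′ ∣ [xᵢ,g] i 0 i≤n ⟩ Y)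
      ∷ (:0 :- B :* Y S.⟨ :bracket X G⁺ ≋ B :* X′ :* G :- G :* X′ ∣ [xᵢ,g] i 0 i≤n ⟩ :1)
      ∷ (:0 :- X S.⟨ :bracket G⁺ Y ≋ B :* G :* Y′ :- Y′ :* G ∣ [g,yⱼ] j 0 j≤n ⟩ :1)
      ∷ (B S.⟨ :bracket G⁺ Y ≋ B :* G :* Y′ :- Y′ :* G ∣ [g,yⱼ] j 0 j≤n ⟩ X)
      ∷ (B :* X′ S.⟨ G ≋ :1 ∣ g₀≈1 ⟩ Y)
      ∷ (:0 :- :1 S.⟨ G ≋ :1 ∣ g₀≈1 ⟩ X′ :* Y)
      ∷ (:0 :- B :* X S.⟨ G ≋ :1 ∣ g₀≈1 ⟩ Y′)
      ∷ (X :* Y′ S.⟨ G ≋ :1 ∣ g₀≈1 ⟩ :1)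
      ∷ (B :* B S.⟨ G ≋ :1 ∣ g₀≈1 ⟩ Y′ :* X)
      ∷ (:0 :- B :* Y′ S.⟨ G ≋ :1 ∣ g₀≈1 ⟩ X)
      ∷ (:0 :- B :* B :* Y :* X′ S.⟨ G ≋ :1 ∣ g₀≈1 ⟩ :1)
      ∷ (B :* Y S.⟨ G ≋ :1 ∣ g₀≈1 ⟩ X′)
      ∷ (B :- :1 S.⟨ (X′ :* Y :- B :* Y :* X′) :- (X :* Y′ :- B :* Y′ :* X) ≋ var 6 ∣ ψ-shift-top i j i+j≡m ⟩ :1)
      ∷ []) ≡-refl
      where
      i+j≡m : i +ℕ j ≡ m
      i+j≡m = ℕ.suc-injective (≡-trans (≡-sym (ℕ.+-comm (i +ℕ j) 1)) eq)
      i≤n : i +ℕ 1 ≤ n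
      i≤n = ≡-subst (i +ℕ 1 ≤_) eq (ℕ.+-monoˡ-≤ 1 (ℕ.m≤m+n i j))
      j≤n : j +ℕ 1 ≤ n
      j≤n = ≡-subst (j +ℕ 1 ≤_) eq (ℕ.+-monoˡ-≤ 1 (ℕ.m≤n+m j i))
      module S = Evaluation scalars (x[ i ] ∷ x[ suc i ] ∷ y[ j ] ∷ y[ suc j ] ∷ g 0 ∷ g 1 ∷ Δ ∷ [])
      X  = var 0
      X′ = var 1
      Y  = var 2
      Y′ = var 3
      G  = var 4
      G⁺ = var 5
    [ψ,g] (suc (suc k)) i j eq = S.solveModulo
      (:bracket (X :* Y :- B :* Y :* X) G⁺⁺) ((B :* (B :* var 7) :- :1) :* var 8)
      ( (:1 S.⟨ :bracket X G⁺⁺ ≋ B :* X′ :* G⁺ :- G⁺ :* X′ ∣ [xᵢ,g] i (suc k) i≤n ⟩ Y)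
      ∷ (:0 :- B :* Y S.⟨ :bracket X G⁺⁺ ≋ B :* X′ :* G⁺ :- G⁺ :* X′ ∣ [xᵢ,g] i (suc k) i≤n ⟩ :1)
      ∷ (:0 :- X S.⟨ :bracket G⁺⁺ Y ≋ B :* G⁺ :* Y′ :- Y′ :* G⁺ ∣ [g,yⱼ] j (suc k) j≤n ⟩ :1)
      ∷ (B S.⟨ :bracket G⁺⁺ Y ≋ B :* G⁺ :* Y′ :- Y′ :* G⁺ ∣ [g,yⱼ] j (suc k) j≤n ⟩ X)
      ∷ (:0 :- B S.⟨ :bracket X G⁺ ≋ B :* X′ :* G :- G :* X′ ∣ [xᵢ,g] i k (weaken i i≤n) ⟩ Y′)
      ∷ (B :* Y′ S.⟨ :bracket X G⁺ ≋ B :* X′ :* G :- G :* X′ ∣ [xᵢ,g] i k (weaken i i≤n) ⟩ :1)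
      ∷ (B :* X′ S.⟨ :bracket G⁺ Y ≋ B :* G :* Y′ :- Y′ :* G ∣ [g,yⱼ] j k (weaken j j≤n) ⟩ :1)
      ∷ (:0 :- B S.⟨ :bracket G⁺ Y ≋ B :* G :* Y′ :- Y′ :* G ∣ [g,yⱼ] j k (weaken j j≤n) ⟩ X′)
      ∷ (B :* G⁺ S.⟨ X′ :* Y :- B :* Y :* X′ ≋ X :* Y′ :- B :* Y′ :* X ∣ shift ⟩ :1)
      ∷ (:0 :- :1 S.⟨ X′ :* Y :- B :* Y :* X′ ≋ X :* Y′ :- B :* Y′ :* X ∣ shift ⟩ G⁺)
      ∷ (B :+ :1 S.⟨ :bracket (X′ :* Y :- B :* Y :* X′) G⁺ ≋ (B :* var 7 :- :1) :* var 8 ∣ [ψ,g] (suc k) (suc i) j eq₁ ⟩ :1)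
      ∷ (:0 :- B S.⟨ :bracket (X′ :* Y′ :- B :* Y′ :* X′) G ≋ (var 7 :- :1) :* var 8 ∣ [ψ,g] k (suc i) (suc j) eq₂ ⟩ :1)
      ∷ []) ≡-refl
      where
      i≤n : i +ℕ suc (suc k) ≤ n
      i≤n = ≡-subst (i +ℕ suc (suc k) ≤_) eq (ℕ.+-monoˡ-≤ (suc (suc k)) (ℕ.m≤m+n i j))
      j≤n : j +ℕ suc (suc k) ≤ n
      j≤n = ≡-subst (j +ℕ suc (suc k) ≤_) eq (ℕ.+-monoˡ-≤ (suc (suc k)) (ℕ.m≤n+m j i))
      weaken : ∀ i → i +ℕ suc (suc k) ≤ n → i +ℕ suc k ≤ n
      weaken i = ℕ.≤-trans (ℕ.+-monoʳ-≤ i (ℕ.n≤1+n (suc k)))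
      eq₁ : suc i +ℕ j +ℕ suc k ≡ n
      eq₁ = ≡-trans (≡-sym (ℕ.+-suc (i +ℕ j) (suc k))) eq
      eq₂ : suc i +ℕ suc j +ℕ k ≡ n
      eq₂ = ≡-trans (≡-cong (λ e → suc e +ℕ k) (ℕ.+-suc i j)) (≡-trans (≡-sym (ℕ.+-suc (suc (i +ℕ j)) k)) eq₁)
      shift : ψ (suc i) j ≈ ψ i (suc j)
      shift = ψ-shift i j (ℕ.≤-trans (s≤s (ℕ.m≤m+n (i +ℕ j) k))
        (ℕ.≤-reflexive (ℕ.suc-injective (≡-trans (≡-sym (ℕ.+-suc (suc (i +ℕ j)) k)) eq₁))))
      module S = Evaluation scalars
        (x[ i ] ∷ x[ suc i ] ∷ y[ j ] ∷ y[ suc j ] ∷ g k ∷ g (suc k) ∷ g (suc (suc k)) ∷ b ^ k ∷ Δ ∷ [])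
      X   = var 0
      X′  = var 1
      Y   = var 2
      Y′  = var 3
      G   = var 4
      G⁺  = var 5
      G⁺⁺ = var 6

    J : ℕ → Carrier → Carrier
    J a u = conv a (λ k l → weight k * (g k * u * g l))

    -- For i = 0 this is the part of the quadratic relation left over after h is eliminated and the
    -- contributions of Θ and γ are split off. Replacing x by x_i makes the commutation rule
    -- applicable repeatedly.
    H : ℕ → ℕ → Carrier
    H i a = conv a (λ k l → weight k * (bracket x[ i ] (g k) * y * g l - g k * y * bracket x[ i ] (g l)))

    [a,g₀] : ∀ a → bracket a (g 0) ≈ 0#
    [a,g₀] a = S.solveModulo (:bracket (var 0) (var 1)) :0
      ((var 0 S.⟨ var 1 ≋ :1 ∣ g₀≈1 ⟩ :1) ∷ (:0 :- :1 S.⟨ var 1 ≋ :1 ∣ g₀≈1 ⟩ var 0) ∷ []) ≡-refl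
      where module S = Evaluation [] (a ∷ g 0 ∷ [])

    H-zero : ∀ i → H i 0 ≈ 0#
    H-zero i = S.solveModulo (:1 :* (:bracket (var 0) (var 1) :* var 2 :* var 1 :- var 1 :* var 2 :* :bracket (var 0) (var 1))) :0
      ( (:1 S.⟨ :bracket (var 0) (var 1) ≋ :0 ∣ [a,g₀] x[ i ] ⟩ var 2 :* var 1)
      ∷ (:0 :- var 1 :* var 2 S.⟨ :bracket (var 0) (var 1) ≋ :0 ∣ [a,g₀] x[ i ] ⟩ :1) ∷ []) ≡-refl
      where module S = Evaluation [] (x[ i ] ∷ g 0 ∷ y ∷ [])

    -- The rule lowers the index of one g in each of the two terms. Its unequal coefficients b and
    -- -1 leave a remainder that combines into ψ (suc i) 0.
    H-suc : ∀ i a → i +ℕ suc a ≤ m → H i (suc a) ≈ H (suc i) a + (1# - b⁻¹) * J a (ψ (suc i) 0)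
    H-suc i a i+a≤m = begin
      H i (suc a)                                                     ≈⟨ conv-cong (suc a) (λ k l _ → spread k l) ⟩
      conv (suc a) (λ k l → f k l - f′ k l)                           ≈⟨ conv-- (suc a) f f′ ⟩
      conv (suc a) f - conv (suc a) f′                                ≈⟨ +-cong f-sum (-‿cong f′-sum) ⟩
      conv a (λ k l → f (suc k) l) - conv a (λ k l → f′ k (suc l))    ≈⟨ conv-- a _ _ ⟨
      conv a (λ k l → f (suc k) l - f′ k (suc l))                     ≈⟨ conv-cong a shift ⟩
      conv a (λ k l → p k l + (1# - b⁻¹) * p′ k l)                    ≈⟨ conv-+ a p (λ k l → (1# - b⁻¹) * p′ k l) ⟩
      H (suc i) a + conv a (λ k l → (1# - b⁻¹) * p′ k l)              ≈⟨ +-congˡ (conv-*ˡ a _ _) ⟨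
      H (suc i) a + (1# - b⁻¹) * J a (ψ (suc i) 0)                    ∎
      where
      f f′ p p′ : ℕ → ℕ → Carrier
      f  k l = weight k * (bracket x[ i ] (g k) * y * g l)
      f′ k l = weight k * (g k * y * bracket x[ i ] (g l))
      p  k l = weight k * (bracket x[ suc i ] (g k) * y * g l - g k * y * bracket x[ suc i ] (g l))
      p′ k l = weight k * (g k * ψ (suc i) 0 * g l)

      spread : ∀ k l → weight k * (bracket x[ i ] (g k) * y * g l - g k * y * bracket x[ i ] (g l)) ≈ f k l - f′ k l
      spread k l = S.solve (var 0 :* (var 1 :- var 2)) (var 0 :* var 1 :- var 0 :* var 2) ≡-refl
        where module S = Evaluation [] (weight k ∷ bracket x[ i ] (g k) * y * g l ∷ g k * y * bracket x[ i ] (g l) ∷ [])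

      f-sum : conv (suc a) f ≈ conv a (λ k l → f (suc k) l)
      f-sum = trans (+-congʳ (S.solveModulo (:1 :* (var 0 :* var 1 :* var 2)) :0
        ((:1 S.⟨ var 0 ≋ :0 ∣ [a,g₀] x[ i ] ⟩ var 1 :* var 2) ∷ []) ≡-refl)) (+-identityˡ _)
        where module S = Evaluation [] (bracket x[ i ] (g 0) ∷ y ∷ g (suc a) ∷ [])

      f′-sum : conv (suc a) f′ ≈ conv a (λ k l → f′ k (suc l))
      f′-sum = trans (conv-last a f′) (trans (+-congˡ
        (trans (*-congˡ (trans (*-congˡ ([a,g₀] x[ i ])) (zeroʳ _))) (zeroʳ _))) (+-identityʳ _))

      shift : ∀ k l → k +ℕ l ≡ a → f (suc k) l - f′ k (suc l) ≈ p k l + (1# - b⁻¹) * p′ k l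
      shift k l eq = S.solveModulo
        (B⁻ :* β :* (:bracket X G⁺ :* Y :* Q) :- β :* (G :* Y :* :bracket X Q⁺))
        (β :* (:bracket X′ G :* Y :* Q :- G :* Y :* :bracket X′ Q) :+
          (:1 :- B⁻) :* (β :* (G :* (X′ :* Y :- B :* Y :* X′) :* Q)))
        ( (B⁻ :* β S.⟨ :bracket X G⁺ ≋ B :* X′ :* G :- G :* X′ ∣ [xᵢ,g] i k (bound (≤-fromʳ eq)) ⟩ Y :* Q)
        ∷ (:0 :- β :* G :* Y S.⟨ :bracket X Q⁺ ≋ B :* X′ :* Q :- Q :* X′ ∣ [xᵢ,g] i l (bound (≤-fromˡ eq)) ⟩ :1)
        ∷ (β S.⟨ B :* B⁻ ≋ :1 ∣ b*b⁻¹≈1 ⟩ X′ :* G :* Y :* Q)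
        ∷ (:0 :- β S.⟨ B :* B⁻ ≋ :1 ∣ b*b⁻¹≈1 ⟩ G :* Y :* X′ :* Q) ∷ []) ≡-refl
        where
        bound : ∀ {k} → k ≤ a → i +ℕ suc k ≤ n
        bound k≤a = ℕ.m≤n⇒m≤1+n (ℕ.≤-trans (ℕ.+-monoʳ-≤ i (s≤s k≤a)) i+a≤m)
        module S = Evaluation (weighted k)
          (x[ i ] ∷ x[ suc i ] ∷ y ∷ g k ∷ g (suc k) ∷ g l ∷ g (suc l) ∷ [])
        X  = var 0
        X′ = var 1
        Y  = var 2
        G  = var 3
        G⁺ = var 4
        Q  = var 5
        Q⁺ = var 6

    -- z commutes with both outer factors, so the bracket reaches only u.
    [J,z] : ∀ a u → a ≤ m → bracket (J a u) z ≈ J a (bracket u z)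
    [J,z] a u a≤m = trans (conv-bracketʳ z a _) (conv-cong a term)
      where
      term : ∀ k l → k +ℕ l ≡ a → bracket (weight k * (g k * u * g l)) z ≈ weight k * (g k * bracket u z * g l)
      term k l eq = S.solveModulo (:bracket (β :* (G :* U :* Q)) Z) (β :* (G :* :bracket U Z :* Q))
        ( (β :* G :* U S.⟨ :bracket Q Z ≋ :0 ∣ [g,z] l (ℕ.≤-trans (≤-fromˡ eq) a≤m) ⟩ :1)
        ∷ (β S.⟨ :bracket G Z ≋ :0 ∣ [g,z] k (ℕ.≤-trans (≤-fromʳ eq) a≤m) ⟩ U :* Q) ∷ []) ≡-refl
        where
        module S = Evaluation (weighted k) (g k ∷ u ∷ g l ∷ z ∷ [])
        G = var 0
        U = var 1
        Q = var 2
        Z = var 3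

    J-vanishes : ∀ a {u} → u ≈ 0# → J a u ≈ 0#
    J-vanishes a u≈0 = conv-0 a (λ k l _ → trans (*-congˡ (trans (*-congʳ (trans (*-congˡ u≈0) (zeroʳ _))) (zeroˡ _))) (zeroʳ _))

    -- `H-suc` is iterated until the second index is 0, where H vanishes. The intermediate
    -- contributions contain [ψ j 0, z] with j < m and are zero; only the last one, at j = m, yields
    -- Δ.
    [H,z] : ∀ a i → i +ℕ suc a ≡ m → bracket (H i (suc a)) z ≈ (1# - b⁻¹) * Δ
    [H,z] a i eq = S.solveModulo (:bracket (var 0) (var 1)) ((:1 :- B⁻) :* var 4)
      ( (:1 S.⟨ var 0 ≋ var 2 :+ (:1 :- B⁻) :* var 3 ∣ H-suc i a (ℕ.≤-reflexive eq) ⟩ var 1)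
      ∷ (:0 :- var 1 S.⟨ var 0 ≋ var 2 :+ (:1 :- B⁻) :* var 3 ∣ H-suc i a (ℕ.≤-reflexive eq) ⟩ :1)
      ∷ (:1 S.⟨ :bracket (var 2) (var 1) :+ (:1 :- B⁻) :* :bracket (var 3) (var 1) ≋ (:1 :- B⁻) :* var 4 ∣ parts a eq ⟩ :1) ∷ []) ≡-refl
      where
      module S = Evaluation scalars (H i (suc a) ∷ z ∷ H (suc i) a ∷ J a (ψ (suc i) 0) ∷ Δ ∷ [])
      parts : ∀ a → i +ℕ suc a ≡ m →
        bracket (H (suc i) a) z + (1# - b⁻¹) * bracket (J a (ψ (suc i) 0)) z ≈ (1# - b⁻¹) * Δ
      parts zero eq = T.solveModulo (:bracket (var 0) (var 1) :+ (:1 :- B⁻) :* var 2) ((:1 :- B⁻) :* var 3)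
        ( (:1 T.⟨ var 0 ≋ :0 ∣ H-zero (suc i) ⟩ var 1)
        ∷ (:0 :- var 1 T.⟨ var 0 ≋ :0 ∣ H-zero (suc i) ⟩ :1)
        ∷ (:1 :- B⁻ T.⟨ var 2 ≋ :1 :* (var 4 :* var 5 :* var 4) ∣ [J,z] 0 (ψ (suc i) 0) z≤n ⟩ :1)
        ∷ ((:1 :- B⁻) :* var 4 T.⟨ var 5 ≋ var 3 ∣ [ψ,z] (suc i) 0 eq′ ⟩ var 4)
        ∷ (:1 :- B⁻ T.⟨ var 4 ≋ :1 ∣ g₀≈1 ⟩ var 3 :* var 4)
        ∷ ((:1 :- B⁻) :* var 3 T.⟨ var 4 ≋ :1 ∣ g₀≈1 ⟩ :1) ∷ []) ≡-refl
        where
        eq′ : suc i +ℕ 0 ≡ m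
        eq′ = ≡-trans (≡-sym (ℕ.+-suc i 0)) eq
        module T = Evaluation scalars
          (H (suc i) 0 ∷ z ∷ bracket (J 0 (ψ (suc i) 0)) z ∷ Δ ∷ g 0 ∷ bracket (ψ (suc i) 0) z ∷ [])
      parts (suc a) eq = T.solveModulo (var 0 :+ (:1 :- B⁻) :* var 1) ((:1 :- B⁻) :* var 2)
        ( (:1 T.⟨ var 0 ≋ (:1 :- B⁻) :* var 2 ∣ [H,z] a (suc i) eq′ ⟩ :1)
        ∷ (:1 :- B⁻ T.⟨ var 1 ≋ :0 ∣ trans ([J,z] (suc a) (ψ (suc i) 0) a<m) (J-vanishes (suc a) [ψ,z]≈0) ⟩ :1) ∷ []) ≡-refl
        where
        eq′ : suc i +ℕ suc a ≡ m
        eq′ = ≡-trans (≡-sym (ℕ.+-suc i (suc a))) eq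
        a<m : suc a ≤ m
        a<m = ≡-subst (suc a ≤_) eq′ (ℕ.m≤n+m (suc a) (suc i))
        [ψ,z]≈0 : bracket (ψ (suc i) 0) z ≈ 0#
        [ψ,z]≈0 = trans (ψ-derivation (suc i) 0) (trans (+-congʳ (ψ-shift (suc i) 0
          (≡-subst (_< m) (≡-sym (ℕ.+-identityʳ (suc i))) (≡-subst (suc i <_) eq′ (ℕ.m<m+n (suc i) (s≤s z≤n)))))) (-‿inverseʳ _))
        module T = Evaluation scalars
          (bracket (H (suc i) (suc a)) z ∷ bracket (J (suc a) (ψ (suc i) 0)) z ∷ Δ ∷ [])

    gg : ℕ → ℕ → Carrier
    gg k l = weight k * (g k * g l)

    -- Substituting h = g + D and (b-1)² D_{l+1} = b [x, v_l] removes h from the quadratic relation.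
    -- In the expansion of the rest, the sum of b Θ y vanishes by `Θˣ`, which leaves the terms with
    -- γ and with [x, g].
    gg-sum : s² * conv n gg ≈ (b - 1#) * J m γ - b * H 0 m
    gg-sum = S.solveModulo (:s² :* var 0) ((B :- :1) :* var 6 :- B :* var 7)
      ( (:0 :- :s² S.⟨ var 1 ≋ var 0 :+ var 2 ∣ gh-split ⟩ :1)
      ∷ (:1 S.⟨ :s² :* var 1 ≋ var 3 ∣ quadratic m ⟩ :1)
      ∷ (:0 :- :s² S.⟨ var 2 ≋ var 4 ∣ gD-sum ⟩ :1)
      ∷ (:1 S.⟨ var 3 :- :s² :* var 4 ≋ B :* var 5 :* var 8 :+ (B :- :1) :* var 6 :- B :* var 7 ∣ expanded ⟩ :1)
      ∷ (B S.⟨ var 5 ≋ :0 ∣ Θˣ ⟩ var 8) ∷ []) ≡-refl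
      where
      gD wv θ j η : ℕ → ℕ → Carrier
      gD k l = weight k * (g k * D l)
      wv k l = weight k * (w k * v l)
      θ k l = weight k * (b * x * g k * g l - (b + 1#) * g k * x * g l + g k * g l * x)
      j k l = weight k * (g k * γ * g l)
      η k l = weight k * (bracket x (g k) * y * g l - g k * y * bracket x (g l))
      module S = Evaluation scalars (conv n gg ∷ conv n gh ∷ conv n gD ∷ conv m wv ∷ conv m (λ k l → gD k (suc l))
        ∷ conv m θ ∷ J m γ ∷ H 0 m ∷ y ∷ [])

      gh-split : conv n gh ≈ conv n gg + conv n gD
      gh-split = trans (conv-cong n (λ k l _ → term k l)) (conv-+ n gg gD)
        where
        term : ∀ k l → gh k l ≈ gg k l + gD k l
        term k l = T.solve (var 0 :* (var 1 :* var 3)) (var 0 :* (var 1 :* var 2) :+ var 0 :* (var 1 :* (var 3 :- var 2))) ≡-refl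
          where module T = Evaluation [] (weight k ∷ g k ∷ g l ∷ h l ∷ [])

      gD-sum : conv n gD ≈ conv m (λ k l → gD k (suc l))
      gD-sum = trans (conv-last m gD) (trans (+-congˡ (trans (*-congˡ (trans (*-congˡ D₀≈0) (zeroʳ _))) (zeroʳ _))) (+-identityʳ _))

      expanded : conv m wv - s² * conv m (λ k l → gD k (suc l)) ≈ b * conv m θ * y + (b - 1#) * J m γ - b * H 0 m
      expanded = begin
        conv m wv - s² * conv m (λ k l → gD k (suc l))
          ≈⟨ +-congˡ (-‿cong (conv-*ˡ m s² _)) ⟩
        conv m wv - conv m (λ k l → s² * gD k (suc l))
          ≈⟨ conv-- m _ _ ⟨
        conv m (λ k l → wv k l - s² * gD k (suc l))
          ≈⟨ conv-cong m term ⟩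
        conv m (λ k l → b * θ k l * y + (b - 1#) * j k l - b * η k l)
          ≈⟨ conv-- m _ _ ⟩
        conv m (λ k l → b * θ k l * y + (b - 1#) * j k l) - conv m (λ k l → b * η k l)
          ≈⟨ +-cong (conv-+ m _ _) (-‿cong (sym (conv-*ˡ m b η))) ⟩
        conv m (λ k l → b * θ k l * y) + conv m (λ k l → (b - 1#) * j k l) - b * H 0 m
          ≈⟨ +-congʳ (+-cong (trans (*-congʳ (conv-*ˡ m b θ)) (conv-*ʳ m y _)) (conv-*ˡ m (b - 1#) j)) ⟨
        b * conv m θ * y + (b - 1#) * J m γ - b * H 0 m ∎
        where
        term : ∀ k l → k +ℕ l ≡ m → wv k l - s² * gD k (suc l) ≈ b * θ k l * y + (b - 1#) * j k l - b * η k l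
        term k l eq = T.solveModulo
          (β :* (:bracketᵇ X G :* :bracketᵇ Q Y) :- :s² :* (β :* (G :* D′)))
          (B :* (β :* (B :* X :* G :* Q :- (B :+ :1) :* G :* X :* Q :+ G :* Q :* X)) :* Y
            :+ (B :- :1) :* (β :* (G :* :bracketᵇ Y X :* Q))
            :- B :* (β :* (:bracket X G :* Y :* Q :- G :* Y :* :bracket X Q)))
          ( (:0 :- β :* G T.⟨ :s² :* D′ ≋ B :* :bracket X (:bracketᵇ Q Y) ∣ difference l ⟩ :1)
          ∷ (:0 :- β :* B :* G T.⟨ :bracket (:bracketᵇ Y X) Q ≋ :0 ∣ [γ,g] l (≤-fromˡ eq) ⟩ :1) ∷ []) ≡-refl
          where
          module T = Evaluation (weighted k) (x ∷ y ∷ g k ∷ g l ∷ D (suc l) ∷ [])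
          X = var 0
          Y = var 1
          G = var 2
          Q = var 3
          D′ = var 4

    [ψ₀₀,z]≈0 : bracket (ψ 0 0) z ≈ 0#
    [ψ₀₀,z]≈0 = S.solve (:bracket (var 0 :* var 1 :- B :* var 1 :* var 0) (P :* :bracketᵇ (var 1) (var 0))) :0 ≡-refl
      where module S = Evaluation scalars (x ∷ y ∷ [])

    [H₀,z] : ∀ k → k ≡ m → bracket (H 0 k) z ≈ (1# - b⁻¹) * Δ
    [H₀,z] zero ≡-refl = S.solveModulo (:bracket (var 0) (var 1)) ((:1 :- B⁻) :* var 2)
      ( (:1 S.⟨ var 0 ≋ :0 ∣ H-zero 0 ⟩ var 1)
      ∷ (:0 :- var 1 S.⟨ var 0 ≋ :0 ∣ H-zero 0 ⟩ :1)
      ∷ (:0 :- (:1 :- B⁻) S.⟨ var 2 ≋ :0 ∣ [ψ₀₀,z]≈0 ⟩ :1) ∷ []) ≡-refl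
      where module S = Evaluation scalars (H 0 0 ∷ z ∷ Δ ∷ [])
    [H₀,z] (suc k) eq = [H,z] k 0 eq

    -- Every g below level n commutes with z, so only the end terms (0,n) and (n,0) contribute.
    [gg,z] : bracket (conv n gg) z ≈ (1# + weight n) * bracket (g n) z
    [gg,z] = begin
      bracket (conv n gg) z                                       ≈⟨ conv-bracketʳ z n gg ⟩
      f 0 n + conv m (λ k l → f (suc k) l)                        ≈⟨ +-congˡ (conv-congLast m {λ k l → f (suc k) l} {λ _ _ → 0#} inner) ⟩
      f 0 n + (conv m (λ _ _ → 0#) + (f n 0 - 0#))                ≈⟨ +-congˡ (+-congʳ (conv-0 m {λ _ _ → 0#} (λ _ _ _ → refl))) ⟩
      f 0 n + (0# + (f n 0 - 0#))                                 ≈⟨ ends ⟩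
      (1# + weight n) * bracket (g n) z                           ∎
      where
      f : ℕ → ℕ → Carrier
      f k l = bracket (gg k l) z
      ends : f 0 n + (0# + (f n 0 - 0#)) ≈ (1# + weight n) * bracket (g n) z
      ends = S.solveModulo
        (:bracket (:1 :* (var 1 :* var 0)) Z :+ (:0 :+ (:bracket (β :* (var 0 :* var 1)) Z :- :0)))
        ((:1 :+ β) :* :bracket (var 0) Z)
        ( (:1 S.⟨ var 1 ≋ :1 ∣ g₀≈1 ⟩ var 0 :* Z) ∷ (:0 :- Z S.⟨ var 1 ≋ :1 ∣ g₀≈1 ⟩ var 0)
        ∷ (β :* var 0 S.⟨ var 1 ≋ :1 ∣ g₀≈1 ⟩ Z) ∷ (:0 :- β :* Z :* var 0 S.⟨ var 1 ≋ :1 ∣ g₀≈1 ⟩ :1) ∷ []) ≡-refl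
        where
        module S = Evaluation (weighted n) (g n ∷ g 0 ∷ z ∷ [])
        Z = var 2
      inner : ∀ k l → k +ℕ suc l ≡ m → f (suc k) (suc l) ≈ 0#
      inner k l eq = S.solveModulo (:bracket (β :* (var 0 :* var 1)) Z) :0
        ( (β :* var 0 S.⟨ :bracket (var 1) Z ≋ :0 ∣ [g,z] (suc l) (≤-fromˡ eq) ⟩ :1)
        ∷ (β S.⟨ :bracket (var 0) Z ≋ :0 ∣ [g,z] (suc k) (<-fromʳ eq) ⟩ var 1) ∷ []) ≡-refl
        where
        module S = Evaluation (weighted (suc k)) (g (suc k) ∷ g (suc l) ∷ z ∷ [])
        Z = var 2

    [gₙ,z]-Δ : s² * (1# + weight n) * bracket (g n) z ≈ (1# - b) * Δ
    [gₙ,z]-Δ = S.solveModulo (:s² :* (:1 :+ β) :* var 0) ((:1 :- B) :* var 1)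
      ( (:0 :- :s² S.⟨ :bracket (var 2) Z ≋ (:1 :+ β) :* var 0 ∣ [gg,z] ⟩ :1)
      ∷ (:1 S.⟨ :s² :* var 2 ≋ (B :- :1) :* var 4 :- B :* var 5 ∣ gg-sum ⟩ Z)
      ∷ (:0 :- Z S.⟨ :s² :* var 2 ≋ (B :- :1) :* var 4 :- B :* var 5 ∣ gg-sum ⟩ :1)
      ∷ (B :- :1 S.⟨ :bracket (var 4) Z ≋ :0 ∣ trans ([J,z] m γ ℕ.≤-refl) (J-vanishes m [γ,z]≈0) ⟩ :1)
      ∷ (:0 :- B S.⟨ :bracket (var 5) Z ≋ (:1 :- B⁻) :* var 1 ∣ [H₀,z] m ≡-refl ⟩ :1)
      ∷ (:1 S.⟨ B :* B⁻ ≋ :1 ∣ b*b⁻¹≈1 ⟩ var 1) ∷ []) ≡-refl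
      where
      module S = Evaluation (weighted n) (bracket (g n) z ∷ Δ ∷ conv n gg ∷ z ∷ J m γ ∷ H 0 m ∷ [])
      Z = var 3
      [γ,z]≈0 : bracket γ z ≈ 0#
      [γ,z]≈0 = T.solve (:bracket (var 0) (P :* var 0)) :0 ≡-refl
        where module T = Evaluation scalars (γ ∷ [])

    -- The two expressions for [g n , z] in terms of Δ, one from the
    -- commutation rules and one from the quadratic relation, disagree.
    Δ≈0 : ∀ k → k ≡ m → Δ ≈ 0#
    -- For m = 0 the factor used in the other case would contain b^0 + 1 = 2, which can vanish. Here
    -- Δ is the bracket of ψ 0 0 = -γ with a multiple of γ.
    Δ≈0 zero    ≡-refl = [ψ₀₀,z]≈0
    -- Eliminating [g n, γ] between `[ψ,g]` at i = j = 0 and `[gₙ,z]-Δ` leaves b (b^{n+1} -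
    -- 1)(b^{n-1} + 1) Δ = 0.
    Δ≈0 (suc k) ≡-refl = regular-* b-regular (regular-* (bⁿ-1-regular (suc m)) (bⁿ+1-regular k)) Δ (S.solveModulo
      (B :* ((B :* (B :* t) :- :1) :* (t :+ :1)) :* δ) :0
      ( (B :* t :* B :* (:1 :+ β) S.⟨ :bracket (X :* Y :- B :* Y :* X) G ≋ (B :* t :- :1) :* δ ∣ [ψ,g] n 0 0 ≡-refl ⟩ :0 :- :1)
      ∷ (B :* t :* (:1 :+ β) S.⟨ (B :+ :1) :* :s² :* P ≋ B ∣ ρ-equation ⟩ :0 :- :bracket G (:bracketᵇ Y X))
      ∷ (B :* t :* (B :+ :1) S.⟨ :s² :* (:1 :+ β) :* :bracket G (P :* :bracketᵇ Y X) ≋ (:1 :- B) :* δ ∣ [gₙ,z]-Δ ⟩ :1)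
      ∷ (:0 :- B :* (B :* t :- :1) S.⟨ (B :* t) :* β ≋ :1 ∣ b^*weight n ⟩ δ) ∷ []) ≡-refl)
      where
      module S = Evaluation (weighted n) (x ∷ y ∷ g n ∷ Δ ∷ b ^ m ∷ [])
      X = var 0
      Y = var 1
      G = var 2
      δ = var 3
      t = var 4

    [γ,gₙ] : bracket γ (g n) ≈ 0#
    [γ,gₙ] = regular-* (regular-* b-regular s²-regular) (1+weight-regular m) _ (S.solveModulo
      (B :* :s² :* (:1 :+ β) :* :bracket Γ G) :0
      ( (:0 :- :s² :* (:1 :+ β) S.⟨ (B :+ :1) :* :s² :* P ≋ B ∣ ρ-equation ⟩ :bracket Γ G)
      ∷ (:0 :- (B :+ :1) :* :s² S.⟨ :s² :* (:1 :+ β) :* :bracket G (P :* Γ) ≋ (:1 :- B) :* var 2 ∣ [gₙ,z]-Δ ⟩ :1)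
      ∷ (:0 :- (B :+ :1) :* :s² :* (:1 :- B) S.⟨ var 2 ≋ :0 ∣ Δ≈0 m ≡-refl ⟩ :1) ∷ []) ≡-refl)
      where
      module S = Evaluation (weighted n) (γ ∷ g n ∷ Δ ∷ [])
      Γ = var 0
      G = var 1

    upTo : ∀ (A : ℕ → Set ℓ) → (∀ k → k ≤ m → A k) → A n → ∀ k → k ≤ n → A k
    upTo A lower top k k≤n with ℕ.m≤n⇒m<n∨m≡n k≤n
    ... | inj₁ k<n    = lower k (ℕ.≤-pred k<n)
    ... | inj₂ ≡-refl = top

    below : ∀ (A : ℕ → Set ℓ) → (∀ k → k < m → A k) → A m → ∀ k → k < n → A k
    below A lower top k k<n with ℕ.m≤n⇒m<n∨m≡n (ℕ.≤-pred k<n)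
    ... | inj₁ k<m    = lower k k<m
    ... | inj₂ ≡-refl = top

    relations-suc : Relations n
    relations-suc = record
      { w≈w̃    = upTo _ w≈w̃ wₙ≈w̃ₙ
      ; v≈ṽ    = upTo _ v≈ṽ vₙ≈ṽₙ
      ; [x,w]  = upTo _ [x,w] [x,wₙ]
      ; [y,ṽ]  = upTo _ [y,ṽ] [y,ṽₙ]
      ; [γ,g]  = upTo _ [γ,g] [γ,gₙ]
      ; [γ̃,h]  = upTo _ [γ̃,h] (trans γ̃-exchange [γ,gₙ])
      ; [x,g]  = below _ [x,g] [x,gₙ]
      ; [g,y]  = below _ [g,y] [gₙ,y]
      ; [y,h]  = below _ [y,h] [y,hₙ]
      ; Θˣ     = trans Θˣ-defect (trans (+-congʳ (sym wₙ≈w̃ₙ)) (-‿inverseʳ _))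
      ; Θʸ     = trans Θʸ-defect (trans (*-congˡ (trans (+-congʳ (sym vₙ≈ṽₙ)) (-‿inverseʳ _))) (zeroʳ _))
      ; ψ-shift = shift
      }
      where
      shift : ∀ i j → i +ℕ j < n → ψ (suc i) j ≈ ψ i (suc j)
      shift i j p with ℕ.m≤n⇒m<n∨m≡n (ℕ.≤-pred p)
      ... | inj₁ i+j<m = ψ-shift i j i+j<m
      ... | inj₂ i+j≡m = S.solveModulo (var 0) (var 1)
        ((:1 S.⟨ var 0 :- var 1 ≋ :0 ∣ trans (ψ-shift-top i j i+j≡m) (Δ≈0 m ≡-refl) ⟩ :1) ∷ []) ≡-refl
        where module S = Evaluation [] (ψ (suc i) j ∷ ψ i (suc j) ∷ [])

  relations : ∀ m → Relations m
  relations zero    = relations-zero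
  relations (suc m) = Step.relations-suc m (relations m)

  [x,[x,g]ᵇ]≈0 : ∀ k → bracket x (bracketᵇ x (g k)) ≈ 0#
  [x,[x,g]ᵇ]≈0 k = Relations.[x,w] (relations k) k ℕ.≤-refl

  [x,[h,x]ᵇ]≈0 : ∀ k → bracket x (bracketᵇ (h k) x) ≈ 0#
  [x,[h,x]ᵇ]≈0 k = trans (+-cong (*-congˡ (sym w≈w̃ₖ)) (-‿cong (*-congʳ (sym w≈w̃ₖ)))) ([x,[x,g]ᵇ]≈0 k)
    where w≈w̃ₖ = Relations.w≈w̃ (relations k) k ℕ.≤-refl

  [y,[y,h]ᵇ]≈0 : ∀ k → bracket y (bracketᵇ y (h k)) ≈ 0#
  [y,[y,h]ᵇ]≈0 k = Relations.[y,ṽ] (relations k) k ℕ.≤-refl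

  [y,[g,y]ᵇ]≈0 : ∀ k → bracket y (bracketᵇ (g k) y) ≈ 0#
  [y,[g,y]ᵇ]≈0 k = trans (+-cong (*-congˡ v≈ṽₖ) (-‿cong (*-congʳ v≈ṽₖ))) ([y,[y,h]ᵇ]≈0 k)
    where v≈ṽₖ = Relations.v≈ṽ (relations k) k ℕ.≤-refl

open import Defs

-- Finite search up to double negation, and finite sums

¬¬-Fin : ∀ {p} {m} {P : Fin m → Set p} → (∀ i → ¬ ¬ P i) → ¬ ¬ (∀ i → P i)
¬¬-Fin {m = zero}  _ k = k λ ()
¬¬-Fin {m = suc m} p k = p fz λ p₀ → ¬¬-Fin (λ i → p (fs i)) λ ps → k λ { fz → p₀ ; (fs i) → ps i }

-- Used to locate a nonzero entry of a matrix. Equality in F is not decidable, so the entry is found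
-- only under a double negation, which suffices when the goal is ⊥.
¬¬-find : ∀ {p} {m} {P : Fin m → Set p} → ¬ (∀ i → P i) → ¬ ¬ (∃ λ i → ¬ P i)
¬¬-find ¬all k = ¬¬-Fin (λ i ¬p → k (i , ¬p)) ¬all

module FiniteSums {c ℓ} (F : Field c ℓ) where
  open Field F
  private module Sum = SemiringSum semiring

  sumF≡sum : ∀ {m} (f : Fin m → Carrier) → sumF F f ≡ Sum.sum f
  sumF≡sum {zero}  f = ≡-refl
  sumF≡sum {suc m} f = ≡-cong (f fz +_) (sumF≡sum (λ i → f (fs i)))

  sumF-cong : ∀ {m} {f f′ : Fin m → Carrier} → (∀ i → f i ≈ f′ i) → sumF F f ≈ sumF F f′
  sumF-cong {zero}  p = refl
  sumF-cong {suc m} p = +-cong (p fz) (sumF-cong (λ i → p (fs i)))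

  sumF-+ : ∀ {m} (f f′ : Fin m → Carrier) → sumF F (λ i → f i + f′ i) ≈ sumF F f + sumF F f′
  sumF-+ f f′ rewrite sumF≡sum (λ i → f i + f′ i) | sumF≡sum f | sumF≡sum f′ = Sum.∑-distrib-+ f f′

  sumF-*ˡ : ∀ {m} a (f : Fin m → Carrier) → a * sumF F f ≈ sumF F (λ i → a * f i)
  sumF-*ˡ a f rewrite sumF≡sum (λ i → a * f i) | sumF≡sum f = Sum.*-distribˡ-sum a f

  sumF-*ʳ : ∀ {m} a (f : Fin m → Carrier) → sumF F f * a ≈ sumF F (λ i → f i * a)
  sumF-*ʳ a f rewrite sumF≡sum (λ i → f i * a) | sumF≡sum f = Sum.*-distribʳ-sum a f

  sumF-swap : ∀ {m n} (f : Fin m → Fin n → Carrier) →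
              sumF F (λ i → sumF F (f i)) ≈ sumF F (λ j → sumF F (λ i → f i j))
  sumF-swap f = begin
    sumF F (λ i → sumF F (f i))                ≈⟨ sumF-cong (λ i → reflexive (sumF≡sum (f i))) ⟩
    sumF F (λ i → Sum.sum (f i))               ≡⟨ sumF≡sum (λ i → Sum.sum (f i)) ⟩
    Sum.sum (λ i → Sum.sum (f i))              ≈⟨ Sum.∑-comm f ⟩
    Sum.sum (λ j → Sum.sum (λ i → f i j))      ≡⟨ sumF≡sum (λ j → Sum.sum (λ i → f i j)) ⟨
    sumF F (λ j → Sum.sum (λ i → f i j))       ≈⟨ sumF-cong (λ j → reflexive (≡-sym (sumF≡sum (λ i → f i j)))) ⟩
    sumF F (λ j → sumF F (λ i → f i j))        ∎
    where open SetoidReasoning setoid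

  sumF-0 : ∀ {m} {f : Fin m → Carrier} → (∀ i → f i ≈ 0#) → sumF F f ≈ 0#
  sumF-0 {zero}  p = refl
  sumF-0 {suc m} p = trans (+-cong (p fz) (sumF-0 (λ i → p (fs i)))) (+-identityˡ 0#)

  sumF-single : ∀ {m} (i : Fin m) {f : Fin m → Carrier} → (∀ j → i ≢ j → f j ≈ 0#) → sumF F f ≈ f i
  sumF-single fz     p = trans (+-congˡ (sumF-0 (λ j → p (fs j) λ ()))) (+-identityʳ _)
  sumF-single (fs i) p = trans (+-cong (p fz λ ()) (sumF-single i (λ j i≢j → p (fs j) λ eq → i≢j (fs-injective eq)))) (+-identityˡ _)

  δ : ∀ {m} → Fin m → Fin m → Carrier
  δ i j = if does (i ≟F j) then 1# else 0#

  δ-diagonal : ∀ {m} (i : Fin m) → δ i i ≈ 1#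
  δ-diagonal i with i ≟F i
  ... | yes _   = refl
  ... | no  i≢i = ⊥-elim (i≢i ≡-refl)

  δ-offDiagonal : ∀ {m} {i j : Fin m} → i ≢ j → δ i j ≈ 0#
  δ-offDiagonal {i = i} {j} i≢j with i ≟F j
  ... | yes i≡j = ⊥-elim (i≢j i≡j)
  ... | no  _   = refl

  sumF-δˡ : ∀ {m} (i : Fin m) (f : Fin m → Carrier) → sumF F (λ j → δ i j * f j) ≈ f i
  sumF-δˡ i f = trans
    (sumF-single i (λ j i≢j → trans (*-congʳ (δ-offDiagonal i≢j)) (zeroˡ _)))
    (trans (*-congʳ (δ-diagonal i)) (*-identityˡ _))

  sumF-δʳ : ∀ {m} (i : Fin m) (f : Fin m → Carrier) → sumF F (λ j → f j * δ j i) ≈ f i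
  sumF-δʳ i f = trans
    (sumF-single i (λ j i≢j → trans (*-congˡ (δ-offDiagonal (λ eq → i≢j (≡-sym eq)))) (zeroʳ _)))
    (trans (*-congˡ (δ-diagonal i)) (*-identityʳ _))

-- Determinants via the exterior algebra: an element of Λ(Fⁿ) is given by
-- its coefficients on the basis indexed by subsets of {0,…,n-1}.
module Determinants {c ℓ} (F : Field c ℓ) where
  open Field F
  open FiniteSums F
  open NoncommutativeSolver ring
  open SetoidReasoning setoid

  commuting : Carrier → Σ Carrier Central
  commuting a = a , *-comm a

  Form : ℕ → Set c
  Form n = Vec Bool n → Carrier

  unit : ∀ {n} → Form n
  unit []ᵛ           = 1#
  unit (false ∷ᵛ s) = unit s
  unit (true  ∷ᵛ s) = 0#

  infixr 7 _∧̂_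
  -- The basis vector e_0 stands leftmost in each basis element. Moving the remaining part of v past
  -- it produces the minus sign in the `true` case.
  _∧̂_ : ∀ {n} → Vect F n → Form n → Form n
  (v ∧̂ x) []ᵛ           = 0#
  (v ∧̂ x) (false ∷ᵛ s) = ((λ i → v (fs i)) ∧̂ (λ t → x (false ∷ᵛ t))) s
  (v ∧̂ x) (true  ∷ᵛ s) = v fz * x (false ∷ᵛ s) - ((λ i → v (fs i)) ∧̂ (λ t → x (true ∷ᵛ t))) s

  ∧̂-cong : ∀ {n} {u v : Vect F n} {x y : Form n} → (∀ i → u i ≈ v i) → (∀ s → x s ≈ y s) → ∀ s → (u ∧̂ x) s ≈ (v ∧̂ y) s
  ∧̂-cong p q []ᵛ           = refl
  ∧̂-cong p q (false ∷ᵛ s) = ∧̂-cong (λ i → p (fs i)) (λ t → q (false ∷ᵛ t)) s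
  ∧̂-cong p q (true  ∷ᵛ s) = +-cong (*-cong (p fz) (q (false ∷ᵛ s))) (-‿cong (∧̂-cong (λ i → p (fs i)) (λ t → q (true ∷ᵛ t)) s))

  ∧̂-congʳ : ∀ {n} (u : Vect F n) {x y : Form n} → (∀ s → x s ≈ y s) → ∀ s → (u ∧̂ x) s ≈ (u ∧̂ y) s
  ∧̂-congʳ u = ∧̂-cong (λ _ → refl)

  ∧̂-linearˡ : ∀ {n} (u v : Vect F n) a x s → ((λ i → u i + a * v i) ∧̂ x) s ≈ (u ∧̂ x) s + a * (v ∧̂ x) s
  ∧̂-linearˡ u v a x []ᵛ           = solve :0 (:0 :+ var 0 :* :0) ≡-refl
    where open Evaluation [] (a ∷ [])
  ∧̂-linearˡ u v a x (false ∷ᵛ s) = ∧̂-linearˡ _ _ a _ s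
  ∧̂-linearˡ u v a x (true  ∷ᵛ s) = trans (+-congˡ (-‿cong (∧̂-linearˡ (λ i → u (fs i)) (λ i → v (fs i)) a _ s)))
    (solve ((var 0 :+ cvar 0 :* var 1) :* var 2 :- (var 3 :+ cvar 0 :* var 4))
           ((var 0 :* var 2 :- var 3) :+ cvar 0 :* (var 1 :* var 2 :- var 4)) ≡-refl)
    where open Evaluation (commuting a ∷ []) (u fz ∷ v fz ∷ x (false ∷ᵛ s) ∷ ((λ i → u (fs i)) ∧̂ (λ t → x (true ∷ᵛ t))) s ∷ ((λ i → v (fs i)) ∧̂ (λ t → x (true ∷ᵛ t))) s ∷ [])

  ∧̂-linearʳ : ∀ {n} (u : Vect F n) a x y s → (u ∧̂ (λ t → x t + a * y t)) s ≈ (u ∧̂ x) s + a * (u ∧̂ y) s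
  ∧̂-linearʳ u a x y []ᵛ           = solve :0 (:0 :+ var 0 :* :0) ≡-refl
    where open Evaluation [] (a ∷ [])
  ∧̂-linearʳ u a x y (false ∷ᵛ s) = ∧̂-linearʳ _ a _ _ s
  ∧̂-linearʳ u a x y (true  ∷ᵛ s) = trans (+-congˡ (-‿cong (∧̂-linearʳ (λ i → u (fs i)) a _ _ s)))
    (solve (var 0 :* (var 1 :+ cvar 0 :* var 2) :- (var 3 :+ cvar 0 :* var 4))
           ((var 0 :* var 1 :- var 3) :+ cvar 0 :* (var 0 :* var 2 :- var 4)) ≡-refl)
    where open Evaluation (commuting a ∷ []) (u fz ∷ x (false ∷ᵛ s) ∷ y (false ∷ᵛ s) ∷ ((λ i → u (fs i)) ∧̂ (λ t → x (true ∷ᵛ t))) s ∷ ((λ i → u (fs i)) ∧̂ (λ t → y (true ∷ᵛ t))) s ∷ [])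

  ∧̂-zeroʳ : ∀ {n} (u : Vect F n) {x} → (∀ s → x s ≈ 0#) → ∀ s → (u ∧̂ x) s ≈ 0#
  ∧̂-zeroʳ u p []ᵛ           = refl
  ∧̂-zeroʳ u p (false ∷ᵛ s) = ∧̂-zeroʳ _ (λ t → p (false ∷ᵛ t)) s
  ∧̂-zeroʳ u p (true  ∷ᵛ s) = trans (+-cong (trans (*-congˡ (p _)) (zeroʳ _)) (-‿cong (∧̂-zeroʳ (λ i → u (fs i)) (λ t → p (true ∷ᵛ t)) s)))
    (-‿inverseʳ 0#)

  ∧̂-zeroˡ : ∀ {n} {u : Vect F n} x → (∀ i → u i ≈ 0#) → ∀ s → (u ∧̂ x) s ≈ 0#
  ∧̂-zeroˡ x p []ᵛ           = refl
  ∧̂-zeroˡ x p (false ∷ᵛ s) = ∧̂-zeroˡ _ (λ i → p (fs i)) s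
  ∧̂-zeroˡ x p (true  ∷ᵛ s) = trans (+-cong (trans (*-congʳ (p fz)) (zeroˡ _)) (-‿cong (∧̂-zeroˡ _ (λ i → p (fs i)) s)))
    (-‿inverseʳ 0#)

  private
    -- The sign is written as multiplication by the scalar -1, so that linearity in the second
    -- argument applies.
    slice : ∀ {n} (u v : Vect F (suc n)) x (s : Vec Bool n) → (u ∧̂ v ∧̂ x) (true ∷ᵛ s) ≈
      u fz * ((λ i → v (fs i)) ∧̂ (λ t → x (false ∷ᵛ t))) s -
      (- 1# * ((λ i → u (fs i)) ∧̂ (λ i → v (fs i)) ∧̂ (λ t → x (true ∷ᵛ t))) s + v fz * ((λ i → u (fs i)) ∧̂ (λ t → x (false ∷ᵛ t))) s)
    slice u v x s = +-congˡ (-‿cong (begin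
      (u′ ∧̂ (λ t → v fz * x (false ∷ᵛ t) - y t)) s              ≈⟨ ∧̂-congʳ u′ (λ t → rearrange (v fz * x (false ∷ᵛ t)) (y t)) s ⟩
      (u′ ∧̂ (λ t → (0# + - 1# * y t) + v fz * x (false ∷ᵛ t))) s ≈⟨ ∧̂-linearʳ u′ (v fz) _ _ s ⟩
      (u′ ∧̂ (λ t → 0# + - 1# * y t)) s + v fz * (u′ ∧̂ (λ t → x (false ∷ᵛ t))) s
                                                                ≈⟨ +-congʳ (trans (∧̂-linearʳ u′ (- 1#) (λ _ → 0#) y s) (trans (+-congʳ (∧̂-zeroʳ u′ (λ _ → refl) s)) (+-identityˡ _))) ⟩
      - 1# * (u′ ∧̂ y) s + v fz * (u′ ∧̂ (λ t → x (false ∷ᵛ t))) s ∎))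
      where
      u′ = λ i → u (fs i)
      y  = (λ i → v (fs i)) ∧̂ (λ t → x (true ∷ᵛ t))
      rearrange : ∀ p q → p - q ≈ (0# + - 1# * q) + p
      rearrange p q = trans (+-congˡ (-‿cong (sym (*-identityˡ q))))
        (trans (+-congˡ (RingProperties.-‿distribˡ-* ring 1# q)) (trans (+-comm _ _) (+-congʳ (sym (+-identityˡ _)))))

  -- Proved on its own, because anticommutativity yields only 2 (u ∧ u ∧ x) = 0, which is void in
  -- characteristic two.
  ∧̂-square : ∀ {n} (u : Vect F n) x s → (u ∧̂ u ∧̂ x) s ≈ 0#
  ∧̂-square u x []ᵛ           = refl
  ∧̂-square u x (false ∷ᵛ s) = ∧̂-square _ _ s
  ∧̂-square u x (true  ∷ᵛ s) = trans (slice u u x s) (solveModulo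
    (var 0 :* var 1 :- (var 2 :* var 3 :+ var 0 :* var 1)) :0
    ((:0 :- var 2 ⟨ var 3 ≋ :0 ∣ ∧̂-square (λ i → u (fs i)) (λ t → x (true ∷ᵛ t)) s ⟩ :1) ∷ []) ≡-refl)
    where open Evaluation [] (u fz ∷ ((λ i → u (fs i)) ∧̂ (λ t → x (false ∷ᵛ t))) s ∷ (- 1#) ∷ ((λ i → u (fs i)) ∧̂ (λ i → u (fs i)) ∧̂ (λ t → x (true ∷ᵛ t))) s ∷ [])

  ∧̂-anticomm : ∀ {n} (u v : Vect F n) x s → (u ∧̂ v ∧̂ x) s + (v ∧̂ u ∧̂ x) s ≈ 0#
  ∧̂-anticomm u v x []ᵛ           = +-identityˡ 0#
  ∧̂-anticomm u v x (false ∷ᵛ s) = ∧̂-anticomm _ _ _ s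
  ∧̂-anticomm u v x (true  ∷ᵛ s) = trans (+-cong (slice u v x s) (slice v u x s)) (solveModulo
    ((var 0 :* var 3 :- (var 4 :* var 5 :+ var 1 :* var 2)) :+ (var 1 :* var 2 :- (var 4 :* var 6 :+ var 0 :* var 3))) :0
    ((:0 :- var 4 ⟨ var 5 :+ var 6 ≋ :0 ∣ ∧̂-anticomm (λ i → u (fs i)) (λ i → v (fs i)) (λ t → x (true ∷ᵛ t)) s ⟩ :1) ∷ []) ≡-refl)
    where
    u′ = λ i → u (fs i)
    v′ = λ i → v (fs i)
    open Evaluation [] (u fz ∷ v fz ∷ (u′ ∧̂ (λ t → x (false ∷ᵛ t))) s ∷ (v′ ∧̂ (λ t → x (false ∷ᵛ t))) s ∷ (- 1#)
      ∷ (u′ ∧̂ v′ ∧̂ (λ t → x (true ∷ᵛ t))) s ∷ (v′ ∧̂ u′ ∧̂ (λ t → x (true ∷ᵛ t))) s ∷ [])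

  ∧̂-vanish-swap : ∀ {n} (u v : Vect F n) x → (∀ s → (u ∧̂ x) s ≈ 0#) → ∀ s → (u ∧̂ v ∧̂ x) s ≈ 0#
  ∧̂-vanish-swap u v x p s = begin
    (u ∧̂ v ∧̂ x) s                    ≈⟨ +-identityʳ _ ⟨
    (u ∧̂ v ∧̂ x) s + 0#               ≈⟨ +-congˡ (∧̂-zeroʳ v p s) ⟨
    (u ∧̂ v ∧̂ x) s + (v ∧̂ u ∧̂ x) s   ≈⟨ ∧̂-anticomm u v x s ⟩
    0#                               ∎

  wedge : ∀ {m n} → (Fin m → Vect F n) → Form n
  wedge {zero}  f = unit
  wedge {suc m} f = f fz ∧̂ wedge (λ i → f (fs i))

  wedgeReplacing : ∀ {m n} → (Fin m → Vect F n) → Fin m → Vect F n → Form n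
  wedgeReplacing f fz     u = u ∧̂ wedge (λ i → f (fs i))
  wedgeReplacing f (fs i) u = f fz ∧̂ wedgeReplacing (λ j → f (fs j)) i u

  ∧̂-wedge : ∀ {m n} (f : Fin m → Vect F n) i s → (f i ∧̂ wedge f) s ≈ 0#
  ∧̂-wedge f fz     s = ∧̂-square (f fz) _ s
  ∧̂-wedge f (fs i) s = ∧̂-vanish-swap (f (fs i)) (f fz) _ (∧̂-wedge (λ j → f (fs j)) i) s

  ∧̂-wedgeReplacing : ∀ {m n} (f : Fin m → Vect F n) i u s → (u ∧̂ wedgeReplacing f i u) s ≈ 0#
  ∧̂-wedgeReplacing f fz     u s = ∧̂-square u _ s
  ∧̂-wedgeReplacing f (fs i) u s = ∧̂-vanish-swap u (f fz) _ (∧̂-wedgeReplacing (λ j → f (fs j)) i u) s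

  wedgeReplacing-same : ∀ {m n} (f : Fin m → Vect F n) i s → wedgeReplacing f i (f i) s ≈ wedge f s
  wedgeReplacing-same f fz     s = refl
  wedgeReplacing-same f (fs i) s = ∧̂-congʳ (f fz) (wedgeReplacing-same (λ j → f (fs j)) i) s

  wedgeReplacing-other : ∀ {m n} (f : Fin m → Vect F n) i k → i ≢ k → ∀ s → wedgeReplacing f i (f k) s ≈ 0#
  wedgeReplacing-other f fz     fz     i≢k s = ⊥-elim (i≢k ≡-refl)
  wedgeReplacing-other f fz     (fs k) i≢k s = ∧̂-wedge (λ j → f (fs j)) k s
  wedgeReplacing-other f (fs i) fz     i≢k s = ∧̂-wedgeReplacing (λ j → f (fs j)) i (f fz) s
  wedgeReplacing-other f (fs i) (fs k) i≢k s = ∧̂-zeroʳ (f fz)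
    (wedgeReplacing-other (λ j → f (fs j)) i k (λ eq → i≢k (≡-cong fs eq))) s

  wedgeReplacing-cong : ∀ {m n} (f : Fin m → Vect F n) i {u v} → (∀ j → u j ≈ v j) → ∀ s → wedgeReplacing f i u s ≈ wedgeReplacing f i v s
  wedgeReplacing-cong f fz     p s = ∧̂-cong p (λ _ → refl) s
  wedgeReplacing-cong f (fs i) p s = ∧̂-congʳ (f fz) (wedgeReplacing-cong _ i p) s

  wedgeReplacing-linear : ∀ {m n} (f : Fin m → Vect F n) i u v a s →
    wedgeReplacing f i (λ j → u j + a * v j) s ≈ wedgeReplacing f i u s + a * wedgeReplacing f i v s
  wedgeReplacing-linear f fz     u v a s = ∧̂-linearˡ u v a _ s
  wedgeReplacing-linear f (fs i) u v a s = trans (∧̂-congʳ (f fz) (wedgeReplacing-linear _ i u v a) s) (∧̂-linearʳ (f fz) a _ _ s)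

  wedgeReplacing-zero : ∀ {m n} (f : Fin m → Vect F n) i s → wedgeReplacing f i (λ _ → 0#) s ≈ 0#
  wedgeReplacing-zero f fz     s = ∧̂-zeroˡ _ (λ _ → refl) s
  wedgeReplacing-zero f (fs i) s = ∧̂-zeroʳ (f fz) (wedgeReplacing-zero _ i) s

  wedgeReplacing-sum : ∀ {m n k} (f : Fin m → Vect F n) i (a : Fin k → Carrier) (u : Fin k → Vect F n) s →
    wedgeReplacing f i (λ r → sumF F (λ j → a j * u j r)) s ≈ sumF F (λ j → a j * wedgeReplacing f i (u j) s)
  wedgeReplacing-sum {k = zero}  f i a u s = wedgeReplacing-zero f i s
  wedgeReplacing-sum {k = suc k} f i a u s = begin
    wedgeReplacing f i (λ r → a fz * u fz r + rest r) s               ≈⟨ wedgeReplacing-cong f i (λ r → +-comm _ _) s ⟩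
    wedgeReplacing f i (λ r → rest r + a fz * u fz r) s               ≈⟨ wedgeReplacing-linear f i rest (u fz) (a fz) s ⟩
    wedgeReplacing f i rest s + a fz * wedgeReplacing f i (u fz) s    ≈⟨ +-congʳ (wedgeReplacing-sum f i (λ j → a (fs j)) (λ j → u (fs j)) s) ⟩
    sumF F (λ j → a (fs j) * wedgeReplacing f i (u (fs j)) s) + a fz * wedgeReplacing f i (u fz) s ≈⟨ +-comm _ _ ⟩
    sumF F (λ j → a j * wedgeReplacing f i (u j) s)                   ∎
    where
    rest = λ r → sumF F (λ j → a (fs j) * u (fs j) r)

  ⊤ᵛ : ∀ {n} → Vec Bool n
  ⊤ᵛ = replicate _ true

  det : ∀ {n} → Mat F n → Carrier
  det M = wedge M ⊤ᵛ

  cofactor : ∀ {n} → Mat F n → Mat F n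
  cofactor M j i = wedgeReplacing M i (δ j) ⊤ᵛ

  -- By multilinearity the sum is the determinant of M with row i replaced by row k: this is det M
  -- for k = i, and has a repeated row otherwise.
  cramer : ∀ {n} (M : Mat F n) k i → sumF F (λ j → M k j * cofactor M j i) ≈ det M * δ k i
  cramer M k i = begin
    sumF F (λ j → M k j * wedgeReplacing M i (δ j) ⊤ᵛ)        ≈⟨ wedgeReplacing-sum M i (M k) δ ⊤ᵛ ⟨
    wedgeReplacing M i (λ r → sumF F (λ j → M k j * δ j r)) ⊤ᵛ ≈⟨ wedgeReplacing-cong M i (λ r → sumF-δʳ r (M k)) ⊤ᵛ ⟩
    wedgeReplacing M i (M k) ⊤ᵛ                                ≈⟨ diagonal ⟩
    det M * δ k i                                              ∎
    where
    diagonal : wedgeReplacing M i (M k) ⊤ᵛ ≈ det M * δ k i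
    diagonal with k ≟F i
    ... | yes ≡-refl = trans (wedgeReplacing-same M i ⊤ᵛ) (sym (*-identityʳ _))
    ... | no  k≢i    = trans (wedgeReplacing-other M i k (λ eq → k≢i (≡-sym eq)) ⊤ᵛ) (sym (zeroʳ _))

  -- Row operations: once u has been moved next to a factor, the multiple of u in that factor is
  -- absorbed by `∧̂-square`.
  ∧̂-wedge-reduce : ∀ {m n} (u : Vect F n) (f f′ : Fin m → Vect F n) (a : Fin m → Carrier) →
    (∀ i j → f′ i j ≈ f i j + a i * u j) → ∀ s → (u ∧̂ wedge f) s ≈ (u ∧̂ wedge f′) s
  ∧̂-wedge-reduce {zero}  u f f′ a p s = refl
  ∧̂-wedge-reduce {suc m} u f f′ a p s = solveModulo (var 0) (var 1)
    ( (:1 ⟨ var 0 :+ var 2 ≋ :0 ∣ ∧̂-anticomm u (f fz) W s ⟩ :1)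
    ∷ (:0 :- :1 ⟨ var 3 :+ var 4 ≋ :0 ∣ ∧̂-anticomm u (f fz) W′ s ⟩ :1)
    ∷ (:0 :- :1 ⟨ var 2 ≋ var 4 ∣ ∧̂-congʳ (f fz) (∧̂-wedge-reduce u _ _ (λ i → a (fs i)) (λ i → p (fs i))) s ⟩ :1)
    ∷ (:0 :- :1 ⟨ var 1 ≋ var 3 ∣ absorbed ⟩ :1) ∷ []) ≡-refl
    where
    W  = wedge (λ i → f (fs i))
    W′ = wedge (λ i → f′ (fs i))
    open Evaluation [] ((u ∧̂ f fz ∧̂ W) s ∷ (u ∧̂ f′ fz ∧̂ W′) s ∷ (f fz ∧̂ u ∧̂ W) s ∷ (u ∧̂ f fz ∧̂ W′) s ∷ (f fz ∧̂ u ∧̂ W′) s ∷ [])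
    absorbed : (u ∧̂ f′ fz ∧̂ W′) s ≈ (u ∧̂ f fz ∧̂ W′) s
    absorbed = begin
      (u ∧̂ f′ fz ∧̂ W′) s                                              ≈⟨ ∧̂-congʳ u (∧̂-cong (p fz) (λ _ → refl)) s ⟩
      (u ∧̂ (λ i → f fz i + a fz * u i) ∧̂ W′) s                        ≈⟨ ∧̂-congʳ u (∧̂-linearˡ (f fz) u (a fz) W′) s ⟩
      (u ∧̂ (λ t → (f fz ∧̂ W′) t + a fz * (u ∧̂ W′) t)) s               ≈⟨ ∧̂-linearʳ u (a fz) _ _ s ⟩
      (u ∧̂ f fz ∧̂ W′) s + a fz * (u ∧̂ u ∧̂ W′) s                       ≈⟨ +-congˡ (trans (*-congˡ (∧̂-square u W′ s)) (zeroʳ _)) ⟩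
      (u ∧̂ f fz ∧̂ W′) s + 0#                                          ≈⟨ +-identityʳ _ ⟩
      (u ∧̂ f fz ∧̂ W′) s                                               ∎

  wedge-false : ∀ {m n} (f : Fin m → Vect F (suc n)) s → wedge f (false ∷ᵛ s) ≈ wedge (λ i j → f i (fs j)) s
  wedge-false {zero}  f s = refl
  wedge-false {suc m} f s = ∧̂-congʳ _ (wedge-false (λ i → f (fs i))) s

  wedge-true : ∀ {m n} (f : Fin m → Vect F (suc n)) → (∀ i → f i fz ≈ 0#) → ∀ s → wedge f (true ∷ᵛ s) ≈ 0#
  wedge-true {zero}  f p s = refl
  wedge-true {suc m} f p s = trans
    (+-cong (trans (*-congʳ (p fz)) (zeroˡ _)) (-‿cong (∧̂-zeroʳ _ (wedge-true (λ i → f (fs i)) (λ i → p (fs i))) s)))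
    (-‿inverseʳ 0#)

  -- The conclusion is doubly negated because transversality of the flags is available only in that
  -- form.
  Injective : ∀ {n} → Mat F n → Set (c ⊔ ℓ)
  Injective {n} M = ∀ (v : Vect F n) → (∀ i → sumF F (λ j → M i j * v j) ≈ 0#) → ¬ ¬ (∀ j → v j ≈ 0#)

  -- Gaussian elimination under a negation: the goal is ⊥, so a pivot that exists up to double
  -- negation is good enough.
  det≉0 : ∀ n (M : Mat F n) → Injective M → ¬ (det M ≈ 0#)

  -- The Schur complement S of the pivot a satisfies det M = a det S and inherits injectivity.
  det≉0-pivot : ∀ n (M : Mat F (suc n)) → Injective M → ¬ (M fz fz ≈ 0#) → ¬ (det M ≈ 0#)
  det≉0-pivot n M inj a≉0 det≈0 = det≉0 n S S-injective (begin
    det S                          ≈⟨ *-identityˡ _ ⟨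
    1# * det S                     ≈⟨ *-congʳ (trans (*-comm _ _) aa⁻¹≈1) ⟨
    a ⁻¹ * a * det S               ≈⟨ *-assoc _ _ _ ⟩
    a ⁻¹ * (a * det S)             ≈⟨ *-congˡ expand ⟨
    a ⁻¹ * det M                   ≈⟨ *-congˡ det≈0 ⟩
    a ⁻¹ * 0#                      ≈⟨ zeroʳ _ ⟩
    0#                             ∎)
    where
    a = M fz fz
    aa⁻¹≈1 : a * a ⁻¹ ≈ 1#
    aa⁻¹≈1 = ⁻¹-inverse a a≉0
    coef : Fin n → Carrier
    coef i = - (M (fs i) fz * a ⁻¹)
    rows : Fin n → Vect F (suc n)
    rows i j = M (fs i) j + coef i * M fz j
    S : Mat F n
    S i j = rows i (fs j)

    rows₀≈0 : ∀ i → rows i fz ≈ 0#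
    rows₀≈0 i = begin
      m + - (m * a ⁻¹) * a    ≈⟨ +-congˡ (RingProperties.-‿distribˡ-* ring _ _) ⟨
      m - m * a ⁻¹ * a        ≈⟨ +-congˡ (-‿cong (trans (*-assoc _ _ _) (trans (*-congˡ (trans (*-comm _ _) aa⁻¹≈1)) (*-identityʳ m)))) ⟩
      m - m                   ≈⟨ -‿inverseʳ m ⟩
      0#                      ∎
      where m = M (fs i) fz

    expand : det M ≈ a * det S
    expand = begin
      det M
        ≈⟨ ∧̂-wedge-reduce (M fz) (λ i → M (fs i)) rows coef (λ _ _ → refl) ⊤ᵛ ⟩
      a * wedge rows (false ∷ᵛ ⊤ᵛ) - ((λ j → M fz (fs j)) ∧̂ (λ t → wedge rows (true ∷ᵛ t))) ⊤ᵛ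
        ≈⟨ +-cong (*-congˡ (wedge-false rows ⊤ᵛ)) (-‿cong (∧̂-zeroʳ _ (wedge-true rows rows₀≈0) ⊤ᵛ)) ⟩
      a * det S - 0#
        ≈⟨ solve (var 0 :- :0) (var 0) ≡-refl ⟩
      a * det S ∎
      where open Evaluation [] (a * det S ∷ [])

    S-injective : Injective S
    S-injective u Su≈0 k = inj v Mv≈0 (λ v≈0 → k (λ j → v≈0 (fs j)))
      where
      σ : Carrier
      σ = sumF F (λ j → M fz (fs j) * u j)
      v : Vect F (suc n)
      -- A kernel vector of S is extended by the coordinate that makes row 0 of M annihilate it.
      v fz     = - (a ⁻¹ * σ)
      v (fs j) = u j
      Mv≈0 : ∀ i → sumF F (λ j → M i j * v j) ≈ 0#
      Mv≈0 fz     = begin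
        a * - (a ⁻¹ * σ) + σ      ≈⟨ +-congʳ (RingProperties.-‿distribʳ-* ring _ _) ⟨
        - (a * (a ⁻¹ * σ)) + σ    ≈⟨ +-congʳ (-‿cong (trans (sym (*-assoc _ _ _)) (trans (*-congʳ aa⁻¹≈1) (*-identityˡ σ)))) ⟩
        - σ + σ                   ≈⟨ -‿inverseˡ σ ⟩
        0#                        ∎
      Mv≈0 (fs i) = begin
        m * - (a ⁻¹ * σ) + τ                          ≈⟨ +-congʳ (trans (sym (RingProperties.-‿distribʳ-* ring _ _)) (trans (-‿cong (sym (*-assoc _ _ _))) (RingProperties.-‿distribˡ-* ring _ _))) ⟩
        coef i * σ + τ                                ≈⟨ +-comm _ _ ⟩
        τ + coef i * σ                                ≈⟨ +-congˡ (trans (sumF-*ˡ (coef i) (λ j → M fz (fs j) * u j)) (sumF-cong (λ j → sym (*-assoc (coef i) (M fz (fs j)) (u j))))) ⟩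
        τ + sumF F (λ j → coef i * M fz (fs j) * u j) ≈⟨ sumF-+ (λ j → M (fs i) (fs j) * u j) (λ j → coef i * M fz (fs j) * u j) ⟨
        sumF F (λ j → M (fs i) (fs j) * u j + coef i * M fz (fs j) * u j) ≈⟨ sumF-cong (λ j → distribʳ (u j) (M (fs i) (fs j)) (coef i * M fz (fs j))) ⟨
        sumF F (λ j → S i j * u j)                    ≈⟨ Su≈0 i ⟩
        0#                                            ∎
        where
        m = M (fs i) fz
        τ = sumF F (λ j → M (fs i) (fs j) * u j)

  det≉0 zero    M inj det≈0 = 0≉1 (sym det≈0)
  det≉0 (suc n) M inj det≈0 = ¬¬-find column≉0 λ (i , Mi≉0) → moveUp i Mi≉0
    where
    column≉0 : ¬ (∀ i → M i fz ≈ 0#)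
    column≉0 column≈0 = inj (δ fz)
      (λ i → trans (+-cong (trans (*-congʳ (column≈0 i)) (zeroˡ _)) (sumF-0 (λ j → zeroʳ (M i (fs j))))) (+-identityˡ 0#))
      (λ δ≈0 → 0≉1 (sym (δ≈0 fz)))

    moveUp : ∀ i → ¬ (M i fz ≈ 0#) → ⊥
    moveUp fz     Mi≉0 = det≉0-pivot n M inj Mi≉0 det≈0
    -- Whether the corner entry vanishes cannot be decided. If it did, adding row i + 1 to row 0
    -- would give a pivot without changing the determinant, a contradiction; hence it is nonzero and
    -- M has its pivot already.
    moveUp (fs i) Mi≉0 = det≉0-pivot n M inj M₀≉0 det≈0
      where
      M′ : Mat F (suc n)
      M′ fz     j = M fz j + 1# * M (fs i) j
      M′ (fs k) j = M (fs k) j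

      M′-injective : Injective M′
      M′-injective v M′v≈0 = inj v λ where
        (fs k) → M′v≈0 (fs k)
        fz     → begin
          sumF F (λ j → M fz j * v j)
            ≈⟨ +-identityʳ _ ⟨
          sumF F (λ j → M fz j * v j) + 0#
            ≈⟨ +-congˡ (M′v≈0 (fs i)) ⟨
          sumF F (λ j → M fz j * v j) + sumF F (λ j → M (fs i) j * v j)
            ≈⟨ sumF-+ (λ j → M fz j * v j) (λ j → M (fs i) j * v j) ⟨
          sumF F (λ j → M fz j * v j + M (fs i) j * v j)
            ≈⟨ sumF-cong {suc n} (λ j → trans (*-congʳ (+-congˡ (*-identityˡ (M (fs i) j)))) (distribʳ (v j) (M fz j) (M (fs i) j))) ⟨
          sumF F (λ j → M′ fz j * v j)
            ≈⟨ M′v≈0 fz ⟩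
          0# ∎

      M₀≉0 : ¬ (M fz fz ≈ 0#)
      M₀≉0 M₀≈0 = det≉0-pivot n M′ M′-injective
        (λ M′₀≈0 → Mi≉0 (trans (sym (trans (+-cong M₀≈0 (*-identityˡ _)) (+-identityˡ _))) M′₀≈0))
        (begin
          det M′                                        ≈⟨ ∧̂-linearˡ (M fz) (M (fs i)) 1# (wedge (λ k → M (fs k))) ⊤ᵛ ⟩
          det M + 1# * (M (fs i) ∧̂ wedge (λ k → M (fs k))) ⊤ᵛ ≈⟨ +-cong det≈0 (trans (*-identityˡ _) (∧̂-wedge (λ k → M (fs k)) i ⊤ᵛ)) ⟩
          0# + 0#                                       ≈⟨ +-identityˡ 0# ⟩
          0#                                            ∎)

  rightInverse : ∀ {n} (M : Mat F n) → Injective M →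
    Σ (Mat F n) λ N → ∀ k i → sumF F (λ j → M k j * N j i) ≈ δ k i
  rightInverse {n} M inj = (λ j i → cofactor M j i * det M ⁻¹) , λ k i → begin
    sumF F (λ j → M k j * (cofactor M j i * det M ⁻¹))   ≈⟨ sumF-cong (λ j → *-assoc (M k j) (cofactor M j i) (det M ⁻¹)) ⟨
    sumF F (λ j → M k j * cofactor M j i * det M ⁻¹)     ≈⟨ sumF-*ʳ (det M ⁻¹) (λ j → M k j * cofactor M j i) ⟨
    sumF F (λ j → M k j * cofactor M j i) * det M ⁻¹     ≈⟨ *-congʳ (cramer M k i) ⟩
    det M * δ k i * det M ⁻¹                             ≈⟨ *-congʳ (*-comm _ _) ⟩
    δ k i * det M * det M ⁻¹                             ≈⟨ *-assoc _ _ _ ⟩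
    δ k i * (det M * det M ⁻¹)                           ≈⟨ *-congˡ (⁻¹-inverse (det M) (det≉0 _ M inj)) ⟩
    δ k i * 1#                                           ≈⟨ *-identityʳ _ ⟩
    δ k i                                                ∎

-- The matrix ring, scalar matrices, and the action on vectors

module Matrices {c ℓ} (F : Field c ℓ) (n : ℕ) where
  open Field F
  open FiniteSums F
  open SetoidReasoning setoid

  private
    V = Vect F n
    M′ = Mat F n

  ·-assoc : ∀ (L M N : M′) i j → _·_ F (_·_ F L M) N i j ≈ _·_ F L (_·_ F M N) i j
  ·-assoc L M N i j = begin
    sumF F (λ k → sumF F (λ r → L i r * M r k) * N k j)        ≈⟨ sumF-cong (λ k → trans (sumF-*ʳ (N k j) (λ r → L i r * M r k)) (sumF-cong (λ r → *-assoc (L i r) (M r k) (N k j)))) ⟩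
    sumF F (λ k → sumF F (λ r → L i r * (M r k * N k j)))      ≈⟨ sumF-swap (λ k r → L i r * (M r k * N k j)) ⟩
    sumF F (λ r → sumF F (λ k → L i r * (M r k * N k j)))      ≈⟨ sumF-cong (λ r → sumF-*ˡ (L i r) (λ k → M r k * N k j)) ⟨
    sumF F (λ r → L i r * sumF F (λ k → M r k * N k j))        ∎

  matrixRing : Ring c ℓ
  matrixRing = record
    { Carrier = M′
    ; _≈_ = _≈m_ F
    ; _+_ = _⊕_ F
    ; _*_ = _·_ F
    ; -_  = λ M i j → - M i j
    ; 0#  = 0m F
    ; 1#  = Im F
    ; isRing = record
      { +-isAbelianGroup = record
        { isGroup = record
          { isMonoid = record
            { isSemigroup = record
              { isMagma = record
                { isEquivalence = record
                  { refl  = λ _ _ → refl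
                  ; sym   = λ p i j → sym (p i j)
                  ; trans = λ p q i j → trans (p i j) (q i j) }
                ; ∙-cong = λ p q i j → +-cong (p i j) (q i j) }
              ; assoc = λ L M N i j → +-assoc (L i j) (M i j) (N i j) }
            ; identity = (λ M i j → +-identityˡ (M i j)) , (λ M i j → +-identityʳ (M i j)) }
          ; inverse = (λ M i j → -‿inverseˡ (M i j)) , (λ M i j → -‿inverseʳ (M i j))
          ; ⁻¹-cong = λ p i j → -‿cong (p i j) }
        ; comm = λ M N i j → +-comm (M i j) (N i j) }
      ; *-cong = λ p q i j → sumF-cong (λ k → *-cong (p i k) (q k j))
      ; *-assoc = ·-assoc
      ; *-identity = (λ M i j → sumF-δˡ i (λ k → M k j)) , (λ M i j → sumF-δʳ j (M i))
      ; distrib = (λ L M N i j → trans (sumF-cong (λ k → distribˡ (L i k) (M k j) (N k j))) (sumF-+ (λ k → L i k * M k j) (λ k → L i k * N k j)))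
                , (λ L M N i j → trans (sumF-cong (λ k → distribʳ (L k j) (M i k) (N i k))) (sumF-+ (λ k → M i k * L k j) (λ k → N i k * L k j)))
      }
    }

  private module M = Ring matrixRing

  •-·ˡ : ∀ a M N → _•_ F a (_·_ F M N) M.≈ _·_ F (_•_ F a M) N
  •-·ˡ a M N i j = trans (sumF-*ˡ a (λ k → M i k * N k j)) (sumF-cong (λ k → sym (*-assoc a (M i k) (N k j))))

  •-·ʳ : ∀ a M N → _•_ F a (_·_ F M N) M.≈ _·_ F M (_•_ F a N)
  •-·ʳ a M N i j = trans (sumF-*ˡ a (λ k → M i k * N k j)) (sumF-cong (λ k →
    trans (sym (*-assoc a (M i k) (N k j))) (trans (*-congʳ (*-comm a (M i k))) (*-assoc (M i k) a (N k j)))))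

  scalar : Carrier → M′
  scalar a = _•_ F a (Im F)

  scalar-· : ∀ a M → _·_ F (scalar a) M M.≈ _•_ F a M
  scalar-· a M = M.trans (M.sym (•-·ˡ a (Im F) M)) (λ i j → *-congˡ (M.*-identityˡ M i j))

  scalar-central : ∀ a → NoncommutativeSolver.Central matrixRing (scalar a)
  scalar-central a M = M.trans (scalar-· a M) (M.trans (λ i j → *-congˡ (M.sym (M.*-identityʳ M) i j)) (•-·ʳ a M (Im F)))

  scalar-* : ∀ a a′ → scalar a M.* scalar a′ M.≈ scalar (a * a′)
  scalar-* a a′ = M.trans (scalar-· a (scalar a′)) (λ i j → sym (*-assoc a a′ (Im F i j)))

  scalar-+ : ∀ a a′ → scalar a M.+ scalar a′ M.≈ scalar (a + a′)
  scalar-+ a a′ i j = sym (distribʳ (Im F i j) a a′)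

  scalar-neg : ∀ a → M.- scalar a M.≈ scalar (- a)
  scalar-neg a i j = RingProperties.-‿distribˡ-* ring a (Im F i j)

  scalar-1 : scalar 1# M.≈ M.1#
  scalar-1 i j = *-identityˡ (Im F i j)

  scalar-cong : ∀ {a a′} → a ≈ a′ → scalar a M.≈ scalar a′
  scalar-cong p i j = *-congʳ p

  scalar-- : ∀ a a′ → scalar a M.- scalar a′ M.≈ scalar (a - a′)
  scalar-- a a′ = M.trans (M.+-congˡ (scalar-neg a′)) (scalar-+ a (- a′))

  scalar-cancel : ∀ {a N} → ¬ (a ≈ 0#) → scalar a M.* N M.≈ 0m F → N M.≈ 0m F
  scalar-cancel {a} {N} a≉0 p i j = begin
    N i j                       ≈⟨ *-identityˡ _ ⟨
    1# * N i j                  ≈⟨ *-congʳ (trans (*-comm _ _) (⁻¹-inverse a a≉0)) ⟨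
    a ⁻¹ * a * N i j            ≈⟨ *-assoc _ _ _ ⟩
    a ⁻¹ * (a * N i j)          ≈⟨ *-congˡ (trans (sym (scalar-· a N i j)) (p i j)) ⟩
    a ⁻¹ * 0#                   ≈⟨ zeroʳ _ ⟩
    0#                          ∎

  vectors : Setoid c ℓ
  vectors = record
    { Carrier = V
    ; _≈_ = _≈v_ F
    ; isEquivalence = record
      { refl = λ _ → refl ; sym = λ p i → sym (p i) ; trans = λ p q i → trans (p i) (q i) } }

  module ≈v = Setoid vectors

  app-cong : ∀ {M N : M′} {u v : V} → M M.≈ N → u ≈v.≈ v → app F M u ≈v.≈ app F N v
  app-cong p q i = sumF-cong (λ j → *-cong (p i j) (q j))

  app-congʳ : ∀ (M : M′) {u v : V} → u ≈v.≈ v → app F M u ≈v.≈ app F M v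
  app-congʳ M q = app-cong {M} M.refl q

  app-· : ∀ (M N : M′) v → app F (_·_ F M N) v ≈v.≈ app F M (app F N v)
  app-· M N v i = begin
    sumF F (λ k → sumF F (λ r → M i r * N r k) * v k)        ≈⟨ sumF-cong (λ k → trans (sumF-*ʳ (v k) (λ r → M i r * N r k)) (sumF-cong (λ r → *-assoc (M i r) (N r k) (v k)))) ⟩
    sumF F (λ k → sumF F (λ r → M i r * (N r k * v k)))      ≈⟨ sumF-swap (λ k r → M i r * (N r k * v k)) ⟩
    sumF F (λ r → sumF F (λ k → M i r * (N r k * v k)))      ≈⟨ sumF-cong (λ r → sumF-*ˡ (M i r) (λ k → N r k * v k)) ⟨
    sumF F (λ r → M i r * sumF F (λ k → N r k * v k))        ∎

  app-+ : ∀ (M : M′) u v → app F M (_+v_ F u v) ≈v.≈ _+v_ F (app F M u) (app F M v)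
  app-+ M u v i = trans (sumF-cong (λ j → distribˡ (M i j) (u j) (v j))) (sumF-+ (λ j → M i j * u j) (λ j → M i j * v j))

  app-• : ∀ (M : M′) a v → app F M (_•v_ F a v) ≈v.≈ _•v_ F a (app F M v)
  app-• M a v i = trans (sumF-cong (λ j → trans (sym (*-assoc (M i j) a (v j))) (trans (*-congʳ (*-comm (M i j) a)) (*-assoc a (M i j) (v j)))))
    (sym (sumF-*ˡ a (λ j → M i j * v j)))

  app-0v : ∀ (M : M′) {v} → v ≈v.≈ 0v F → app F M v ≈v.≈ 0v F
  app-0v M p i = sumF-0 (λ j → trans (*-congˡ (p j)) (zeroʳ (M i j)))

  app-⊕ : ∀ (M N : M′) v → app F (_⊕_ F M N) v ≈v.≈ _+v_ F (app F M v) (app F N v)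
  app-⊕ M N v i = trans (sumF-cong (λ j → distribʳ (v j) (M i j) (N i j))) (sumF-+ (λ j → M i j * v j) (λ j → N i j * v j))

  app-•m : ∀ a (M : M′) v → app F (_•_ F a M) v ≈v.≈ _•v_ F a (app F M v)
  app-•m a M v i = trans (sumF-cong (λ j → *-assoc a (M i j) (v j))) (sym (sumF-*ˡ a (λ j → M i j * v j)))

  app-⊖ : ∀ (M N : M′) v i → app F (_⊖_ F M N) v i ≈ app F M v i - app F N v i
  app-⊖ M N v i = begin
    sumF F (λ j → (M i j - N i j) * v j)                         ≈⟨ sumF-cong (λ j → trans (distribʳ (v j) (M i j) (- N i j)) (+-congˡ (expand (N i j) (v j)))) ⟩
    sumF F (λ j → M i j * v j + - 1# * (N i j * v j))            ≈⟨ sumF-+ (λ j → M i j * v j) (λ j → - 1# * (N i j * v j)) ⟩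
    app F M v i + sumF F (λ j → - 1# * (N i j * v j))            ≈⟨ +-congˡ (trans (sym (sumF-*ˡ (- 1#) (λ j → N i j * v j))) (-1*x≈-x _)) ⟩
    app F M v i - app F N v i                                    ∎
    where
    open RingProperties ring using (-1*x≈-x; -‿distribˡ-*)
    expand : ∀ x y → - x * y ≈ - 1# * (x * y)
    expand x y = trans (sym (-‿distribˡ-* x y)) (sym (-1*x≈-x (x * y)))

  app-0m : ∀ {M : M′} → M M.≈ 0m F → ∀ v → app F M v ≈v.≈ 0v F
  app-0m p v i = sumF-0 (λ j → trans (*-congʳ (p i j)) (zeroˡ (v j)))

  app-Im : ∀ v → app F (Im F) v ≈v.≈ v
  app-Im v i = sumF-δˡ i v

  app-column : ∀ (M : M′) k → app F M (λ j → δ j k) ≈v.≈ (λ i → M i k)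
  app-column M k i = sumF-δʳ k (M i)

  sumVF-cong : ∀ {m} {f f′ : Fin m → V} → (∀ j → f j ≈v.≈ f′ j) → sumVF F f ≈v.≈ sumVF F f′
  sumVF-cong {zero}  p i = refl
  sumVF-cong {suc m} p i = +-cong (p fz i) (sumVF-cong (λ j → p (fs j)) i)

  sumVF-0 : ∀ {m} {f : Fin m → V} → (∀ j → f j ≈v.≈ 0v F) → sumVF F f ≈v.≈ 0v F
  sumVF-0 {zero}  p i = refl
  sumVF-0 {suc m} p i = trans (+-cong (p fz i) (sumVF-0 (λ j → p (fs j)) i)) (+-identityˡ 0#)

  sumVF-pointwise : ∀ {m} (f : Fin m → V) i → sumVF F f i ≡ sumF F (λ j → f j i)
  sumVF-pointwise {zero}  f i = ≡-refl
  sumVF-pointwise {suc m} f i = ≡-cong (f fz i +_) (sumVF-pointwise (λ j → f (fs j)) i)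

  sumVF-single : ∀ {m} k (f : Fin m → V) → (∀ j → k ≢ j → f j ≈v.≈ 0v F) → sumVF F f ≈v.≈ f k
  sumVF-single k f p i = trans (reflexive (sumVF-pointwise f i)) (sumF-single k (λ j k≢j → p j k≢j i))

  app-sumVF : ∀ {m} (M : M′) (f : Fin m → V) → app F M (sumVF F f) ≈v.≈ sumVF F (λ j → app F M (f j))
  app-sumVF {zero}  M f = app-0v M {0v F} (λ _ → refl)
  app-sumVF {suc m} M f = ≈v.trans (app-+ M (f fz) (sumVF F (λ j → f (fs j)))) (λ i → +-congˡ (app-sumVF M (λ j → f (fs j)) i))

  app-sumMF : ∀ {m} (f : Fin m → M′) v → app F (sumMF F f) v ≈v.≈ sumVF F (λ j → app F (f j) v)
  app-sumMF {zero}  f v = app-0m {0m F} (λ _ _ → refl) v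
  app-sumMF {suc m} f v = ≈v.trans (app-⊕ (f fz) (sumMF F (λ j → f (fs j))) v) (λ i → +-congˡ (app-sumMF (λ j → f (fs j)) v i))

  app-injective : ∀ {M N : M′} → (∀ v → app F M v ≈v.≈ app F N v) → M M.≈ N
  app-injective {M} {N} p i k = trans (sym (app-column M k i)) (trans (p (λ j → δ j k) i) (app-column N k i))

-- Flags of eigenspaces: transversality, reversal, splitting

module TridiagonalSystems {c ℓ} (F : Field c ℓ) (n d : ℕ) where
  open Field F
  open FiniteSums F
  open Matrices F n
  private module Sum = CommutativeMonoidSum +-commutativeMonoid

  private
    V = Vect F n
    Family = Fin (suc d) → Mat F n
    _≈ᵛ_ = _≈v_ F {n}
    0ᵛ = 0v F {n}
    infix 4 _≈ᵛ_


  record Resolution (E : Family) : Set (c ⊔ ℓ) where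
    field
      orthogonal : ∀ i j → i ≢ j → ∀ v → app F (E i) (app F (E j) v) ≈ᵛ 0ᵛ
      idempotent : ∀ i v → app F (E i) (app F (E i) v) ≈ᵛ app F (E i) v
      complete   : ∀ v → sumVF F (λ j → app F (E j) v) ≈ᵛ v

    vanishes : ∀ {v} → (∀ j → app F (E j) v ≈ᵛ 0ᵛ) → v ≈ᵛ 0ᵛ
    vanishes {v} p = ≈v.trans (≈v.sym (complete v)) (sumVF-0 p)

  ZeroBlock : Family → Mat F n → Fin (suc d) → Fin (suc d) → Set (c ⊔ ℓ)
  ZeroBlock E M i j = ∀ v → app F (E i) (app F M (app F (E j) v)) ≈ᵛ 0ᵛ

  -- The blocks E_i M E_j vanish unless i ≤ j + r, respectively j ≤ i + r. Tridiagonality is both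
  -- with r = 1. The two bounds are kept apart because reversing the order of the eigenspaces
  -- exchanges them.
  RaisesBy LowersBy : ℕ → Family → Mat F n → Set (c ⊔ ℓ)
  RaisesBy r E M = ∀ i j → r +ℕ toℕ j < toℕ i → ZeroBlock E M i j
  LowersBy r E M = ∀ i j → r +ℕ toℕ i < toℕ j → ZeroBlock E M i j

  -- Membership in E₀V + ⋯ + EₖV and in EₖV + ⋯ + E_dV.
  UpTo From : ℕ → Family → V → Set ℓ
  UpTo k E v = ∀ l → k < toℕ l → app F (E l) v ≈ᵛ 0ᵛ
  From k E v = ∀ l → toℕ l < k → app F (E l) v ≈ᵛ 0ᵛ

  module _ {E : Family} (resolution : Resolution E) where
    open Resolution resolution

    block-expansion : ∀ M i v → app F (E i) (app F M v) ≈ᵛ sumVF F (λ j → app F (E i) (app F M (app F (E j) v)))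
    block-expansion M i v = begin
      app F (E i) (app F M v)                                       ≈⟨ app-congʳ (E i) (app-congʳ M (complete v)) ⟨
      app F (E i) (app F M (sumVF F (λ j → app F (E j) v)))         ≈⟨ app-congʳ (E i) (app-sumVF M (λ j → app F (E j) v)) ⟩
      app F (E i) (sumVF F (λ j → app F M (app F (E j) v)))         ≈⟨ app-sumVF (E i) (λ j → app F M (app F (E j) v)) ⟩
      sumVF F (λ j → app F (E i) (app F M (app F (E j) v)))         ∎
      where open SetoidReasoning vectors

    RaisesBy-UpTo : ∀ {r M} → RaisesBy r E M → ∀ k {v} → UpTo k E v → UpTo (r +ℕ k) E (app F M v)
    RaisesBy-UpTo {r} {M} raises k {v} v∈ l r+k<l = ≈v.trans (block-expansion M l v) (sumVF-0 term)
      where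
      term : ∀ j → app F (E l) (app F M (app F (E j) v)) ≈ᵛ 0ᵛ
      term j with k <? toℕ j
      ... | yes k<j = app-0v (E l) (app-0v M (v∈ j k<j))
      ... | no  k≮j = raises l j (ℕ.≤-<-trans (ℕ.+-monoʳ-≤ r (ℕ.≮⇒≥ k≮j)) r+k<l) v

    LowersBy-From : ∀ {r M} → LowersBy r E M → ∀ k {v} → From (r +ℕ k) E v → From k E (app F M v)
    LowersBy-From {r} {M} lowers k {v} v∈ l l<k = ≈v.trans (block-expansion M l v) (sumVF-0 term)
      where
      term : ∀ j → app F (E l) (app F M (app F (E j) v)) ≈ᵛ 0ᵛ
      term j with toℕ j <? r +ℕ k
      ... | yes j<r+k = app-0v (E l) (app-0v M (v∈ j j<r+k))
      ... | no  j≮r+k = lowers l j (ℕ.<-≤-trans (ℕ.+-monoʳ-< r l<k) (ℕ.≮⇒≥ j≮r+k)) v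

  linear-combination-0 : ∀ (M : Mat F n) {u v} a → app F M u ≈ᵛ 0ᵛ → app F M v ≈ᵛ 0ᵛ → app F M (_+v_ F u (_•v_ F a v)) ≈ᵛ 0ᵛ
  linear-combination-0 M {u} {v} a p q i = trans (app-+ M u (_•v_ F a v) i)
    (trans (+-cong (p i) (trans (app-• M a v i) (trans (*-congˡ (q i)) (zeroʳ a)))) (+-identityˡ 0#))

  UpTo-combination : ∀ {k E u v} a → UpTo k E u → UpTo k E v → UpTo k E (_+v_ F u (_•v_ F a v))
  UpTo-combination {E = E} a u∈ v∈ l p = linear-combination-0 (E l) a (u∈ l p) (v∈ l p)

  From-combination : ∀ {k E u v} a → From k E u → From k E v → From k E (_+v_ F u (_•v_ F a v))
  From-combination {E = E} a u∈ v∈ l p = linear-combination-0 (E l) a (u∈ l p) (v∈ l p)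

  UpTo-resp : ∀ {k} {E : Family} {u v} → u ≈ᵛ v → UpTo k E u → UpTo k E v
  UpTo-resp {E = E} u≈v u∈ l p = ≈v.trans (app-congʳ (E l) (≈v.sym u≈v)) (u∈ l p)

  From-resp : ∀ {k} {E : Family} {u v} → u ≈ᵛ v → From k E u → From k E v
  From-resp {E = E} u≈v u∈ l p = ≈v.trans (app-congʳ (E l) (≈v.sym u≈v)) (u∈ l p)

  UpTo-mono : ∀ {k k′} {E : Family} {v} → k ≤ k′ → UpTo k E v → UpTo k′ E v
  UpTo-mono k≤k′ v∈ l p = v∈ l (ℕ.≤-<-trans k≤k′ p)

  From-mono : ∀ {k k′} {E : Family} {v} → k ≤ k′ → From k′ E v → From k E v
  From-mono k≤k′ v∈ l p = v∈ l (ℕ.<-≤-trans p k≤k′)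

  record Eigenspaces (M : Mat F n) (E : Family) : Set (c ⊔ ℓ) where
    field
      resolution : Resolution E
      θ          : Fin (suc d) → Carrier
      eigen      : ∀ i v → app F (E i) (app F M v) ≈ᵛ _•v_ F (θ i) (app F (E i) v)
      nonzero    : ∀ i → ¬ (_≈m_ F (E i) (0m F))
    open Resolution resolution public

    shifted : Fin (suc d) → V → V
    shifted j v = _+v_ F (app F M v) (_•v_ F (- θ j) v)

    shifted-vanishes : ∀ l j {v} → app F (E l) v ≈ᵛ 0ᵛ → app F (E l) (shifted j v) ≈ᵛ 0ᵛ
    shifted-vanishes l j {v} p = linear-combination-0 (E l) (- θ j)
      (≈v.trans (eigen l v) (λ i → trans (*-congˡ (p i)) (zeroʳ (θ l)))) p

    shifted-eigen : ∀ j v → app F (E j) (shifted j v) ≈ᵛ 0ᵛ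
    shifted-eigen j v i = begin
      app F (E j) (shifted j v) i                              ≈⟨ app-+ (E j) (app F M v) (_•v_ F (- θ j) v) i ⟩
      app F (E j) (app F M v) i + app F (E j) (_•v_ F (- θ j) v) i ≈⟨ +-cong (eigen j v i) (app-• (E j) (- θ j) v i) ⟩
      θ j * e + - θ j * e                                      ≈⟨ +-congˡ (RingProperties.-‿distribˡ-* ring (θ j) e) ⟨
      θ j * e - θ j * e                                        ≈⟨ -‿inverseʳ _ ⟩
      0#                                                       ∎
      where
      open SetoidReasoning setoid
      e = app F (E j) v i

    unshift : ∀ j v → _+v_ F (shifted j v) (_•v_ F (θ j) v) ≈ᵛ app F M v
    unshift j v i = trans (+-assoc _ _ _) (trans (+-congˡ (trans (sym (distribʳ (v i) (- θ j) (θ j)))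
      (trans (*-congʳ (-‿inverseˡ (θ j))) (zeroˡ (v i))))) (+-identityʳ _))

  Irreducible : Mat F n → Mat F n → Set (lsuc (c ⊔ ℓ))
  Irreducible A A* = ¬ (Σ (Sub F {n}) λ W → IsSubspace F W
    × (∀ v → W v → W (app F A v)) × (∀ v → W v → W (app F A* v))
    × (Σ V λ v → W v × ¬ v ≈ᵛ 0ᵛ) × (Σ V λ v → ¬ W v))

  -- Either ordering can be reversed without leaving this record, so one argument serves all four
  -- pairs of flags.
  record System : Set (lsuc (c ⊔ ℓ)) where
    field
      A A*      : Mat F n
      E E*      : Family
      spaces    : Eigenspaces A E
      spaces*   : Eigenspaces A* E*
      A*-raises : RaisesBy 1 E A*
      A*-lowers : LowersBy 1 E A*
      A-raises  : RaisesBy 1 E* A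
      A-lowers  : LowersBy 1 E* A
      irreducible : Irreducible A A*

  module Transversality (S : System) where
    open System S
    private
      module X = Eigenspaces spaces*
      module Y = Eigenspaces spaces

    -- The sum of the subspaces (E*₀V + ⋯ + E*ᵢV) ∩ (E_{i+k}V + ⋯ + E_dV).
    data Diagonal (k : ℕ) : V → Set (c ⊔ ℓ) where
      member : ∀ i {v} → UpTo i E* v → From (i +ℕ k) E v → Diagonal k v
      null   : ∀ {v} → v ≈ᵛ 0ᵛ → Diagonal k v
      plus   : ∀ {u v w} → Diagonal k u → Diagonal k v → w ≈ᵛ _+v_ F u v → Diagonal k w

    Diagonal-resp : ∀ {k u v} → u ≈ᵛ v → Diagonal k u → Diagonal k v
    Diagonal-resp u≈v (member i p q) = member i (UpTo-resp u≈v p) (From-resp u≈v q)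
    Diagonal-resp u≈v (null p)       = null (≈v.trans (≈v.sym u≈v) p)
    Diagonal-resp u≈v (plus p q r)   = plus p q (≈v.trans (≈v.sym u≈v) r)

    0-vanishes : ∀ (M : Mat F n) → app F M 0ᵛ ≈ᵛ 0ᵛ
    0-vanishes M = app-0v M {0ᵛ} (λ _ → refl)

    scaling : ∀ a v → _+v_ F 0ᵛ (_•v_ F a v) ≈ᵛ _•v_ F a v
    scaling a v i = +-identityˡ (a * v i)

    Diagonal-• : ∀ {k} a {v} → Diagonal k v → Diagonal k (_•v_ F a v)
    Diagonal-• a {v} (member i p q) = member i
      (UpTo-resp (scaling a v) (UpTo-combination a (λ l _ → 0-vanishes (E* l)) p))
      (From-resp (scaling a v) (From-combination a (λ l _ → 0-vanishes (E l)) q))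
    Diagonal-• a (null p)       = null (λ i → trans (*-congˡ (p i)) (zeroʳ a))
    Diagonal-• a (plus {u} {v} p q r) = plus (Diagonal-• a p) (Diagonal-• a q)
      (λ i → trans (*-congˡ (r i)) (distribˡ a (u i) (v i)))

    private
      top : ∀ {k} → k ≤ d → Σ (Fin (suc d)) λ j → toℕ j ≡ k
      top k≤d = fromℕ< (s≤s k≤d) , toℕ-fromℕ< (s≤s k≤d)

      beyond : ∀ {k v} → ¬ (k ≤ d) → From k E v → v ≈ᵛ 0ᵛ
      beyond k≰d p = Y.vanishes (λ j → p j (ℕ.<-≤-trans (toℕ<n j) (ℕ.≰⇒> k≰d)))

    -- A - θ_{i+k} kills the component in E_{i+k}V, so the lower bound for E rises by one, while the
    -- upper bound for E* rises by at most one. Thus summand i is sent to summand i + 1.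
    Diagonal-A : ∀ {k v} → Diagonal k v → Diagonal k (app F A v)
    Diagonal-A {k} {v} (member i p q) with i +ℕ k ≤? d
    ... | no  i+k≰d = null (app-0v A (beyond i+k≰d q))
    ... | yes i+k≤d with j , j≡i+k ← top i+k≤d = plus
      (member (suc i)
        (UpTo-combination (- Y.θ j) (RaisesBy-UpTo X.resolution A-raises i p) (UpTo-mono (ℕ.n≤1+n i) p))
        (λ l l≤i+k → raised l j j≡i+k l≤i+k))
      (Diagonal-• (Y.θ j) (member i p q)) (≈v.sym (Y.unshift j v))
      where
      raised : ∀ l j → toℕ j ≡ i +ℕ k → toℕ l < suc (i +ℕ k) → app F (E l) (Y.shifted j v) ≈ᵛ 0ᵛ
      raised l j eq (s≤s l≤i+k) with ℕ.m≤n⇒m<n∨m≡n l≤i+k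
      ... | inj₁ l<i+k = Y.shifted-vanishes l j (q l l<i+k)
      ... | inj₂ l≡i+k with ≡-refl ← toℕ-injective (≡-trans l≡i+k (≡-sym eq)) = Y.shifted-eigen l v
    Diagonal-A (null p)     = null (app-0v A p)
    Diagonal-A (plus {u} {v} p q r) = plus (Diagonal-A p) (Diagonal-A q) (≈v.trans (app-congʳ A r) (app-+ A u v))

    -- A* - θ*_i kills the component in E*_iV and lowers the bound for E by at most one. Thus
    -- summand i is sent to summand i - 1, and summand 0 to zero.
    Diagonal-A* : ∀ {k v} → Diagonal k v → Diagonal k (app F A* v)
    Diagonal-A* {k} {v} (member i p q) with i +ℕ k ≤? d
    ... | no  i+k≰d = null (app-0v A* (beyond i+k≰d q))
    ... | yes i+k≤d with j , j≡i ← top (ℕ.≤-trans (ℕ.m≤m+n i k) i+k≤d) = plus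
      (lowered i p q j≡i) (Diagonal-• (X.θ j) (member i p q)) (≈v.sym (X.unshift j v))
      where
      killed : ∀ {i j} → UpTo i E* v → toℕ j ≡ i → ∀ l → i ≤ toℕ l → app F (E* l) (X.shifted j v) ≈ᵛ 0ᵛ
      killed {j = j} p ≡-refl l i≤l with ℕ.m≤n⇒m<n∨m≡n i≤l
      ... | inj₁ i<l = X.shifted-vanishes l j (p l i<l)
      ... | inj₂ i≡l with ≡-refl ← toℕ-injective i≡l = X.shifted-eigen l v
      lowered : ∀ i {j} → UpTo i E* v → From (i +ℕ k) E v → toℕ j ≡ i → Diagonal k (X.shifted j v)
      lowered zero    {j} p q eq = null (X.vanishes (λ l → killed {j = j} p eq l z≤n))
      lowered (suc i) {j} p q eq = member i (killed {j = j} p eq)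
        (From-combination (- X.θ j) (LowersBy-From Y.resolution A*-lowers (i +ℕ k) q) (From-mono (ℕ.n≤1+n (i +ℕ k)) q))
    Diagonal-A* (null p)     = null (app-0v A* p)
    Diagonal-A* (plus {u} {v} p q r) = plus (Diagonal-A* p) (Diagonal-A* q) (≈v.trans (app-congʳ A* r) (app-+ A* u v))

    -- A positive offset puts every summand inside E_1V + ⋯ + E_dV, so the invariant subspace cannot
    -- be all of V.
    Diagonal-proper : ∀ {k v} → Diagonal (suc k) v → app F (E fz) v ≈ᵛ 0ᵛ
    Diagonal-proper {k} (member i p q) = q fz (ℕ.≤-trans (s≤s z≤n) (ℕ.m≤n+m (suc k) i))
    Diagonal-proper (null p)       = app-0v (E fz) p
    Diagonal-proper (plus {u} {v} p q r) i = trans (app-congʳ (E fz) r i) (trans (app-+ (E fz) u v i)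
      (trans (+-cong (Diagonal-proper p i) (Diagonal-proper q i)) (+-identityˡ 0#)))

    -- The intersection is a summand of the invariant subspace `Diagonal 1`. A nonzero column of E_0
    -- is a vector outside it; such a column is found only up to double negation, and irreducibility
    -- itself is a negation.
    meet-trivial : ∀ i {v} → UpTo i E* v → From (suc i) E v → ¬ ¬ v ≈ᵛ 0ᵛ
    meet-trivial i {v} p q v≉0 = ¬¬-find (λ E₀≈0 → Y.nonzero fz (λ r k → E₀≈0 k r)) λ (k , column≉0) →
      irreducible (Diagonal 1
        , ((λ _ _ → Diagonal-resp) , null ≈v.refl , (λ _ _ p q → plus p q ≈v.refl) , (λ a _ → Diagonal-• a))
        , (λ _ → Diagonal-A) , (λ _ → Diagonal-A*)
        , (v , member i p (≡-subst (λ m → From m E v) (ℕ.+-comm 1 i) q) , v≉0)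
        , (app F (E fz) (λ j → δ j k)
          , λ W → column≉0 λ r → trans (sym (trans (Y.idempotent fz (λ j → δ j k) r) (app-column (E fz) k r))) (Diagonal-proper W r)))

  toℕ-opposite : ∀ (j : Fin (suc d)) → toℕ (opposite j) +ℕ toℕ j ≡ d
  toℕ-opposite j = ≡-trans (≡-cong (_+ℕ toℕ j) (opposite-prop j)) (ℕ.m∸n+n≡m (ℕ.≤-pred (toℕ<n j)))

  opposite-reflects : ∀ r (i j : Fin (suc d)) → r +ℕ toℕ j < toℕ i → r +ℕ toℕ (opposite i) < toℕ (opposite j)
  opposite-reflects r i j p = ℕ.+-cancelʳ-< (toℕ j) _ _ (begin-strict
    r +ℕ toℕ (opposite i) +ℕ toℕ j   ≡⟨ ℕ.+-assoc r _ _ ⟩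
    r +ℕ (toℕ (opposite i) +ℕ toℕ j) ≡⟨ ≡-cong (r +ℕ_) (ℕ.+-comm (toℕ (opposite i)) (toℕ j)) ⟩
    r +ℕ (toℕ j +ℕ toℕ (opposite i)) ≡⟨ ℕ.+-assoc r _ _ ⟨
    r +ℕ toℕ j +ℕ toℕ (opposite i)   <⟨ ℕ.+-monoˡ-< (toℕ (opposite i)) p ⟩
    toℕ i +ℕ toℕ (opposite i)        ≡⟨ ℕ.+-comm (toℕ i) _ ⟩
    toℕ (opposite i) +ℕ toℕ i        ≡⟨ toℕ-opposite i ⟩
    d                                ≡⟨ toℕ-opposite j ⟨
    toℕ (opposite j) +ℕ toℕ j        ∎)
    where open ℕ.≤-Reasoning

  reversed : Family → Family
  reversed E j = E (opposite j)

  reversed-raises : ∀ {r E M} → LowersBy r E M → RaisesBy r (reversed E) M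
  reversed-raises {r} lowers i j p = lowers (opposite i) (opposite j) (opposite-reflects r i j p)

  reversed-lowers : ∀ {r E M} → RaisesBy r E M → LowersBy r (reversed E) M
  reversed-lowers {r} raises i j p = raises (opposite i) (opposite j) (opposite-reflects r j i p)

  reversed-resolution : ∀ {E} → Resolution E → Resolution (reversed E)
  reversed-resolution {E} res = record
    { orthogonal = λ i j i≢j → orthogonal (opposite i) (opposite j) (λ eq → i≢j
        (≡-trans (≡-sym (opposite-involutive i)) (≡-trans (≡-cong opposite eq) (opposite-involutive j))))
    ; idempotent = λ i → idempotent (opposite i)
    ; complete   = λ v i → trans (permuted v i) (complete v i)
    }
    where
    open Resolution res
    permuted : ∀ v i → sumVF F (λ j → app F (E (opposite j)) v) i ≈ sumVF F (λ j → app F (E j) v) i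
    permuted v i = begin
      sumVF F (λ j → app F (E (opposite j)) v) i     ≡⟨ sumVF-pointwise (λ j → app F (E (opposite j)) v) i ⟩
      sumF F (λ j → app F (E (opposite j)) v i)      ≡⟨ sumF≡sum (λ j → app F (E (opposite j)) v i) ⟩
      Sum.sum (λ j → app F (E (opposite j)) v i)     ≈⟨ Sum.sum-permute (λ j → app F (E j) v i) reverse ⟨
      Sum.sum (λ j → app F (E j) v i)                ≡⟨ sumF≡sum (λ j → app F (E j) v i) ⟨
      sumF F (λ j → app F (E j) v i)                 ≡⟨ sumVF-pointwise (λ j → app F (E j) v) i ⟨
      sumVF F (λ j → app F (E j) v) i                ∎
      where open SetoidReasoning setoid

  reversed-spaces : ∀ {M E} → Eigenspaces M E → Eigenspaces M (reversed E)
  reversed-spaces spaces = record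
    { resolution = reversed-resolution resolution
    ; θ          = λ i → θ (opposite i)
    ; eigen      = λ i → eigen (opposite i)
    ; nonzero    = λ i → nonzero (opposite i) }
    where open Eigenspaces spaces

  reverse-E : System → System
  reverse-E S = record
    { A = A ; A* = A* ; E = reversed E ; E* = E* ; spaces = reversed-spaces spaces ; spaces* = spaces*
    ; A*-raises = reversed-raises {E = E} A*-lowers ; A*-lowers = reversed-lowers {E = E} A*-raises
    ; A-raises = A-raises ; A-lowers = A-lowers ; irreducible = irreducible }
    where open System S

  reverse-E* : System → System
  reverse-E* S = record
    { A = A ; A* = A* ; E = E ; E* = reversed E* ; spaces = spaces ; spaces* = reversed-spaces spaces*
    ; A*-raises = A*-raises ; A*-lowers = A*-lowers
    ; A-raises = reversed-raises {E = E*} A-lowers ; A-lowers = reversed-lowers {E = E*} A-raises ; irreducible = irreducible }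
    where open System S

  module _ {E : Family} (resolution : Resolution E) where
    open Resolution resolution

    projection : (Fin (suc d) → Bool) → Mat F n
    projection p = sumMF F (λ j → if p j then E j else 0m F)

    projection-block : ∀ p l v → app F (E l) (app F (projection p) v) ≈ᵛ (if p l then app F (E l) v else 0ᵛ)
    projection-block p l v = begin
      app F (E l) (app F (projection p) v)                                    ≈⟨ app-congʳ (E l) (app-sumMF (λ j → if p j then E j else 0m F) v) ⟩
      app F (E l) (sumVF F (λ j → app F (if p j then E j else 0m F) v))       ≈⟨ app-sumVF (E l) (λ j → app F (if p j then E j else 0m F) v) ⟩
      sumVF F (λ j → app F (E l) (app F (if p j then E j else 0m F) v))       ≈⟨ sumVF-single l _ (λ j l≢j → off j l≢j (p j)) ⟩
      app F (E l) (app F (if p l then E l else 0m F) v)                       ≈⟨ diagonal (p l) ⟩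
      (if p l then app F (E l) v else 0ᵛ)                                     ∎
      where
      open SetoidReasoning vectors
      off : ∀ j → l ≢ j → ∀ q → app F (E l) (app F (if q then E j else 0m F) v) ≈ᵛ 0ᵛ
      off j l≢j true  = orthogonal l j l≢j v
      off j l≢j false = app-0v (E l) (app-0m {0m F} (λ _ _ → refl) v)
      diagonal : ∀ q → app F (E l) (app F (if q then E l else 0m F) v) ≈ᵛ (if q then app F (E l) v else 0ᵛ)
      diagonal true  = idempotent l v
      diagonal false = app-0v (E l) (app-0m {0m F} (λ _ _ → refl) v)

  module Decomposition (S : System) where
    open System S
    private
      module X = Eigenspaces spaces*
      module Y = Eigenspaces spaces

    module _ (i : ℕ) (i<d : i < d) where
      private
        below : Fin (suc d) → Bool
        below j = does (toℕ j ≤? i)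
        above : Fin (suc d) → Bool
        above j = does (i <? toℕ j)
        P Q : Mat F n
        P = projection X.resolution below
        Q = projection Y.resolution above

      P-UpTo : ∀ v → UpTo i E* (app F P v)
      P-UpTo v l i<l = ≈v.trans (projection-block X.resolution below l v) (case (toℕ l ≤? i))
        where
        case : (q : Dec (toℕ l ≤ i)) → (if does q then app F (E* l) v else 0ᵛ) ≈ᵛ 0ᵛ
        case (yes l≤i) = ⊥-elim (ℕ.<⇒≱ i<l l≤i)
        case (no  _)   = ≈v.refl

      Q-From : ∀ v → From (suc i) E (app F Q v)
      Q-From v l l<1+i = ≈v.trans (projection-block Y.resolution above l v) (case (i <? toℕ l))
        where
        case : (q : Dec (i < toℕ l)) → (if does q then app F (E l) v else 0ᵛ) ≈ᵛ 0ᵛ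
        case (yes i<l) = ⊥-elim (ℕ.<⇒≱ i<l (ℕ.≤-pred l<1+i))
        case (no  _)   = ≈v.refl

      P-kernel : ∀ {v} → app F P v ≈ᵛ 0ᵛ → ∀ l → toℕ l ≤ i → app F (E* l) v ≈ᵛ 0ᵛ
      P-kernel {v} Pv≈0 l l≤i = ≈v.trans (case (toℕ l ≤? i))
        (≈v.trans (≈v.sym (projection-block X.resolution below l v)) (app-0v (E* l) Pv≈0))
        where
        case : (q : Dec (toℕ l ≤ i)) → app F (E* l) v ≈ᵛ (if does q then app F (E* l) v else 0ᵛ)
        case (yes _)   = ≈v.refl
        case (no  l≰i) = ⊥-elim (l≰i l≤i)

      Q-kernel : ∀ {v} → app F Q v ≈ᵛ 0ᵛ → ∀ l → i < toℕ l → app F (E l) v ≈ᵛ 0ᵛ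
      Q-kernel {v} Qv≈0 l i<l = ≈v.trans (case (i <? toℕ l))
        (≈v.trans (≈v.sym (projection-block Y.resolution above l v)) (app-0v (E l) Qv≈0))
        where
        case : (q : Dec (i < toℕ l)) → app F (E l) v ≈ᵛ (if does q then app F (E l) v else 0ᵛ)
        case (yes _)   = ≈v.refl
        case (no  i≮l) = ⊥-elim (i≮l i<l)

      -- The kernel of P - Q meets both im P ∩ im Q and ker P ∩ ker Q, which
      -- are trivial by transversality of the flags and of the reversed flags.
      P-Q-injective : Determinants.Injective F (_⊖_ F P Q)
      P-Q-injective v p k = Transversality.meet-trivial S i (P-UpTo v) (From-resp (≈v.sym Pv≈Qv) (Q-From v)) λ Pv≈0 →
        -- Now P v = Q v = 0, so v lies in E*_{i+1}V + ⋯ + E*_dV and in E_0V + ⋯ + E_iV. In the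
        -- reversed orders these are again an initial and a final segment, with cut at d - (i+1).
        Transversality.meet-trivial (reverse-E (reverse-E* S)) (d ∸ suc i)
          (λ l d∸1+i<l → P-kernel Pv≈0 (opposite l) (flip-below l d∸1+i<l))
          (λ l l<1+ → Q-kernel (≈v.trans (≈v.sym Pv≈Qv) Pv≈0) (opposite l) (flip-above l l<1+))
          k
        where
        Pv≈Qv : app F P v ≈ᵛ app F Q v
        Pv≈Qv r = x∙y⁻¹≈ε⇒x≈y _ _ (trans (sym (app-⊖ P Q v r)) (p r))
          where open RingProperties ring using (x∙y⁻¹≈ε⇒x≈y)
        flip-below : ∀ l → d ∸ suc i < toℕ l → toℕ (opposite l) ≤ i
        flip-below l p = ℕ.≤-pred (ℕ.+-cancelʳ-< (toℕ l) _ _ (begin-strict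
          toℕ (opposite l) +ℕ toℕ l ≡⟨ toℕ-opposite l ⟩
          d                         ≡⟨ ℕ.m+[n∸m]≡n i<d ⟨
          suc i +ℕ (d ∸ suc i)      <⟨ ℕ.+-monoʳ-< (suc i) p ⟩
          suc i +ℕ toℕ l            ∎))
          where open ℕ.≤-Reasoning
        flip-above : ∀ l → toℕ l < suc (d ∸ suc i) → i < toℕ (opposite l)
        flip-above l p = ℕ.+-cancelʳ-≤ (toℕ l) _ _ (begin
          suc i +ℕ toℕ l            ≤⟨ ℕ.+-monoʳ-≤ (suc i) (ℕ.≤-pred p) ⟩
          suc i +ℕ (d ∸ suc i)      ≡⟨ ℕ.m+[n∸m]≡n i<d ⟩
          d                         ≡⟨ toℕ-opposite l ⟨
          toℕ (opposite l) +ℕ toℕ l ∎)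
          where open ℕ.≤-Reasoning

      -- With N a right inverse of P - Q and u = N v, one has v = P u - Q u.
      split : ∀ v → Σ V λ u → Σ V λ w → UpTo i E* u × From (suc i) E w × v ≈ᵛ _+v_ F u w
      split v with N , PQN≈1 ← Determinants.rightInverse F (_⊖_ F P Q) P-Q-injective =
        app F P u , _•v_ F (- 1#) (app F Q u) , P-UpTo u ,
        (λ l p → ≈v.trans (app-• (E l) (- 1#) (app F Q u)) (λ r → trans (*-congˡ (Q-From u l p r)) (zeroʳ _))) ,
        λ r → begin
          v r                                   ≈⟨ app-Im v r ⟨
          app F (Im F) v r                      ≈⟨ app-cong {_·_ F (_⊖_ F P Q) N} {Im F} PQN≈1 (≈v.refl {v}) r ⟨
          app F (_·_ F (_⊖_ F P Q) N) v r       ≈⟨ app-· (_⊖_ F P Q) N v r ⟩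
          app F (_⊖_ F P Q) u r                 ≈⟨ app-⊖ P Q u r ⟩
          app F P u r - app F Q u r             ≈⟨ +-congˡ (-1*x≈-x _) ⟨
          app F P u r + - 1# * app F Q u r      ∎
        where
        open SetoidReasoning setoid
        open RingProperties ring using (-1*x≈-x)
        u : V
        u = app F N v

    -- The i-th component of the decomposition attached to the two flags.
    Component : ℕ → V → Set ℓ
    Component i v = UpTo i E* v × From i E v

    difference-UpTo : ∀ {k u v w} → v ≈ᵛ _+v_ F u w → UpTo k E* v → UpTo k E* u → UpTo k E* w
    difference-UpTo {v = v} {w} v≈u+w v∈ u∈ = UpTo-resp (λ r → difference v≈u+w r) (UpTo-combination (- 1#) v∈ u∈)
      where
      difference : ∀ {u v w} → v ≈ᵛ _+v_ F u w → _+v_ F v (_•v_ F (- 1#) u) ≈ᵛ w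
      difference {u} {v} {w} p r = begin
        v r + - 1# * u r       ≈⟨ +-cong (trans (p r) (+-comm (u r) (w r))) (RingProperties.-1*x≈-x ring (u r)) ⟩
        w r + u r - u r        ≈⟨ +-assoc _ _ _ ⟩
        w r + (u r - u r)      ≈⟨ +-congˡ (-‿inverseʳ (u r)) ⟩
        w r + 0#               ≈⟨ +-identityʳ (w r) ⟩
        w r                    ∎
        where open SetoidReasoning setoid

    difference-From : ∀ {k u v w} → v ≈ᵛ _+v_ F w u → From k E v → From k E u → From k E w
    difference-From {u = u} {v} {w} p v∈ u∈ = From-resp difference (From-combination (- 1#) v∈ u∈)
      where
      difference : _+v_ F v (_•v_ F (- 1#) u) ≈ᵛ w
      difference r = begin
        v r + - 1# * u r       ≈⟨ +-cong (p r) (RingProperties.-1*x≈-x ring (u r)) ⟩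
        w r + u r - u r        ≈⟨ +-assoc _ _ _ ⟩
        w r + (u r - u r)      ≈⟨ +-congˡ (-‿inverseʳ (u r)) ⟩
        w r + 0#               ≈⟨ +-identityʳ (w r) ⟩
        w r                    ∎
        where open SetoidReasoning setoid

    -- Split v = u + w at i. Then u = v - w inherits the lower bound i of v and w, and w = v - u the
    -- upper bound k of v and u.
    splitOff : ∀ i k → i < d → i < k → ∀ {v} → UpTo k E* v → From i E v →
      Σ V λ u → Σ V λ w → Component i u × (UpTo k E* w × From (suc i) E w) × v ≈ᵛ _+v_ F u w
    splitOff i k i<d i<k {v} v∈X v∈Y with u , w , u∈ , w∈ , v≈ ← split i i<d v =
      u , w
      , (u∈ , difference-From v≈ v∈Y (From-mono (ℕ.n≤1+n i) w∈))
      , (difference-UpTo v≈ v∈X (UpTo-mono (ℕ.<⇒≤ i<k) u∈) , w∈)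
      , v≈

-- Spans as vanishing conditions, and the passage from a TD system

module Spans {c ℓ} (F : Field c ℓ) (n d : ℕ) where
  open Field F
  open Matrices F n
  open TridiagonalSystems F n d

  module _ {E : Fin (suc d) → Mat F n} (resolution : Resolution E) where
    open Resolution resolution

    private
      term : ℕ → ℕ → (Fin (suc d) → Vect F n) → Fin (suc d) → Vect F n
      term a b w j = if (a ≤ᵇ toℕ j) ∧ (toℕ j ≤ᵇ b) then app F (E j) (w j) else 0v F

      inside : ∀ {a b k} → a ≤ k → k ≤ b → ((a ≤ᵇ k) ∧ (k ≤ᵇ b)) ≡ true
      inside {a} {b} {k} p q with a ≤ᵇ k in eq₁ | k ≤ᵇ b in eq₂
      ... | true  | true  = ≡-refl
      ... | false | _     = ⊥-elim (≡-subst IsTrue eq₁ (ℕ.≤⇒≤ᵇ p))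
      ... | true  | false = ⊥-elim (≡-subst IsTrue eq₂ (ℕ.≤⇒≤ᵇ q))

      outside : ∀ {a b k} → k < a ⊎ b < k → ((a ≤ᵇ k) ∧ (k ≤ᵇ b)) ≡ false
      outside {a} {b} {k} p with a ≤ᵇ k in eq₁ | k ≤ᵇ b in eq₂
      ... | false | _     = ≡-refl
      ... | true  | false = ≡-refl
      outside {a} {b} {k} (inj₁ k<a) | true | true = ⊥-elim (ℕ.<⇒≱ k<a (ℕ.≤ᵇ⇒≤ a k (≡-subst IsTrue (≡-sym eq₁) _)))
      outside {a} {b} {k} (inj₂ b<k) | true | true = ⊥-elim (ℕ.<⇒≱ b<k (ℕ.≤ᵇ⇒≤ k b (≡-subst IsTrue (≡-sym eq₂) _)))

      span-vanishes : ∀ a b {v} → span F E a b v → ∀ l → toℕ l < a ⊎ b < toℕ l → ≈v._≈_ (app F (E l) v) (0v F)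
      span-vanishes a b {v} (w , lift v≈) l out = begin
        app F (E l) v                                   ≈⟨ app-congʳ (E l) v≈ ⟩
        app F (E l) (sumVF F (term a b w))              ≈⟨ app-sumVF (E l) (term a b w) ⟩
        sumVF F (λ j → app F (E l) (term a b w j))      ≈⟨ sumVF-0 each ⟩
        0v F                                            ∎
        where
        open SetoidReasoning vectors
        each : ∀ j → ≈v._≈_ (app F (E l) (term a b w j)) (0v F)
        each j with l ≟F j
        ... | yes ≡-refl rewrite outside {a} {b} out = app-0v (E l) {0v F} (λ _ → refl)
        ... | no  l≢j with (a ≤ᵇ toℕ j) ∧ (toℕ j ≤ᵇ b)
        ...   | true  = orthogonal l j l≢j (w j)
        ...   | false = app-0v (E l) {0v F} (λ _ → refl)

    span⇒From : ∀ a b {v} → span F E a b v → From a E v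
    span⇒From a b s l l<a = span-vanishes a b s l (inj₁ l<a)

    span⇒UpTo : ∀ a b {v} → span F E a b v → UpTo b E v
    span⇒UpTo a b s l b<l = span-vanishes a b s l (inj₂ b<l)

    ⇒span : ∀ a b {v} → UpTo b E v → From a E v → span F E a b v
    -- The constant family v is a witness: its terms outside the range vanish, so by completeness
    -- the others sum to v.
    ⇒span a b {v} p q = (λ _ → v) , lift (≈v.trans (≈v.sym (complete v)) (sumVF-cong each))
      where
      each : ∀ j → ≈v._≈_ (app F (E j) v) (term a b (λ _ → v) j)
      each j with a ≤? toℕ j | toℕ j ≤? b
      ... | yes a≤j | yes j≤b rewrite inside a≤j j≤b = ≈v.refl
      ... | no  a≰j | _       rewrite outside {a} {b} (inj₁ (ℕ.≰⇒> a≰j)) = q j (ℕ.≰⇒> a≰j)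
      ... | yes _   | no  j≰b rewrite outside {a} {b} (inj₂ (ℕ.≰⇒> j≰b)) = p j (ℕ.≰⇒> j≰b)

    component-span : ∀ j v → span F E (toℕ j) (toℕ j) (app F (E j) v)
    component-span j v = ⇒span (toℕ j) (toℕ j)
      (λ l j<l → orthogonal l j (λ eq → ℕ.<-irrefl (≡-cong toℕ (≡-sym eq)) j<l) v)
      (λ l l<j → orthogonal l j (λ eq → ℕ.<-irrefl (≡-cong toℕ eq) l<j) v)

    Tridiagonal : Mat F n → Set (c ⊔ ℓ)
    Tridiagonal M = ∀ (i : Fin (suc d)) → MapsInto F M (span F E (toℕ i) (toℕ i)) (span F E (toℕ i ∸ 1) (toℕ i +ℕ 1))

    tridiagonal-raises : ∀ {M} → Tridiagonal M → RaisesBy 1 E M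
    tridiagonal-raises tridiagonal i j 1+j<i v = span⇒UpTo (toℕ j ∸ 1) (toℕ j +ℕ 1) (tridiagonal j _ (component-span j v)) i
      (≡-subst (_< toℕ i) (ℕ.+-comm 1 (toℕ j)) 1+j<i)

    tridiagonal-lowers : ∀ {M} → Tridiagonal M → LowersBy 1 E M
    tridiagonal-lowers tridiagonal i j 1+i<j v = span⇒From (toℕ j ∸ 1) (toℕ j +ℕ 1) (tridiagonal j _ (component-span j v)) i
      (ℕ.≤-trans (ℕ.≤-reflexive (ℕ.+-comm 1 (toℕ i))) (ℕ.m+n≤o⇒m≤o∸n (toℕ i +ℕ 1)
        (≡-subst (_≤ toℕ j) (≡-trans (≡-cong suc (ℕ.+-comm 1 (toℕ i))) (ℕ.+-comm 1 (toℕ i +ℕ 1))) 1+i<j)))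

module FromTDSystem {c ℓ} (F : Field c ℓ) {n d : ℕ} (Φ : TDSystem F n d) where
  open Field F
  open FiniteSums F
  open Matrices F n
  open TridiagonalSystems F n d
  open Spans F n d
  open TDSystem Φ

  resolutionOf : ∀ {E : Fin (suc d) → Mat F n} →
    (∀ i → _≈m_ F (_·_ F (E i) (E i)) (E i)) → (∀ i j → i ≢ j → _≈m_ F (_·_ F (E i) (E j)) (0m F)) →
    _≈m_ F (sumMF F E) (Im F) → Resolution E
  resolutionOf {E} idem orth total = record
    { orthogonal = λ i j i≢j v → ≈v.trans (≈v.sym (app-· (E i) (E j) v)) (app-0m (orth i j i≢j) v)
    ; idempotent = λ i v → ≈v.trans (≈v.sym (app-· (E i) (E i) v)) (app-cong (idem i) (≈v.refl {v}))
    ; complete   = λ v → ≈v.trans (≈v.sym (app-sumMF E v)) (≈v.trans (app-cong total (≈v.refl {v})) (app-Im v)) }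

  -- From M E_j = θ_j E_j to E_i M = θ_i E_i: the vector is expanded over all eigenspaces and
  -- orthogonality selects one term.
  spacesOf : ∀ {M E} → Resolution E → (θ : Fin (suc d) → Carrier) → (∀ i → _≈m_ F (_·_ F M (E i)) (_•_ F (θ i) (E i))) →
    (∀ i → ¬ (_≈m_ F (E i) (0m F))) → Eigenspaces M E
  spacesOf {M} {E} res θ eigenʳ nonzero = record { resolution = res ; θ = θ ; eigen = eigen ; nonzero = nonzero }
    where
    open Resolution res
    image : ∀ j v → ≈v._≈_ (app F M (app F (E j) v)) (_•v_ F (θ j) (app F (E j) v))
    image j v = ≈v.trans (≈v.sym (app-· M (E j) v)) (≈v.trans (app-cong (eigenʳ j) (≈v.refl {v})) (app-•m (θ j) (E j) v))
    moved : ∀ i j v → ≈v._≈_ (app F (E i) (app F M (app F (E j) v))) (_•v_ F (θ j) (app F (E i) (app F (E j) v)))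
    moved i j v = ≈v.trans (app-congʳ (E i) (image j v)) (app-• (E i) (θ j) (app F (E j) v))
    eigen : ∀ i v → ≈v._≈_ (app F (E i) (app F M v)) (_•v_ F (θ i) (app F (E i) v))
    eigen i v = begin
      app F (E i) (app F M v)                                       ≈⟨ block-expansion res M i v ⟩
      sumVF F (λ j → app F (E i) (app F M (app F (E j) v)))         ≈⟨ sumVF-single i (λ j → app F (E i) (app F M (app F (E j) v)))
        (λ j i≢j → ≈v.trans (moved i j v) (λ r → trans (*-congˡ (orthogonal i j i≢j v r)) (zeroʳ (θ j)))) ⟩
      app F (E i) (app F M (app F (E i) v))                         ≈⟨ moved i i v ⟩
      _•v_ F (θ i) (app F (E i) (app F (E i) v))                    ≈⟨ (λ r → *-congˡ (idempotent i v r)) ⟩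
      _•v_ F (θ i) (app F (E i) v)                                  ∎
      where open SetoidReasoning vectors

  resolution-E : Resolution E
  resolution-E = resolutionOf E-idem E-orth E-sum

  resolution-E* : Resolution E*
  resolution-E* = resolutionOf E*-idem E*-orth E*-sum

  system : System
  system = record
    { A = A ; A* = A* ; E = E ; E* = E*
    ; spaces = spacesOf resolution-E θ E-eigen E-nonzero
    ; spaces* = spacesOf resolution-E* θ* E*-eigen E*-nonzero
    ; A*-raises = tridiagonal-raises resolution-E A*-tridiag
    ; A*-lowers = tridiagonal-lowers resolution-E A*-tridiag
    ; A-raises = tridiagonal-raises resolution-E* A-tridiag
    ; A-lowers = tridiagonal-lowers resolution-E* A-tridiag
    ; irreducible = irreducible }

-- Double brackets evaluated on blocks between eigenspaces

module SpectralBlocks {c ℓ} (F : Field c ℓ) (n d : ℕ) (b : Field.Carrier F) where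
  open Field F using (Carrier; _≈_) renaming (_*_ to _*ᶠ_; _-_ to _-ᶠ_; 0# to 0ᶠ)
  private module F = Field F
  open Matrices F n
  open TridiagonalSystems F n d
  open Ring matrixRing renaming (_≈_ to _≈ᴹ_; Carrier to Matrix; setoid to matrices)
  open NoncommutativeSolver matrixRing
  open LevelIdentities matrixRing (scalar b) (scalar-central b) using (bracket; bracketᵇ; B; :bracket; :bracketᵇ)

  central : Carrier → Σ Matrix Central
  central a = scalar a , scalar-central a

  module _ {X : Matrix} {E : Fin (suc d) → Matrix} (spaces : Eigenspaces X E) where
    open Eigenspaces spaces

    sandwich : Fin (suc d) → Matrix → Fin (suc d) → Matrix
    sandwich i M j = E i * M * E j

    zeroBlock⇒sandwich : ∀ {i j} M → ZeroBlock E M i j → sandwich i M j ≈ᴹ 0#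
    zeroBlock⇒sandwich {i} {j} M zb = app-injective λ v → ≈v.trans (app-· (E i * M) (E j) v)
      (≈v.trans (app-· (E i) M (app F (E j) v)) (≈v.trans (zb v) (≈v.sym (app-0m {0m F} (λ _ _ → F.refl) v))))

    sandwich⇒zeroBlock : ∀ {i j} M → sandwich i M j ≈ᴹ 0# → ZeroBlock E M i j
    sandwich⇒zeroBlock {i} {j} M p v = ≈v.trans (≈v.sym (≈v.trans (app-· (E i * M) (E j) v) (app-· (E i) M (app F (E j) v)))) (app-0m p v)

    zeroBlocks⇒0 : ∀ M → (∀ i j → sandwich i M j ≈ᴹ 0#) → M ≈ᴹ 0#
    zeroBlocks⇒0 M p = app-injective λ v → ≈v.trans
      (vanishes (λ i → ≈v.trans (block-expansion resolution M i v) (sumVF-0 (λ j → sandwich⇒zeroBlock M (p i j) v))))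
      (≈v.sym (app-0m {0m F} (λ _ _ → F.refl) v))

    eigenˡ : ∀ i → E i * X ≈ᴹ scalar (θ i) * E i
    eigenˡ i = app-injective λ v → ≈v.trans (app-· (E i) X v) (≈v.trans (eigen i v)
      (≈v.sym (≈v.trans (app-cong (scalar-· (θ i) (E i)) (≈v.refl {v})) (app-•m (θ i) (E i) v))))

    eigenʳ : ∀ j → X * E j ≈ᴹ scalar (θ j) * E j
    eigenʳ j = app-injective λ v → ≈v.trans (app-· X (E j) v) (≈v.trans (≈v.sym (complete _)) (≈v.trans
      (sumVF-single j (λ i → app F (E i) (app F X (app F (E j) v))) (λ i j≢i → ≈v.trans (eigen i (app F (E j) v))
        (λ r → F.trans (F.*-congˡ (orthogonal i j (λ eq → j≢i (≡-sym eq)) v r)) (F.zeroʳ (θ i)))))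
      (≈v.trans (eigen j (app F (E j) v)) (≈v.trans (λ r → F.*-congˡ (idempotent j v r))
        (≈v.sym (≈v.trans (app-cong (scalar-· (θ j) (E j)) (≈v.refl {v})) (app-•m (θ j) (E j) v)))))))

    private
      :t :u : Expr
      :t = cvar 1
      :u = cvar 2

      module Block (i j : Fin (suc d)) (M : Matrix) where
        open Evaluation (central b ∷ central (θ i) ∷ central (θ j) ∷ []) (X ∷ M ∷ E i ∷ E j ∷ []) public

        :X = var 0
        :M = var 1
        :Eᵢ = var 2
        :Eⱼ = var 3

    -- On the (i,j) block, [X,[X,M]_b] acts as (θ_i - θ_j)(b θ_i - θ_j) times E_i M E_j.
    quadratic-block : ∀ i j {M} → bracket X (bracketᵇ X M) ≈ᴹ 0# → ¬ (θ i ≈ θ j) → ¬ (b *ᶠ θ i ≈ θ j) → sandwich i M j ≈ᴹ 0#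
    quadratic-block i j {M} p θᵢ≉θⱼ bθᵢ≉θⱼ = scalar-cancel (difference≉0 θᵢ≉θⱼ) (scalar-cancel (difference≉0 bθᵢ≉θⱼ) (trans
      (*-cong (trans (sym (scalar-- _ _)) (+-congʳ (sym (scalar-* b (θ i))))) (*-congʳ (sym (scalar-- _ _))))
      (solveModulo ((B :* :t :- :u) :* ((:t :- :u) :* (:Eᵢ :* :M :* :Eⱼ))) :0
        ( (:0 :- B ⟨ :Eᵢ :* :X ≋ :t :* :Eᵢ ∣ eigenˡ i ⟩ :X :* :M :* :Eⱼ)
        ∷ (:0 :- B :* :t ⟨ :Eᵢ :* :X ≋ :t :* :Eᵢ ∣ eigenˡ i ⟩ :M :* :Eⱼ)
        ∷ (B :+ :1 ⟨ :Eᵢ :* :X ≋ :t :* :Eᵢ ∣ eigenˡ i ⟩ :M :* :X :* :Eⱼ)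
        ∷ ((B :+ :1) :* :t :* :Eᵢ :* :M ⟨ :X :* :Eⱼ ≋ :u :* :Eⱼ ∣ eigenʳ j ⟩ :1)
        ∷ (:0 :- :Eᵢ :* :M :* :X ⟨ :X :* :Eⱼ ≋ :u :* :Eⱼ ∣ eigenʳ j ⟩ :1)
        ∷ (:0 :- :u :* :Eᵢ :* :M ⟨ :X :* :Eⱼ ≋ :u :* :Eⱼ ∣ eigenʳ j ⟩ :1)
        ∷ (:Eᵢ ⟨ :bracket :X (:bracketᵇ :X :M) ≋ :0 ∣ p ⟩ :Eⱼ) ∷ []) ≡-refl)))
      where
      open Block i j M
      difference≉0 : ∀ {a a′} → ¬ (a ≈ a′) → ¬ (a -ᶠ a′ ≈ 0ᶠ)
      difference≉0 a≉a′ q = a≉a′ (RingProperties.x∙y⁻¹≈ε⇒x≈y F.ring _ _ q)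

    -- For [X,[M,X]_b] the scalar is (θ_i - θ_j)(b θ_j - θ_i).
    quadratic-blockʳ : ∀ i j {M} → bracket X (bracketᵇ M X) ≈ᴹ 0# → ¬ (θ i ≈ θ j) → ¬ (b *ᶠ θ j ≈ θ i) → sandwich i M j ≈ᴹ 0#
    quadratic-blockʳ i j {M} p θᵢ≉θⱼ bθⱼ≉θᵢ = scalar-cancel (difference≉0 θᵢ≉θⱼ) (scalar-cancel (difference≉0 bθⱼ≉θᵢ) (trans
      (*-cong (trans (sym (scalar-- _ _)) (+-congʳ (sym (scalar-* b (θ j))))) (*-congʳ (sym (scalar-- _ _))))
      (solveModulo ((B :* :u :- :t) :* ((:t :- :u) :* (:Eᵢ :* :M :* :Eⱼ))) :0
        ( (:1 ⟨ :Eᵢ :* :X ≋ :t :* :Eᵢ ∣ eigenˡ i ⟩ :X :* :M :* :Eⱼ)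
        ∷ (:t ⟨ :Eᵢ :* :X ≋ :t :* :Eᵢ ∣ eigenˡ i ⟩ :M :* :Eⱼ)
        ∷ (:0 :- (B :+ :1) ⟨ :Eᵢ :* :X ≋ :t :* :Eᵢ ∣ eigenˡ i ⟩ :M :* :X :* :Eⱼ)
        ∷ (:0 :- (B :+ :1) :* :t :* :Eᵢ :* :M ⟨ :X :* :Eⱼ ≋ :u :* :Eⱼ ∣ eigenʳ j ⟩ :1)
        ∷ (B :* :Eᵢ :* :M :* :X ⟨ :X :* :Eⱼ ≋ :u :* :Eⱼ ∣ eigenʳ j ⟩ :1)
        ∷ (B :* :u :* :Eᵢ :* :M ⟨ :X :* :Eⱼ ≋ :u :* :Eⱼ ∣ eigenʳ j ⟩ :1)
        ∷ (:Eᵢ ⟨ :bracket :X (:bracketᵇ :M :X) ≋ :0 ∣ p ⟩ :Eⱼ) ∷ []) ≡-refl)))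
      where
      open Block i j M
      difference≉0 : ∀ {a a′} → ¬ (a ≈ a′) → ¬ (a -ᶠ a′ ≈ 0ᶠ)
      difference≉0 a≉a′ q = a≉a′ (RingProperties.x∙y⁻¹≈ε⇒x≈y F.ring _ _ q)

    -- On the (i,j) block the q-Serre element acts as a multiple of
    -- (θᵢ - θⱼ)(bθᵢ - θⱼ)(θᵢ - bθⱼ), which vanishes for |i - j| ≤ 1.
    serre : ∀ {M} → RaisesBy 1 E M → LowersBy 1 E M →
      (∀ i j → toℕ j ≡ suc (toℕ i) → b *ᶠ θ i ≈ θ j ⊎ θ i ≈ b *ᶠ θ j) →
      bracketᵇ X (bracket X (bracketᵇ M X)) ≈ᴹ 0#
    serre {M} raises lowers ratio = zeroBlocks⇒0 _ λ i j → trans (expand i j) (vanish i j)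
      where
      expand : ∀ i j → sandwich i (bracketᵇ X (bracket X (bracketᵇ M X))) j ≈ᴹ
        (0# - 1#) * ((scalar (θ i) - scalar (θ j)) * (scalar b * scalar (θ i) - scalar (θ j)) * (scalar (θ i) - scalar b * scalar (θ j)) * sandwich i M j)
      expand i j = solveModulo (:Eᵢ :* :bracketᵇ :X (:bracket :X (:bracketᵇ :M :X)) :* :Eⱼ)
        ((:0 :- :1) :* ((:t :- :u) :* (B :* :t :- :u) :* (:t :- B :* :u) :* (:Eᵢ :* :M :* :Eⱼ)))
        ( (:0 :- B ⟨ eq₁ ≋ eq₁′ ∣ eigenˡ i ⟩ :X :* :X :* :M :* :Eⱼ)
        ∷ (:0 :- B :* :t ⟨ eq₁ ≋ eq₁′ ∣ eigenˡ i ⟩ :X :* :M :* :Eⱼ)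
        ∷ (:0 :- B :* :t :* :t ⟨ eq₁ ≋ eq₁′ ∣ eigenˡ i ⟩ :M :* :Eⱼ)
        ∷ (K ⟨ eq₁ ≋ eq₁′ ∣ eigenˡ i ⟩ :X :* :M :* :X :* :Eⱼ)
        ∷ (K :* :t ⟨ eq₁ ≋ eq₁′ ∣ eigenˡ i ⟩ :M :* :X :* :Eⱼ)
        ∷ (K :* :t :* :t :* :Eᵢ :* :M ⟨ eq₂ ≋ eq₂′ ∣ eigenʳ j ⟩ :1)
        ∷ (:0 :- K ⟨ eq₁ ≋ eq₁′ ∣ eigenˡ i ⟩ :M :* :X :* :X :* :Eⱼ)
        ∷ (:0 :- K :* :t :* :Eᵢ :* :M :* :X ⟨ eq₂ ≋ eq₂′ ∣ eigenʳ j ⟩ :1)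
        ∷ (:0 :- K :* :t :* :u :* :Eᵢ :* :M ⟨ eq₂ ≋ eq₂′ ∣ eigenʳ j ⟩ :1)
        ∷ (B :* :Eᵢ :* :M :* :X :* :X ⟨ eq₂ ≋ eq₂′ ∣ eigenʳ j ⟩ :1)
        ∷ (B :* :u :* :Eᵢ :* :M :* :X ⟨ eq₂ ≋ eq₂′ ∣ eigenʳ j ⟩ :1)
        ∷ (B :* :u :* :u :* :Eᵢ :* :M ⟨ eq₂ ≋ eq₂′ ∣ eigenʳ j ⟩ :1) ∷ []) ≡-refl
        where
        open Block i j M
        K = B :* B :+ B :+ :1
        eq₁  = :Eᵢ :* :X
        eq₁′ = :t :* :Eᵢ
        eq₂  = :X :* :Eⱼ
        eq₂′ = :u :* :Eⱼ

      Target : Fin (suc d) → Fin (suc d) → Set ℓ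
      Target i j = (0# - 1#) * ((scalar (θ i) - scalar (θ j)) * (scalar b * scalar (θ i) - scalar (θ j)) * (scalar (θ i) - scalar b * scalar (θ j)) * sandwich i M j) ≈ᴹ 0#

      zero-block : ∀ i j → sandwich i M j ≈ᴹ 0# → Target i j
      zero-block i j p = solveModulo ((:0 :- :1) :* ((:t :- :u) :* (B :* :t :- :u) :* (:t :- B :* :u) :* (:Eᵢ :* :M :* :Eⱼ))) :0
        (((:0 :- :1) :* ((:t :- :u) :* (B :* :t :- :u) :* (:t :- B :* :u)) ⟨ :Eᵢ :* :M :* :Eⱼ ≋ :0 ∣ p ⟩ :1) ∷ []) ≡-refl
        where open Block i j M

      zero-factor : ∀ i j → b *ᶠ θ i ≈ θ j ⊎ θ i ≈ b *ᶠ θ j → Target i j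
      zero-factor i j (inj₁ p) = solveModulo ((:0 :- :1) :* ((:t :- :u) :* (B :* :t :- :u) :* (:t :- B :* :u) :* (:Eᵢ :* :M :* :Eⱼ))) :0
        (((:0 :- :1) :* (:t :- :u) ⟨ B :* :t ≋ :u ∣ trans (scalar-* b (θ i)) (scalar-cong p) ⟩ (:t :- B :* :u) :* (:Eᵢ :* :M :* :Eⱼ)) ∷ []) ≡-refl
        where open Block i j M
      zero-factor i j (inj₂ p) = solveModulo ((:0 :- :1) :* ((:t :- :u) :* (B :* :t :- :u) :* (:t :- B :* :u) :* (:Eᵢ :* :M :* :Eⱼ))) :0
        (((:0 :- :1) :* ((:t :- :u) :* (B :* :t :- :u)) ⟨ :t ≋ B :* :u ∣ trans (scalar-cong p) (sym (scalar-* b (θ j))) ⟩ :Eᵢ :* :M :* :Eⱼ) ∷ []) ≡-refl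
        where open Block i j M

      flip : ∀ {i j} → b *ᶠ θ i ≈ θ j ⊎ θ i ≈ b *ᶠ θ j → b *ᶠ θ j ≈ θ i ⊎ θ j ≈ b *ᶠ θ i
      flip (inj₁ p) = inj₂ (F.sym p)
      flip (inj₂ p) = inj₁ (F.sym p)

      vanish : ∀ i j → Target i j
      vanish i j with ℕ.<-cmp (toℕ i) (toℕ j)
      vanish i j | tri≈ _ i≡j _ with ≡-refl ← toℕ-injective i≡j =
        solve ((:0 :- :1) :* ((:t :- :t) :* (B :* :t :- :t) :* (:t :- B :* :t) :* (:Eᵢ :* :M :* :Eⱼ))) :0 ≡-refl
        where open Block i i M
      vanish i j | tri< i<j _ _ with ℕ.m≤n⇒m<n∨m≡n i<j
      ... | inj₁ 1+i<j = zero-block i j (zeroBlock⇒sandwich M (lowers i j 1+i<j))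
      ... | inj₂ 1+i≡j = zero-factor i j (ratio i j (≡-sym 1+i≡j))
      vanish i j | tri> _ _ j<i with ℕ.m≤n⇒m<n∨m≡n j<i
      ... | inj₁ 1+j<i = zero-block i j (zeroBlock⇒sandwich M (raises i j 1+j<i))
      ... | inj₂ 1+j≡i = zero-factor i j (flip {j} {i} (ratio j i (≡-sym 1+j≡i)))

-- The recursion of the alternating elements, brought to polynomial form

module AlternatingSequences {c ℓ} (F : Field c ℓ) {n : ℕ} (x y : Mat F n) (b : Field.Carrier F) where
  open Field F using (Carrier; _⁻¹) renaming (_≈_ to _≈ᶠ_; _*_ to _*ᶠ_; _+_ to _+ᶠ_; _-_ to _-ᶠ_; 0# to 0ᶠ; 1# to 1ᶠ)
  private module F = Field F
  open Matrices F n
  open Ring matrixRing renaming (Carrier to Matrix)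

  quads : ℕ → Quad F n
  quads = altQuad F x y b

  g h w⁻ w⁺ : ℕ → Matrix
  g k  = Quad.Gq (quads k)
  h k  = Quad.Gtq (quads k)
  w⁻ k = Quad.Wneg (quads k)
  w⁺ k = Quad.Wpos (quads k)

  ≡ᵇ-refl : ∀ m → (m ≡ᵇ m) ≡ true
  ≡ᵇ-refl zero    = ≡-refl
  ≡ᵇ-refl (suc m) = ≡ᵇ-refl m

  private
    bi c₂ : Carrier
    bi = b ⁻¹
    c₂ = 1ᶠ -ᶠ bi
    c₁ : ℕ → Carrier
    c₁ m = 1ᶠ +ᶠ pow F bi m

  -- The recursion table of the alternating elements is not exported by
  -- name; the placeholders are resolved to its entries by unification.
  mutual
    summand₁ summand₂ : ℕ → ℕ → Matrix
    summand₁ = _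
    summand₂ = _

    g-suc : ∀ m → g (suc m) ≡
      _•_ F (c₁ (suc m) ⁻¹) (sumFrom F 0 (suc m) (summand₁ m) - sumFrom F 1 (suc m) (summand₂ m))
        + _•_ F ((c₁ (suc m) *ᶠ c₂) ⁻¹) (comm F (w⁺ m) x)
    g-suc m rewrite ≡ᵇ-refl m = ≡-refl

  mutual
    table′ : ℕ → ℕ → Quad F n
    table′ = _

    summand₁-table : ∀ m k j → (suc m ∸ k) ∸ 1 ≡ j →
      summand₁ m k ≡ _•_ F (pow F bi k) (Quad.Wneg (table′ m k) * Quad.Wpos (table′ m j))
    summand₁-table m k j eq rewrite eq = ≡-refl

    summand₂-table : ∀ m k j → suc m ∸ k ≡ j →
      summand₂ m k ≡ _•_ F (pow F bi k) (Quad.Gq (table′ m k) * Quad.Gtq (table′ m j))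
    summand₂-table m k j eq rewrite eq = ≡-refl

  ≤⇒≢ᵇsuc : ∀ {k m} → k ≤ m → (k ≡ᵇ suc m) ≡ false
  ≤⇒≢ᵇsuc z≤n       = ≡-refl
  ≤⇒≢ᵇsuc (s≤s k≤m) = ≤⇒≢ᵇsuc k≤m

  -- An entry is never overwritten by later rows, so the recursion at any level can be read in terms
  -- of the final sequence.
  table-stable : ∀ m {k} → k ≤ m → table′ m k ≡ quads k
  table-stable zero    z≤n = ≡-refl
  table-stable (suc m) {k} k≤1+m with ℕ.m≤n⇒m<n∨m≡n k≤1+m
  ... | inj₂ ≡-refl    = ≡-refl
  ... | inj₁ (s≤s k≤m) rewrite ≤⇒≢ᵇsuc k≤m = table-stable m k≤m

  h-suc : ∀ m → h (suc m) ≡ g (suc m) + _•_ F (c₂ ⁻¹) (comm F x (w⁺ m))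
  h-suc m rewrite ≡ᵇ-refl m = ≡-refl

  w⁻-suc : ∀ m → w⁻ (suc m) ≡ _•_ F ((b -ᶠ 1ᶠ) ⁻¹) (commb F b x (g (suc m)))
  w⁻-suc m rewrite ≡ᵇ-refl m = ≡-refl

  w⁺-suc : ∀ m → w⁺ (suc m) ≡ _•_ F ((b -ᶠ 1ᶠ) ⁻¹) (commb F b (g (suc m)) y)
  w⁺-suc m rewrite ≡ᵇ-refl m = ≡-refl

  open Convolution matrixRing using (conv; conv-last; conv-cong)

  sumFrom0-conv : ∀ m (f : ℕ → Matrix) (f′ : ℕ → ℕ → Matrix) →
    (∀ k → k ≤ m → f k ≈ f′ k (m ∸ k)) → sumFrom F 0 (suc m) f ≈ conv m f′
  sumFrom0-conv zero    f f′ p = trans (+-identityˡ _) (p 0 z≤n)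
  sumFrom0-conv (suc m) f f′ p = trans (+-cong
    (sumFrom0-conv m f (λ k l → f′ k (suc l)) (λ k k≤m → trans (p k (ℕ.m≤n⇒m≤1+n k≤m)) (reflexive (≡-cong (f′ k) (ℕ.+-∸-assoc 1 k≤m)))))
    (trans (p (suc m) ℕ.≤-refl) (reflexive (≡-cong (f′ (suc m)) (ℕ.n∸n≡0 m)))))
    (sym (conv-last m f′))

  sumFrom1-conv : ∀ m (f : ℕ → Matrix) (f′ : ℕ → ℕ → Matrix) →
    (∀ k → suc k ≤ m → f (suc k) ≈ f′ (suc k) (m ∸ k)) → f′ 0 (suc m) + sumFrom F 1 (suc m) f ≈ conv m (λ k l → f′ k (suc l))
  sumFrom1-conv zero    f f′ p = +-identityʳ _
  sumFrom1-conv (suc m) f f′ p = trans (sym (+-assoc _ _ _)) (trans (+-cong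
    (sumFrom1-conv m f (λ k l → f′ k (suc l)) (λ k k≤m → trans (p k (ℕ.m≤n⇒m≤1+n k≤m)) (reflexive (≡-cong (f′ (suc k)) (ℕ.+-∸-assoc 1 (ℕ.≤-trans (ℕ.n≤1+n k) k≤m))))))
    (trans (p m ℕ.≤-refl) (reflexive (≡-cong (f′ (suc m)) (≡-trans (ℕ.+-∸-assoc 1 (ℕ.≤-refl {m})) (≡-cong suc (ℕ.n∸n≡0 m)))))))
    (sym (conv-last m (λ k l → f′ k (suc l)))))

  S₁ S₂ : ℕ → Matrix
  S₁ m = sumFrom F 0 (suc m) (summand₁ m)
  S₂ m = sumFrom F 1 (suc m) (summand₂ m)

  S₁-conv : ∀ m → S₁ m ≈ conv m (λ k l → _•_ F (pow F bi k) (w⁻ k * w⁺ l))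
  S₁-conv m = sumFrom0-conv m (summand₁ m) (λ k l → _•_ F (pow F bi k) (w⁻ k * w⁺ l)) λ k k≤m → reflexive (≡-trans
    (summand₁-table m k (m ∸ k) (≡-cong (_∸ 1) (ℕ.+-∸-assoc 1 k≤m)))
    (≡-cong₂ (λ p q → _•_ F (pow F bi k) (Quad.Wneg p * Quad.Wpos q)) (table-stable m k≤m) (table-stable m (ℕ.m∸n≤m m k))))

  -- The sum in the recursion omits k = 0 and k = n. Adding these two terms completes it to a
  -- convolution.
  S₂-conv : ∀ m → _•_ F 1ᶠ (g 0 * h (suc m)) + S₂ m + _•_ F (pow F bi (suc m)) (g (suc m) * h 0) ≈
    conv (suc m) (λ k l → _•_ F (pow F bi k) (g k * h l))
  S₂-conv m = trans (+-congʳ (sumFrom1-conv m (summand₂ m) (λ k l → _•_ F (pow F bi k) (g k * h l)) λ k k<m → reflexive (≡-trans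
      (summand₂-table m (suc k) (m ∸ k) ≡-refl)
      (≡-cong₂ (λ p q → _•_ F (pow F bi (suc k)) (Quad.Gq p * Quad.Gtq q)) (table-stable m k<m) (table-stable m (ℕ.m∸n≤m m k))))))
    (sym (conv-last m (λ k l → _•_ F (pow F bi k) (g k * h l))))

module NonRootOfUnity {c ℓ} (F : Field c ℓ) (b : Field.Carrier F)
  (b≉0 : ¬ (Field._≈_ F b (Field.0# F)))
  (bᵐ≉1 : ∀ m → ¬ (Field._≈_ F (pow F b (suc m)) (Field.1# F))) where
  open Field F using (Carrier; _⁻¹) renaming (_≈_ to _≈ᶠ_; _*_ to _*ᶠ_; _+_ to _+ᶠ_; _-_ to _-ᶠ_; 0# to 0ᶠ; 1# to 1ᶠ)
  private module F = Field F
  open RingProperties F.ring using () renaming (x∙y⁻¹≈ε⇒x≈y to difference≈0⇒≈)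
  open NoncommutativeSolver F.ring

  bi c₂ : Carrier
  bi = b ⁻¹
  c₂ = 1ᶠ -ᶠ bi

  c₁ : ℕ → Carrier
  c₁ m = 1ᶠ +ᶠ pow F bi m

  pow-+ : ∀ a m k → pow F a (m +ℕ k) ≈ᶠ pow F a m *ᶠ pow F a k
  pow-+ a zero    k = F.sym (F.*-identityˡ _)
  pow-+ a (suc m) k = F.trans (F.*-congˡ (pow-+ a m k)) (F.sym (F.*-assoc _ _ _))

  pow-inverse : ∀ m → pow F b m *ᶠ pow F bi m ≈ᶠ 1ᶠ
  pow-inverse zero    = F.*-identityˡ 1ᶠ
  pow-inverse (suc m) = begin
    b *ᶠ p *ᶠ (bi *ᶠ q)     ≈⟨ F.*-assoc _ _ _ ⟩
    b *ᶠ (p *ᶠ (bi *ᶠ q))   ≈⟨ F.*-congˡ (F.trans (F.sym (F.*-assoc _ _ _)) (F.trans (F.*-congʳ (F.*-comm p bi)) (F.*-assoc _ _ _))) ⟩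
    b *ᶠ (bi *ᶠ (p *ᶠ q))   ≈⟨ F.*-assoc _ _ _ ⟨
    b *ᶠ bi *ᶠ (p *ᶠ q)     ≈⟨ F.*-cong (F.⁻¹-inverse b b≉0) (pow-inverse m) ⟩
    1ᶠ *ᶠ 1ᶠ                ≈⟨ F.*-identityˡ 1ᶠ ⟩
    1ᶠ                      ∎
    where
    open SetoidReasoning F.setoid
    p = pow F b m
    q = pow F bi m

  b-1≉0 : ¬ (b -ᶠ 1ᶠ ≈ᶠ 0ᶠ)
  b-1≉0 p = bᵐ≉1 0 (F.trans (F.*-identityʳ b) (difference≈0⇒≈ _ _ p))

  -- b^{m+1} = -1 would give b^{2m+2} = 1.
  1+pow≉0 : ∀ m → ¬ (1ᶠ +ᶠ pow F b (suc m) ≈ᶠ 0ᶠ)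
  1+pow≉0 m p = bᵐ≉1 (m +ℕ suc m) (F.trans (pow-+ b (suc m) (suc m)) (S.solveModulo (var 0 :* var 0) :1
    ((var 0 S.⟨ :1 :+ var 0 ≋ :0 ∣ p ⟩ :1) ∷ (:0 :- :1 S.⟨ :1 :+ var 0 ≋ :0 ∣ p ⟩ :1) ∷ []) ≡-refl))
    where
    module S = Evaluation [] (pow F b (suc m) ∷ [])

  b+1≉0 : ¬ (b +ᶠ 1ᶠ ≈ᶠ 0ᶠ)
  b+1≉0 p = 1+pow≉0 0 (F.trans (F.+-congˡ (F.*-identityʳ b)) (F.trans (F.+-comm 1ᶠ b) p))

  c₂≉0 : ¬ (c₂ ≈ᶠ 0ᶠ)
  c₂≉0 p = b-1≉0 (F.trans (F.+-congˡ (F.-‿cong (F.trans (F.sym (F.⁻¹-inverse b b≉0)) (F.trans (F.*-congˡ (F.sym (difference≈0⇒≈ _ _ p))) (F.*-identityʳ b))))) (F.-‿inverseʳ b))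

  c₁≉0 : ∀ m → ¬ (c₁ (suc m) ≈ᶠ 0ᶠ)
  c₁≉0 m p = 1+pow≉0 m (S.solveModulo (:1 :+ var 0) :0
    ((var 0 S.⟨ :1 :+ var 1 ≋ :0 ∣ p ⟩ :1) ∷ (:0 :- :1 S.⟨ var 0 :* var 1 ≋ :1 ∣ pow-inverse (suc m) ⟩ :1) ∷ []) ≡-refl)
    where
    module S = Evaluation [] (pow F b (suc m) ∷ pow F bi (suc m) ∷ [])

  product≉0 : ∀ {a a′} → ¬ (a ≈ᶠ 0ᶠ) → ¬ (a′ ≈ᶠ 0ᶠ) → ¬ (a *ᶠ a′ ≈ᶠ 0ᶠ)
  product≉0 {a} {a′} a≉0 a′≉0 p = a′≉0 (begin
    a′                     ≈⟨ F.*-identityˡ a′ ⟨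
    1ᶠ *ᶠ a′               ≈⟨ F.*-congʳ (F.trans (F.*-comm _ _) (F.⁻¹-inverse a a≉0)) ⟨
    a ⁻¹ *ᶠ a *ᶠ a′        ≈⟨ F.*-assoc _ _ _ ⟩
    a ⁻¹ *ᶠ (a *ᶠ a′)      ≈⟨ F.*-congˡ p ⟩
    a ⁻¹ *ᶠ 0ᶠ             ≈⟨ F.zeroʳ _ ⟩
    0ᶠ                     ∎)
    where open SetoidReasoning F.setoid

module AlternatingHypotheses {c ℓ} (F : Field c ℓ) {n : ℕ} (x y : Mat F n) (b : Field.Carrier F)
  (b≉0 : ¬ (Field._≈_ F b (Field.0# F)))
  (bᵐ≉1 : ∀ m → ¬ (Field._≈_ F (pow F b (suc m)) (Field.1# F))) where
  open Field F using (Carrier; _⁻¹) renaming (_≈_ to _≈ᶠ_; _*_ to _*ᶠ_; _+_ to _+ᶠ_; _-_ to _-ᶠ_; 0# to 0ᶠ; 1# to 1ᶠ)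
  private module F = Field F
  open Matrices F n
  open AlternatingSequences F x y b
  open Ring matrixRing renaming (Carrier to Matrix)
  open NoncommutativeSolver matrixRing
  open RingProperties F.ring using () renaming (x∙y⁻¹≈ε⇒x≈y to difference≈0⇒≈)
  open NonRootOfUnity F b b≉0 bᵐ≉1

  invert : ∀ {a} → ¬ (a ≈ᶠ 0ᶠ) → scalar a * scalar (a ⁻¹) ≈ 1#
  invert {a} a≉0 = trans (scalar-* a (a ⁻¹)) (trans (scalar-cong (F.⁻¹-inverse a a≉0)) scalar-1)

  ρ : Carrier
  ρ = b *ᶠ ((b +ᶠ 1ᶠ) *ᶠ ((b -ᶠ 1ᶠ) *ᶠ (b -ᶠ 1ᶠ))) ⁻¹

  private
    𝐛 = scalar b
    𝐛⁻¹ = scalar bi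

  𝐛-inverse : 𝐛 * 𝐛⁻¹ ≈ 1#
  𝐛-inverse = invert b≉0

  open WeightedSums matrixRing 𝐛 𝐛⁻¹ (scalar ρ) (scalar-central b) (scalar-central bi) (scalar-central ρ) 𝐛-inverse

  𝐛-1 : 𝐛 - 1# ≈ scalar (b -ᶠ 1ᶠ)
  𝐛-1 = trans (+-congˡ (-‿cong (sym scalar-1))) (scalar-- b 1ᶠ)

  𝐛+1 : 𝐛 + 1# ≈ scalar (b +ᶠ 1ᶠ)
  𝐛+1 = trans (+-congˡ (sym scalar-1)) (scalar-+ b 1ᶠ)

  ρ-equation : (𝐛 + 1#) * ((𝐛 - 1#) * (𝐛 - 1#)) * scalar ρ ≈ 𝐛
  ρ-equation = trans (*-congʳ (trans (*-cong 𝐛+1 (trans (*-cong 𝐛-1 𝐛-1) (scalar-* _ _))) (scalar-* _ _)))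
    (trans (scalar-* _ _) (scalar-cong (begin
      s *ᶠ (b *ᶠ s ⁻¹)   ≈⟨ F.*-congˡ (F.*-comm _ _) ⟩
      s *ᶠ (s ⁻¹ *ᶠ b)   ≈⟨ F.*-assoc _ _ _ ⟨
      s *ᶠ s ⁻¹ *ᶠ b     ≈⟨ F.*-congʳ (F.⁻¹-inverse s (product≉0 b+1≉0 (product≉0 b-1≉0 b-1≉0))) ⟩
      1ᶠ *ᶠ b            ≈⟨ F.*-identityˡ b ⟩
      b                  ∎)))
    where
    open SetoidReasoning F.setoid
    s = (b +ᶠ 1ᶠ) *ᶠ ((b -ᶠ 1ᶠ) *ᶠ (b -ᶠ 1ᶠ))

  scalar-^ : ∀ a k → scalar a ^ k ≈ scalar (pow F a k)
  scalar-^ a zero    = sym scalar-1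
  scalar-^ a (suc k) = trans (*-congˡ (scalar-^ a k)) (scalar-* a (pow F a k))

  𝐛ⁿ-1-regular : ∀ m M → (𝐛 ^ suc m - 1#) * M ≈ 0# → M ≈ 0#
  𝐛ⁿ-1-regular m M p = scalar-cancel {pow F b (suc m) -ᶠ 1ᶠ} (λ q → bᵐ≉1 m (difference≈0⇒≈ _ _ q))
    (trans (*-congʳ (sym (trans (+-cong (scalar-^ b (suc m)) (-‿cong (sym scalar-1))) (scalar-- _ _)))) p)

  scaled : ∀ a M → _•_ F a M ≈ scalar a * M
  scaled a M = sym (scalar-· a M)

  w⁻-equation : ∀ m → (𝐛 - 1#) * w⁻ m ≈ bracketᵇ x (g m)
  w⁻-equation zero    = solve ((B :- :1) :* var 0) (:bracketᵇ (var 0) :1) ≡-refl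
    where open Evaluation scalars (x ∷ [])
  w⁻-equation (suc m) = trans (*-congˡ (trans (reflexive (w⁻-suc m)) (trans (scaled e _) (*-congˡ (+-congʳ (scaled b _))))))
    (solveModulo ((B :- :1) :* (var 0 :* (B :* (var 1 :* var 2) :- var 2 :* var 1))) (:bracketᵇ (var 1) (var 2))
      ((:1 ⟨ (B :- :1) :* var 0 ≋ :1 ∣ trans (*-congʳ 𝐛-1) (invert b-1≉0) ⟩ (B :* (var 1 :* var 2) :- var 2 :* var 1)) ∷ []) ≡-refl)
    where
    e = (b -ᶠ 1ᶠ) ⁻¹
    open Evaluation scalars (scalar e ∷ x ∷ g (suc m) ∷ [])

  w⁺-equation : ∀ m → (𝐛 - 1#) * w⁺ m ≈ bracketᵇ (g m) y
  w⁺-equation zero    = solve ((B :- :1) :* var 0) (:bracketᵇ :1 (var 0)) ≡-refl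
    where open Evaluation scalars (y ∷ [])
  w⁺-equation (suc m) = trans (*-congˡ (trans (reflexive (w⁺-suc m)) (trans (scaled e _) (*-congˡ (+-congʳ (scaled b _))))))
    (solveModulo ((B :- :1) :* (var 0 :* (B :* (var 2 :* var 1) :- var 1 :* var 2))) (:bracketᵇ (var 2) (var 1))
      ((:1 ⟨ (B :- :1) :* var 0 ≋ :1 ∣ trans (*-congʳ 𝐛-1) (invert b-1≉0) ⟩ (B :* (var 2 :* var 1) :- var 1 :* var 2)) ∷ []) ≡-refl)
    where
    e = (b -ᶠ 1ᶠ) ⁻¹
    open Evaluation scalars (scalar e ∷ y ∷ g (suc m) ∷ [])

  1-𝐛⁻¹ : 1# - 𝐛⁻¹ ≈ scalar c₂
  1-𝐛⁻¹ = trans (+-congʳ (sym scalar-1)) (scalar-- 1ᶠ bi)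

  h-equation : ∀ m → (1# - 𝐛⁻¹) * (h (suc m) - g (suc m)) ≈ bracket x (w⁺ m)
  h-equation m = trans (*-congˡ (+-congʳ (trans (reflexive (h-suc m)) (+-congˡ (scaled (c₂ ⁻¹) _)))))
    (solveModulo ((:1 :- B⁻) :* ((var 1 :+ var 0 :* var 2) :- var 1)) (var 2)
      ((:1 ⟨ (:1 :- B⁻) :* var 0 ≋ :1 ∣ trans (*-congʳ 1-𝐛⁻¹) (invert c₂≉0) ⟩ var 2) ∷ []) ≡-refl)
    where open Evaluation scalars (scalar (c₂ ⁻¹) ∷ g (suc m) ∷ bracket x (w⁺ m) ∷ [])

  difference : ∀ m → (𝐛 - 1#) * (𝐛 - 1#) * (h (suc m) - g (suc m)) ≈ 𝐛 * bracket x (bracketᵇ (g m) y)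
  difference m = solveModulo ((B :- :1) :* (B :- :1) :* var 0) (B :* :bracket (var 1) (var 3))
    ( (B :* (B :- :1) ⟨ (:1 :- B⁻) :* var 0 ≋ :bracket (var 1) (var 2) ∣ h-equation m ⟩ :1)
    ∷ ((B :- :1) ⟨ B :* B⁻ ≋ :1 ∣ 𝐛-inverse ⟩ var 0)
    ∷ (B :* var 1 ⟨ (B :- :1) :* var 2 ≋ var 3 ∣ w⁺-equation m ⟩ :1)
    ∷ (:0 :- B ⟨ (B :- :1) :* var 2 ≋ var 3 ∣ w⁺-equation m ⟩ var 1) ∷ []) ≡-refl
    where open Evaluation scalars (h (suc m) - g (suc m) ∷ x ∷ w⁺ m ∷ bracketᵇ (g m) y ∷ [])

  g-equation : ∀ m → (1# + weight (suc m)) * (1# - 𝐛⁻¹) * g (suc m) ≈ (1# - 𝐛⁻¹) * (S₁ m - S₂ m) + bracket (w⁺ m) x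
  g-equation m = trans (*-congˡ (trans (reflexive (g-suc m)) (+-cong (scaled _ _) (scaled _ _))))
    (solveModulo ((:1 :+ β) :* (:1 :- B⁻) :* (var 0 :* var 2 :+ var 1 :* var 3)) ((:1 :- B⁻) :* var 2 :+ var 3)
      ( (:1 :- B⁻ ⟨ (:1 :+ β) :* var 0 ≋ :1 ∣ trans (*-congʳ 1+β) (invert (c₁≉0 m)) ⟩ var 2)
      ∷ (:1 ⟨ (:1 :+ β) :* (:1 :- B⁻) :* var 1 ≋ :1 ∣ trans (*-congʳ (trans (*-cong 1+β 1-𝐛⁻¹) (scalar-* _ _))) (invert (product≉0 (c₁≉0 m) c₂≉0)) ⟩ var 3) ∷ []) ≡-refl)
    where
    open Evaluation (weighted (suc m)) (scalar (c₁ (suc m) ⁻¹) ∷ scalar ((c₁ (suc m) *ᶠ c₂) ⁻¹) ∷ S₁ m - S₂ m ∷ bracket (w⁺ m) x ∷ [])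
    1+β : 1# + weight (suc m) ≈ scalar (c₁ (suc m))
    1+β = trans (+-cong (sym scalar-1) (scalar-^ bi (suc m))) (scalar-+ _ _)

  weighted-• : ∀ k M → _•_ F (pow F bi k) M ≈ weight k * M
  weighted-• k M = trans (scaled _ M) (*-congʳ (sym (scalar-^ bi k)))

  quadratic : ∀ m → (𝐛 - 1#) * (𝐛 - 1#) * conv (suc m) (λ k l → weight k * (g k * h l)) ≈
                    conv m (λ k l → weight k * (bracketᵇ x (g k) * bracketᵇ (g l) y))
  quadratic m = begin
    s² * conv (suc m) (λ k l → weight k * (g k * h l))   ≈⟨ *-congˡ (trans (sym ends) cancelled) ⟩
    s² * S₁ m                                            ≈⟨ *-congˡ (trans (S₁-conv m) (conv-cong m (λ k l _ → weighted-• k _))) ⟩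
    s² * conv m (λ k l → weight k * (w⁻ k * w⁺ l))       ≈⟨ conv-*ˡ m s² _ ⟩
    conv m (λ k l → s² * (weight k * (w⁻ k * w⁺ l)))     ≈⟨ conv-cong m (λ k l _ → term k l) ⟩
    conv m (λ k l → weight k * (bracketᵇ x (g k) * bracketᵇ (g l) y)) ∎
    where
    open SetoidReasoning setoid
    s² = (𝐛 - 1#) * (𝐛 - 1#)
    term : ∀ k l → s² * (weight k * (w⁻ k * w⁺ l)) ≈ weight k * (bracketᵇ x (g k) * bracketᵇ (g l) y)
    term k l = solveModulo ((B :- :1) :* (B :- :1) :* (β :* (var 0 :* var 1))) (β :* (var 2 :* var 3))
      ( (β ⟨ (B :- :1) :* var 0 ≋ var 2 ∣ w⁻-equation k ⟩ (B :- :1) :* var 1)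
      ∷ (β :* var 2 ⟨ (B :- :1) :* var 1 ≋ var 3 ∣ w⁺-equation l ⟩ :1) ∷ []) ≡-refl
      where open Evaluation (weighted k) (w⁻ k ∷ w⁺ l ∷ bracketᵇ x (g k) ∷ bracketᵇ (g l) y ∷ [])
    ends : h (suc m) + S₂ m + weight (suc m) * g (suc m) ≈ conv (suc m) (λ k l → weight k * (g k * h l))
    ends = trans (+-cong (+-congʳ (sym (trans (scaled _ _) (trans (*-congʳ scalar-1) (trans (*-identityˡ _) (*-identityˡ _))))))
        (sym (trans (weighted-• (suc m) _) (*-congˡ (*-identityʳ _)))))
      (trans (S₂-conv m) (conv-cong (suc m) (λ k l _ → weighted-• k (g k * h l))))
    cancelled : h (suc m) + S₂ m + weight (suc m) * g (suc m) ≈ S₁ m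
    cancelled = solveModulo (var 1 :+ var 3 :+ β :* var 0) (var 2)
      ( (var 6 ⟨ (:1 :+ β) :* (:1 :- B⁻) :* var 0 ≋ (:1 :- B⁻) :* (var 2 :- var 3) :+ :bracket (var 4) (var 5) ∣ g-equation m ⟩ :1)
      ∷ (var 6 ⟨ (:1 :- B⁻) :* (var 1 :- var 0) ≋ :bracket (var 5) (var 4) ∣ h-equation m ⟩ :1)
      ∷ (:0 :- :1 ⟨ var 6 :* (:1 :- B⁻) ≋ :1 ∣ trans (scalar-central (c₂ ⁻¹) (1# - 𝐛⁻¹)) inv ⟩ (β :* var 0 :+ var 1 :- var 2 :+ var 3)) ∷ []) ≡-refl
      where
      open Evaluation (weighted (suc m)) (g (suc m) ∷ h (suc m) ∷ S₁ m ∷ S₂ m ∷ w⁺ m ∷ x ∷ scalar (c₂ ⁻¹) ∷ [])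
      inv : (1# - 𝐛⁻¹) * scalar (c₂ ⁻¹) ≈ 1#
      inv = trans (*-congʳ 1-𝐛⁻¹) (invert c₂≉0)

-- From flags to the six decompositions

module Targets {c ℓ} (F : Field c ℓ) {n d : ℕ} (Φ : TDSystem F n d) where
  open Field F
  open Matrices F n
  open TridiagonalSystems F n d
  open Spans F n d
  open FromTDSystem F Φ
  open TDSystem Φ

  private
    V = Vect F n
    _≈ᵛ_ = _≈v_ F {n}
    infix 4 _≈ᵛ_

  -- A uniform view of the six decompositions: component i is X i ∩ Y i, and `splitOff` peels it off
  -- a vector of Y i. The targets then become intersections of shifted flag members: X i ∩ Y (i-1)
  -- for `lo`, X (i+1) ∩ Y i for `hi`, X (i+1) ∩ Y (i-1) for `tri`.
  record Flags (κ : Kind) : Set (lsuc (c ⊔ ℓ)) where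
    field
      X Y      : ℕ → V → Set ℓ
      X-top    : ∀ {i v} → d ≤ i → X i v
      Y-bottom : ∀ {v} → Y 0 v
      fromComp : ∀ {i v} → i ≤ d → rawComp F Φ κ i v → X i v × Y i v
      toComp   : ∀ {i v} → i ≤ d → X i v → Y i v → rawComp F Φ κ i v
      splitOff : ∀ i k → i < d → i < k → ∀ {v} → X k v → Y i v →
                 Σ V λ u → Σ V λ w → (X i u × Y i u) × (X k w × Y (suc i) w) × v ≈ᵛ _+v_ F u w

    comp-intro : ∀ {i v} → i ≤ d → X i v → Y i v → comp F Φ κ i v
    comp-intro {i} i≤d p q with i ≤ᵇ d in eq
    ... | true  = toComp i≤d p q
    ... | false = ⊥-elim (≡-subst IsTrue eq (ℕ.≤⇒≤ᵇ i≤d))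

    comp-elim : ∀ {i v} → i ≤ d → comp F Φ κ i v → X i v × Y i v
    comp-elim {i} i≤d p with i ≤ᵇ d in eq
    ... | true  = fromComp i≤d p
    ... | false = ⊥-elim (≡-subst IsTrue eq (ℕ.≤⇒≤ᵇ i≤d))

    comp-beyond : comp F Φ κ (suc d) (0v F)
    comp-beyond with suc d ≤ᵇ d in eq
    ... | true  = ⊥-elim (ℕ.<-irrefl ≡-refl (ℕ.≤ᵇ⇒≤ (suc d) d (≡-subst IsTrue (≡-sym eq) _)))
    ... | false = lift ≈v.refl

    hi-member : ∀ {i v} → i ≤ d → X (suc i) v → Y i v → hi F Φ κ i v
    hi-member {i} {v} i≤d p q with ℕ.m≤n⇒m<n∨m≡n i≤d
    -- At i = d the next component is the zero subspace, and X d is already everything.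
    ... | inj₂ ≡-refl = v , 0v F , comp-intro i≤d (X-top ℕ.≤-refl) q , comp-beyond , lift (λ r → sym (+-identityʳ (v r)))
    ... | inj₁ i<d with u , w , (uX , uY) , (wX , wY) , v≈ ← splitOff i (suc i) i<d ℕ.≤-refl p q =
      u , w , comp-intro i≤d uX uY , comp-intro i<d wX wY , lift v≈

    lo-member : ∀ {i v} → i ≤ d → X i v → Y (i ∸ 1) v → lo F Φ κ i v
    lo-member {zero}  {v} i≤d p q = 0v F , v , lift ≈v.refl , comp-intro i≤d p q , lift (λ r → sym (+-identityˡ (v r)))
    lo-member {suc i} {v} i≤d p q = hi-member (ℕ.≤-trans (ℕ.n≤1+n i) i≤d) p q

    tri-member : ∀ {i v} → i ≤ d → X (suc i) v → Y (i ∸ 1) v → tri F Φ κ i v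
    tri-member {zero} {v} i≤d p q with u , w , u∈ , w∈ , lift v≈ ← hi-member i≤d p q =
      u , w , (0v F , u , lift ≈v.refl , u∈ , lift (λ r → sym (+-identityˡ (u r)))) , w∈ , lift v≈
    tri-member {suc i} {v} i≤d p q
      -- The centre is suc i here: component i is peeled off first, and the remainder satisfies the
      -- bounds of `hi` at suc i.
      with u , w , (uX , uY) , (wX , wY) , v≈ ← splitOff i (suc (suc i)) i≤d (s≤s (ℕ.n≤1+n i)) p q
      with u′ , w′ , u′∈ , w′∈ , lift w≈ ← hi-member i≤d wX wY =
      _+v_ F u u′ , w′ , (u , u′ , comp-intro (ℕ.≤-trans (ℕ.n≤1+n i) i≤d) uX uY , u′∈ , lift ≈v.refl) , w′∈ ,
      lift (λ r → trans (v≈ r) (trans (+-congˡ (w≈ r)) (sym (+-assoc (u r) (u′ r) (w′ r)))))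

    mid-member : ∀ {i v} → i ≤ d → X i v → Y i v → mid F Φ κ i v
    mid-member = comp-intro

  module _ {E : Fin (suc d) → Mat F n} where

    UpTo⇒reversed : ∀ {i v} → i ≤ d → UpTo (d ∸ i) E v → From i (reversed E) v
    UpTo⇒reversed {i} i≤d v∈ l l<i = v∈ (opposite l) (ℕ.+-cancelʳ-< (toℕ l) _ _ (begin-strict
      d ∸ i +ℕ toℕ l             <⟨ ℕ.+-monoʳ-< (d ∸ i) l<i ⟩
      d ∸ i +ℕ i                 ≡⟨ ℕ.m∸n+n≡m i≤d ⟩
      d                          ≡⟨ toℕ-opposite l ⟨
      toℕ (opposite l) +ℕ toℕ l  ∎))
      where open ℕ.≤-Reasoning

    From⇒reversed : ∀ {i v} → i ≤ d → From (d ∸ i) E v → UpTo i (reversed E) v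
    From⇒reversed {i} i≤d v∈ l i<l = v∈ (opposite l) (ℕ.+-cancelʳ-< (toℕ l) _ _ (begin-strict
      toℕ (opposite l) +ℕ toℕ l  ≡⟨ toℕ-opposite l ⟩
      d                          ≡⟨ ℕ.m∸n+n≡m i≤d ⟨
      d ∸ i +ℕ i                 <⟨ ℕ.+-monoʳ-< (d ∸ i) i<l ⟩
      d ∸ i +ℕ toℕ l             ∎))
      where open ℕ.≤-Reasoning

    module _ {i : ℕ} {v : V} (i≤d : i ≤ d) where

      reversed⇒UpTo : From i (reversed E) v → UpTo (d ∸ i) E v
      reversed⇒UpTo v∈ l d∸i<l = ≡-subst (λ j → app F (E j) v ≈ᵛ 0v F) (opposite-involutive l) (v∈ (opposite l)
        (ℕ.+-cancelˡ-< (d ∸ i) _ _ (begin-strict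
          d ∸ i +ℕ toℕ (opposite l)  <⟨ ℕ.+-monoˡ-< (toℕ (opposite l)) d∸i<l ⟩
          toℕ l +ℕ toℕ (opposite l)  ≡⟨ ℕ.+-comm (toℕ l) _ ⟩
          toℕ (opposite l) +ℕ toℕ l  ≡⟨ toℕ-opposite l ⟩
          d                          ≡⟨ ℕ.m∸n+n≡m i≤d ⟨
          d ∸ i +ℕ i                 ∎)))
        where open ℕ.≤-Reasoning

      reversed⇒From : UpTo i (reversed E) v → From (d ∸ i) E v
      reversed⇒From v∈ l l<d∸i = ≡-subst (λ j → app F (E j) v ≈ᵛ 0v F) (opposite-involutive l) (v∈ (opposite l)
        (ℕ.+-cancelˡ-< (d ∸ i) _ _ (begin-strict
          d ∸ i +ℕ i                 ≡⟨ ℕ.m∸n+n≡m i≤d ⟩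
          d                          ≡⟨ toℕ-opposite l ⟨
          toℕ (opposite l) +ℕ toℕ l  ≡⟨ ℕ.+-comm (toℕ (opposite l)) _ ⟩
          toℕ l +ℕ toℕ (opposite l)  <⟨ ℕ.+-monoˡ-< (toℕ (opposite l)) l<d∸i ⟩
          d ∸ i +ℕ toℕ (opposite l)  ∎)))
        where open ℕ.≤-Reasoning

    UpTo-top : ∀ {i v} → d ≤ i → UpTo i E v
    UpTo-top d≤i l i<l = ⊥-elim (ℕ.<⇒≱ i<l (ℕ.≤-trans (ℕ.≤-pred (toℕ<n l)) d≤i))

    From-bottom : ∀ {v} → From 0 E v
    From-bottom l ()

    -- Both flags belong to one operator, so its idempotent does the splitting: u = E_i v and w = v
    -- - u.
    eigenspace-splitOff : Resolution E → ∀ i k → i < d → i < k → ∀ {v} → UpTo k E v → From i E v →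
      Σ V λ u → Σ V λ w → (UpTo i E u × From i E u) × (UpTo k E w × From (suc i) E w) × v ≈ᵛ _+v_ F u w
    eigenspace-splitOff res i k i<d i<k {v} v∈X v∈Y = u , w
      , ((λ l i<l → orthogonal l j (λ { ≡-refl → ℕ.<-irrefl (≡-sym j≡i) i<l }) v)
        , (λ l l<i → orthogonal l j (λ { ≡-refl → ℕ.<-irrefl j≡i l<i }) v))
      , ((λ l k<l → linear-combination-0 (E l) (- 1#) (v∈X l k<l) (orthogonal l j (λ { ≡-refl → ℕ.<-asym k<l (≡-subst (_< k) (≡-sym j≡i) i<k) }) v))
        , below)
      , λ r → sym (restore (u r) (v r))
      where
      open Resolution res
      j : Fin (suc d)
      j = fromℕ< (s≤s (ℕ.<⇒≤ i<d))
      j≡i : toℕ j ≡ i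
      j≡i = toℕ-fromℕ< (s≤s (ℕ.<⇒≤ i<d))
      u w : V
      u = app F (E j) v
      w = _+v_ F v (_•v_ F (- 1#) u)
      restore : ∀ a e → a + (e + - 1# * a) ≈ e
      restore a e = trans (+-congˡ (+-congˡ (RingProperties.-1*x≈-x ring a)))
        (S.solve (var 0 :+ (var 1 :- var 0)) (var 1) ≡-refl)
        where
        open NoncommutativeSolver ring
        module S = Evaluation [] (a ∷ e ∷ [])
      below : From (suc i) E w
      below l (s≤s l≤i) with ℕ.m≤n⇒m<n∨m≡n l≤i
      ... | inj₁ l<i = linear-combination-0 (E l) (- 1#) (v∈Y l l<i)
        (orthogonal l j (λ { ≡-refl → ℕ.<-irrefl j≡i l<i }) v)
      ... | inj₂ l≡i with ≡-refl ← toℕ-injective (≡-trans l≡i (≡-sym j≡i)) = λ r → trans (app-+ (E l) v (_•v_ F (- 1#) u) r)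
        (trans (+-congˡ (trans (app-• (E l) (- 1#) u r) (trans (RingProperties.-1*x≈-x ring _) (-‿cong (idempotent l v r))))) (-‿inverseʳ _))

  eigenspaceFlags : ∀ {E} → Resolution E → ∀ κ → (∀ i → rawComp F Φ κ i ≡ span F E i i) → Flags κ
  eigenspaceFlags {E} res κ eq = record
    { X = λ i → UpTo i E ; Y = λ i → From i E
    ; X-top = UpTo-top ; Y-bottom = From-bottom
    ; fromComp = λ {i} {v} _ p → let s = ≡-subst (λ W → W v) (eq i) p in span⇒UpTo res i i s , span⇒From res i i s
    ; toComp = λ {i} {v} _ p q → ≡-subst (λ W → W v) (≡-sym (eq i)) (⇒span res i i p q)
    ; splitOff = eigenspace-splitOff res }

  flags-[0,D] : Flags [0,D]
  flags-[0,D] = eigenspaceFlags resolution-E [0,D] (λ _ → ≡-refl)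

  flags-[0*,D*] : Flags [0*,D*]
  flags-[0*,D*] = eigenspaceFlags resolution-E* [0*,D*] (λ _ → ≡-refl)

  flags-[0*,D] : Flags [0*,D]
  flags-[0*,D] = record
    { X = λ i → UpTo i E* ; Y = λ i → From i E
    ; X-top = UpTo-top ; Y-bottom = From-bottom
    ; fromComp = λ {i} i≤d (p , q) → span⇒UpTo resolution-E* 0 i p , span⇒From resolution-E i d q
    ; toComp = λ {i} i≤d p q → ⇒span resolution-E* 0 i p From-bottom , ⇒span resolution-E i d (UpTo-top ℕ.≤-refl) q
    ; splitOff = Decomposition.splitOff system }

  flags-[0*,0] : Flags [0*,0]
  flags-[0*,0] = record
    { X = λ i → UpTo i E* ; Y = λ i → From i (reversed E)
    ; X-top = UpTo-top ; Y-bottom = From-bottom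
    ; fromComp = λ {i} i≤d (p , q) → span⇒UpTo resolution-E* 0 i p , UpTo⇒reversed i≤d (span⇒UpTo resolution-E 0 (d ∸ i) q)
    ; toComp = λ {i} i≤d p q → ⇒span resolution-E* 0 i p From-bottom , ⇒span resolution-E 0 (d ∸ i) (reversed⇒UpTo i≤d q) From-bottom
    ; splitOff = Decomposition.splitOff (reverse-E system) }

  flags-[D*,0] : Flags [D*,0]
  flags-[D*,0] = record
    { X = λ i → UpTo i (reversed E*) ; Y = λ i → From i (reversed E)
    ; X-top = UpTo-top ; Y-bottom = From-bottom
    ; fromComp = λ {i} i≤d (p , q) → From⇒reversed i≤d (span⇒From resolution-E* (d ∸ i) d p) , UpTo⇒reversed i≤d (span⇒UpTo resolution-E 0 (d ∸ i) q)
    ; toComp = λ {i} i≤d p q → ⇒span resolution-E* (d ∸ i) d (UpTo-top ℕ.≤-refl) (reversed⇒From i≤d p) , ⇒span resolution-E 0 (d ∸ i) (reversed⇒UpTo i≤d q) From-bottom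
    ; splitOff = Decomposition.splitOff (reverse-E (reverse-E* system)) }

  flags-[D*,D] : Flags [D*,D]
  flags-[D*,D] = record
    { X = λ i → UpTo i (reversed E*) ; Y = λ i → From i E
    ; X-top = UpTo-top ; Y-bottom = From-bottom
    ; fromComp = λ {i} i≤d (p , q) → From⇒reversed i≤d (span⇒From resolution-E* (d ∸ i) d p) , span⇒From resolution-E i d q
    ; toComp = λ {i} i≤d p q → ⇒span resolution-E* (d ∸ i) d (UpTo-top ℕ.≤-refl) (reversed⇒From i≤d p) , ⇒span resolution-E i d (UpTo-top ℕ.≤-refl) q
    ; splitOff = Decomposition.splitOff (reverse-E* system) }

  reversed-resolution-E : Resolution (reversed E)
  reversed-resolution-E = reversed-resolution resolution-E

  reversed-resolution-E* : Resolution (reversed E*)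
  reversed-resolution-E* = reversed-resolution resolution-E*

  LowersBy-From-∸1 : ∀ {E M} → Resolution E → LowersBy 1 E M → ∀ i {v} → From i E v → From (i ∸ 1) E (app F M v)
  LowersBy-From-∸1 res lowers zero    q = From-bottom
  LowersBy-From-∸1 res lowers (suc i) q = LowersBy-From res lowers i q

  module _ {M : Mat F n}
    (raisesE : RaisesBy 0 E M) (lowersE : LowersBy 1 E M)
    (raisesE* : RaisesBy 0 E* M) (lowersE* : LowersBy 1 E* M) where

    -- The X-bound is kept when X comes from E* and grows by one when it comes from the reversed
    -- order; the Y-bound drops by one for E and is kept for its reversal. The eigenspace
    -- decomposition of A* behaves like E* for X and like E for Y, that of A likewise. Each target
    -- is the resulting pair of bounds.
    lowering : ∀ κ i → i ≤ d → MapsInto F M (comp F Φ κ i) (GTarget F Φ κ i)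
    lowering [0,D] i i≤d v v∈ with p , q ← Flags.comp-elim flags-[0,D] i≤d v∈ =
      Flags.lo-member flags-[0,D] i≤d (RaisesBy-UpTo resolution-E raisesE i p) (LowersBy-From-∸1 resolution-E lowersE i q)
    lowering [0*,D*] i i≤d v v∈ with p , q ← Flags.comp-elim flags-[0*,D*] i≤d v∈ =
      Flags.lo-member flags-[0*,D*] i≤d (RaisesBy-UpTo resolution-E* raisesE* i p) (LowersBy-From-∸1 resolution-E* lowersE* i q)
    lowering [0*,D] i i≤d v v∈ with p , q ← Flags.comp-elim flags-[0*,D] i≤d v∈ =
      Flags.lo-member flags-[0*,D] i≤d (RaisesBy-UpTo resolution-E* raisesE* i p) (LowersBy-From-∸1 resolution-E lowersE i q)
    lowering [0*,0] i i≤d v v∈ with p , q ← Flags.comp-elim flags-[0*,0] i≤d v∈ =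
      Flags.mid-member flags-[0*,0] i≤d (RaisesBy-UpTo resolution-E* raisesE* i p)
        (LowersBy-From reversed-resolution-E (reversed-lowers {E = E} raisesE) i q)
    lowering [D*,0] i i≤d v v∈ with p , q ← Flags.comp-elim flags-[D*,0] i≤d v∈ =
      Flags.hi-member flags-[D*,0] i≤d (RaisesBy-UpTo reversed-resolution-E* (reversed-raises {E = E*} lowersE*) i p)
        (LowersBy-From reversed-resolution-E (reversed-lowers {E = E} raisesE) i q)
    lowering [D*,D] i i≤d v v∈ with p , q ← Flags.comp-elim flags-[D*,D] i≤d v∈ =
      Flags.tri-member flags-[D*,D] i≤d (RaisesBy-UpTo reversed-resolution-E* (reversed-raises {E = E*} lowersE*) i p) (LowersBy-From-∸1 resolution-E lowersE i q)

  module _ {M : Mat F n}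
    (raisesE : RaisesBy 1 E M) (lowersE : LowersBy 0 E M)
    (raisesE* : RaisesBy 1 E* M) (lowersE* : LowersBy 0 E* M) where

    -- The opposite pattern: original orders let the X-bound grow by one and keep the Y-bound,
    -- reversed orders keep the X-bound and let the Y-bound drop by one.
    raising : ∀ κ i → i ≤ d → MapsInto F M (comp F Φ κ i) (G̃Target F Φ κ i)
    raising [0,D] i i≤d v v∈ with p , q ← Flags.comp-elim flags-[0,D] i≤d v∈ =
      Flags.hi-member flags-[0,D] i≤d (RaisesBy-UpTo resolution-E raisesE i p) (LowersBy-From resolution-E lowersE i q)
    raising [0*,D*] i i≤d v v∈ with p , q ← Flags.comp-elim flags-[0*,D*] i≤d v∈ =
      Flags.hi-member flags-[0*,D*] i≤d (RaisesBy-UpTo resolution-E* raisesE* i p) (LowersBy-From resolution-E* lowersE* i q)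
    raising [0*,D] i i≤d v v∈ with p , q ← Flags.comp-elim flags-[0*,D] i≤d v∈ =
      Flags.hi-member flags-[0*,D] i≤d (RaisesBy-UpTo resolution-E* raisesE* i p) (LowersBy-From resolution-E lowersE i q)
    raising [0*,0] i i≤d v v∈ with p , q ← Flags.comp-elim flags-[0*,0] i≤d v∈ =
      Flags.tri-member flags-[0*,0] i≤d (RaisesBy-UpTo resolution-E* raisesE* i p) (LowersBy-From-∸1 reversed-resolution-E (reversed-lowers {E = E} raisesE) i q)
    raising [D*,0] i i≤d v v∈ with p , q ← Flags.comp-elim flags-[D*,0] i≤d v∈ =
      Flags.lo-member flags-[D*,0] i≤d (RaisesBy-UpTo reversed-resolution-E* (reversed-raises {E = E*} lowersE*) i p) (LowersBy-From-∸1 reversed-resolution-E (reversed-lowers {E = E} raisesE) i q)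
    raising [D*,D] i i≤d v v∈ with p , q ← Flags.comp-elim flags-[D*,D] i≤d v∈ =
      Flags.mid-member flags-[D*,D] i≤d (RaisesBy-UpTo reversed-resolution-E* (reversed-raises {E = E*} lowersE*) i p)
        (LowersBy-From resolution-E lowersE i q)

-- Geometric eigenvalue sequences

module GeometricEigenvalues {c ℓ} (F : Field c ℓ) (b : Field.Carrier F)
  (b≉0 : ¬ (Field._≈_ F b (Field.0# F)))
  (bᵐ≉1 : ∀ m → ¬ (Field._≈_ F (pow F b (suc m)) (Field.1# F))) where
  open Field F
  open NonRootOfUnity F b b≉0 bᵐ≉1
  open RingProperties ring using (x∙y⁻¹≈ε⇒x≈y)
  open SetoidReasoning setoid

  pow≉0 : ∀ k → ¬ (pow F b k ≈ 0#)
  pow≉0 k p = 0≉1 (trans (sym (zeroˡ _)) (trans (*-congʳ (sym p)) (pow-inverse k)))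

  pow-increasing : ∀ {t} → ¬ (t ≈ 0#) → ∀ k m → ¬ (pow F b (k +ℕ suc m) * t ≈ pow F b k * t)
  pow-increasing {t} t≉0 k m p = product≉0 (product≉0 (pow≉0 k) (λ q → bᵐ≉1 m (x∙y⁻¹≈ε⇒x≈y _ _ q))) t≉0 (begin
    u * (w - 1#) * t      ≈⟨ S.solve (var 0 :* (var 1 :- :1) :* var 2) (var 0 :* var 1 :* var 2 :- var 0 :* var 2) ≡-refl ⟩
    u * w * t - u * t     ≈⟨ +-congʳ (trans (*-congʳ (sym (pow-+ b k (suc m)))) p) ⟩
    u * t - u * t         ≈⟨ -‿inverseʳ _ ⟩
    0#                    ∎)
    where
    open NoncommutativeSolver ring
    u = pow F b k
    w = pow F b (suc m)
    module S = Evaluation [] (u ∷ w ∷ t ∷ [])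

  pow-injective : ∀ {t} → ¬ (t ≈ 0#) → ∀ k l → pow F b k * t ≈ pow F b l * t → k ≡ l
  pow-injective {t} t≉0 k l p with ℕ.<-cmp k l
  ... | tri≈ _ k≡l _ = k≡l
  ... | tri< k<l _ _ with m , l≡ ← ℕ.m≤n⇒∃[o]m+o≡n k<l = ⊥-elim (pow-increasing t≉0 k m (trans (reflexive (≡-cong (λ e → pow F b e * t) (≡-trans (ℕ.+-suc k m) l≡))) (sym p)))
  ... | tri> _ _ l<k with m , k≡ ← ℕ.m≤n⇒∃[o]m+o≡n l<k = ⊥-elim (pow-increasing t≉0 l m (trans (reflexive (≡-cong (λ e → pow F b e * t) (≡-trans (ℕ.+-suc l m) k≡))) p))

  module Ascending {d : ℕ} (θ : Fin (suc d) → Carrier) (step : ∀ (i : Fin d) → θ (fs i) ≈ b * θ (inject₁ i)) (θ₀≉0 : ¬ (θ fz ≈ 0#)) where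

    closedForm : ∀ k (j : Fin (suc d)) → toℕ j ≡ k → θ j ≈ pow F b k * θ fz
    closedForm zero    fz     _  = sym (*-identityˡ _)
    closedForm (suc k) (fs i) eq = trans (step i) (trans
      (*-congˡ (closedForm k (inject₁ i) (≡-trans (toℕ-inject₁ i) (ℕ.suc-injective eq)))) (sym (*-assoc _ _ _)))

    ratio : ∀ i j → b * θ i ≈ θ j → toℕ j ≡ suc (toℕ i)
    ratio i j p = pow-injective θ₀≉0 (toℕ j) (suc (toℕ i)) (trans (sym (closedForm _ j ≡-refl))
      (trans (sym p) (trans (*-congˡ (closedForm _ i ≡-refl)) (sym (*-assoc _ _ _)))))

    adjacent : ∀ i j → toℕ j ≡ suc (toℕ i) → b * θ i ≈ θ j
    adjacent i j eq = trans (*-congˡ (closedForm _ i ≡-refl)) (trans (sym (*-assoc _ _ _)) (sym (closedForm _ j eq)))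

  module Descending {d : ℕ} (θ : Fin (suc d) → Carrier) (step : ∀ (i : Fin d) → θ (fs i) ≈ b ⁻¹ * θ (inject₁ i)) (θ₀≉0 : ¬ (θ fz ≈ 0#)) where

    -- The form b^k θ_k = θ_0 avoids powers of b⁻¹, so that injectivity of k ↦ b^k θ_0 serves both
    -- sequences.
    closedForm : ∀ k (j : Fin (suc d)) → toℕ j ≡ k → pow F b k * θ j ≈ θ fz
    closedForm zero    fz     _  = *-identityˡ _
    closedForm (suc k) (fs i) eq = begin
      b * pow F b k * θ (fs i)                    ≈⟨ *-congˡ (step i) ⟩
      b * pow F b k * (b ⁻¹ * θ (inject₁ i))      ≈⟨ *-congʳ (*-comm _ _) ⟩
      pow F b k * b * (b ⁻¹ * θ (inject₁ i))      ≈⟨ *-assoc _ _ _ ⟩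
      pow F b k * (b * (b ⁻¹ * θ (inject₁ i)))    ≈⟨ *-congˡ (trans (sym (*-assoc _ _ _)) (trans (*-congʳ (⁻¹-inverse b b≉0)) (*-identityˡ _))) ⟩
      pow F b k * θ (inject₁ i)                   ≈⟨ closedForm k (inject₁ i) (≡-trans (toℕ-inject₁ i) (ℕ.suc-injective eq)) ⟩
      θ fz                                        ∎

    private
      scaled-form : ∀ i k → pow F b (toℕ i +ℕ k) * θ i ≈ pow F b k * θ fz
      scaled-form i k = begin
        pow F b (toℕ i +ℕ k) * θ i           ≈⟨ *-congʳ (trans (pow-+ b (toℕ i) k) (*-comm _ _)) ⟩
        pow F b k * pow F b (toℕ i) * θ i    ≈⟨ *-assoc _ _ _ ⟩
        pow F b k * (pow F b (toℕ i) * θ i)  ≈⟨ *-congˡ (closedForm _ i ≡-refl) ⟩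
        pow F b k * θ fz                     ∎

      shifted-form : ∀ i k → pow F b (toℕ i +ℕ k) * (b * θ i) ≈ pow F b (suc k) * θ fz
      shifted-form i k = begin
        pow F b (toℕ i +ℕ k) * (b * θ i)     ≈⟨ trans (sym (*-assoc _ _ _)) (trans (*-congʳ (*-comm _ b)) (*-assoc _ _ _)) ⟩
        b * (pow F b (toℕ i +ℕ k) * θ i)     ≈⟨ *-congˡ (scaled-form i k) ⟩
        b * (pow F b k * θ fz)               ≈⟨ *-assoc _ _ _ ⟨
        pow F b (suc k) * θ fz               ∎

    -- Multiplying by b^{i+j} turns the equation into b^{j+1} θ_0 = b^i θ_0.
    ratio : ∀ i j → b * θ i ≈ θ j → toℕ i ≡ suc (toℕ j)
    ratio i j p = ≡-sym (pow-injective θ₀≉0 (suc (toℕ j)) (toℕ i) (begin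
      pow F b (suc (toℕ j)) * θ fz               ≈⟨ shifted-form i (toℕ j) ⟨
      pow F b (toℕ i +ℕ toℕ j) * (b * θ i)       ≈⟨ *-cong (reflexive (≡-cong (pow F b) (ℕ.+-comm (toℕ i) (toℕ j)))) p ⟩
      pow F b (toℕ j +ℕ toℕ i) * θ j             ≈⟨ scaled-form j (toℕ i) ⟩
      pow F b (toℕ i) * θ fz                     ∎))

    adjacent : ∀ i j → toℕ j ≡ suc (toℕ i) → θ i ≈ b * θ j
    adjacent i (fs j) eq = sym (begin
      b * θ (fs j)                   ≈⟨ *-congˡ (step j) ⟩
      b * (b ⁻¹ * θ (inject₁ j))     ≈⟨ trans (sym (*-assoc _ _ _)) (trans (*-congʳ (⁻¹-inverse b b≉0)) (*-identityˡ _)) ⟩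
      θ (inject₁ j)                  ≡⟨ ≡-cong θ (toℕ-injective (≡-trans (toℕ-inject₁ j) (ℕ.suc-injective eq))) ⟩
      θ i                            ∎)

-- Block shape of the alternating elements, and the conclusion

module AlternatingAction {c ℓ} (F : Field c ℓ) (n d : ℕ) (1≤d : 1 ≤ d) (Φ : TDSystem F n d) (b : Field.Carrier F)
  (b≉0 : ¬ (Field._≈_ F b (Field.0# F)))
  (bᵐ≉1 : ∀ m → ¬ (Field._≈_ F (pow F b (suc m)) (Field.1# F)))
  (serreType : SerreType F Φ b) where
  open Field F using (Carrier; _≈_; 0#; _*_; trans; sym; *-congˡ; zeroʳ)
  open Matrices F n
  open TridiagonalSystems F n d
  open FromTDSystem F Φ
  open Targets F Φ
  open SpectralBlocks F n d b
  open GeometricEigenvalues F b b≉0 bᵐ≉1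
  open TDSystem Φ
  open System system using (spaces; spaces*; A-raises; A-lowers; A*-raises; A*-lowers)

  -- If θ_0 vanished, so would θ_1 = a θ_0, against distinctness; the bound on d guarantees that θ_1
  -- exists.
  first≉0 : ∀ {d} → 1 ≤ d → (θ : Fin (suc d) → Carrier) (a : Carrier) → (∀ (i : Fin d) → θ (fs i) ≈ a * θ (inject₁ i)) →
    (∀ i j → i ≢ j → ¬ (θ i ≈ θ j)) → ¬ (θ fz ≈ 0#)
  first≉0 (s≤s _) θ a step distinct θ₀≈0 = distinct (fs fz) fz (λ ())
    (trans (step fz) (trans (*-congˡ θ₀≈0) (trans (zeroʳ a) (sym θ₀≈0))))

  private
    module θ-values = Ascending θ (proj₁ serreType) (first≉0 1≤d θ b (proj₁ serreType) θ-distinct)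
    module θ*-values = Descending θ* (proj₂ serreType) (first≉0 1≤d θ* (Field._⁻¹ F b) (proj₂ serreType) θ*-distinct)
    module H = AlternatingHypotheses F A A* b b≉0 bᵐ≉1
    module Q = AlternatingSequences F A A* b
    module R = Ring matrixRing

    pair : WeightedSums.AlternatingPair matrixRing (scalar b) (scalar (Field._⁻¹ F b)) (scalar H.ρ)
      (scalar-central b) (scalar-central _) (scalar-central H.ρ) H.𝐛-inverse
    pair = record
      { ρ-equation = H.ρ-equation ; bⁿ-1-regular = H.𝐛ⁿ-1-regular
      ; x = A ; y = A*
      ; serreˣ = serre spaces A*-raises A*-lowers (λ i j eq → inj₁ (θ-values.adjacent i j eq))
      -- θ* descends by the factor b where θ ascends, so the factor of the Serre scalar that
      -- vanishes on adjacent blocks is the other one.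
      ; serreʸ = serre spaces* A-raises A-lowers (λ i j eq → inj₂ (θ*-values.adjacent i j eq))
      ; g = Q.g ; h = Q.h ; g₀≈1 = R.refl ; h₀≈1 = R.refl
      ; difference = H.difference ; quadratic = H.quadratic }

  open AlternatingRelations matrixRing (scalar b) (scalar (Field._⁻¹ F b)) (scalar H.ρ)
    (scalar-central b) (scalar-central _) (scalar-central H.ρ) H.𝐛-inverse pair

  ≢-from-> : ∀ {i j : Fin (suc d)} → toℕ j < toℕ i → i ≢ j
  ≢-from-> j<i ≡-refl = ℕ.<-irrefl ≡-refl j<i

  module _ (k : ℕ) where
    private
      M = G F A A* b k
      M̃ = G̃ F A A* b k

    -- For j < i the eigenvalues differ, and b θ_i = θ_j would force j = i + 1.
    G-raises : RaisesBy 0 E M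
    G-raises i j j<i = sandwich⇒zeroBlock spaces M (quadratic-block spaces i j ([x,[x,g]ᵇ]≈0 k)
      (θ-distinct i j (≢-from-> j<i)) (λ p → ℕ.<⇒≱ j<i (ℕ.≤-trans (ℕ.n≤1+n _) (ℕ.≤-reflexive (≡-sym (θ-values.ratio i j p))))))

    G-lowers : LowersBy 1 E M
    G-lowers i j 1+i<j = sandwich⇒zeroBlock spaces M (quadratic-block spaces i j ([x,[x,g]ᵇ]≈0 k)
      (θ-distinct i j (λ eq → ≢-from-> (ℕ.<-trans ℕ.≤-refl 1+i<j) (≡-sym eq))) (λ p → ℕ.<-irrefl (≡-sym (θ-values.ratio i j p)) 1+i<j))

    -- The relation for y has g on the left of the b-bracket, which reverses the exceptional ratio;
    -- the eigenvalues of A* also run in the opposite direction. The two reversals compensate and G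
    -- has the same shape for E* as for E.
    G-raises* : RaisesBy 0 E* M
    G-raises* i j j<i = sandwich⇒zeroBlock spaces* M (quadratic-blockʳ spaces* i j ([y,[g,y]ᵇ]≈0 k)
      (θ*-distinct i j (≢-from-> j<i)) (λ p → ℕ.<⇒≱ j<i (ℕ.≤-trans (ℕ.n≤1+n _) (ℕ.≤-reflexive (≡-sym (θ*-values.ratio j i p))))))

    G-lowers* : LowersBy 1 E* M
    G-lowers* i j 1+i<j = sandwich⇒zeroBlock spaces* M (quadratic-blockʳ spaces* i j ([y,[g,y]ᵇ]≈0 k)
      (θ*-distinct i j (λ eq → ≢-from-> (ℕ.<-trans ℕ.≤-refl 1+i<j) (≡-sym eq))) (λ p → ℕ.<-irrefl (≡-sym (θ*-values.ratio j i p)) 1+i<j))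

    G̃-raises : RaisesBy 1 E M̃
    G̃-raises i j 1+j<i = sandwich⇒zeroBlock spaces M̃ (quadratic-blockʳ spaces i j ([x,[h,x]ᵇ]≈0 k)
      (θ-distinct i j (≢-from-> (ℕ.<-trans ℕ.≤-refl 1+j<i))) (λ p → ℕ.<-irrefl (≡-sym (θ-values.ratio j i p)) 1+j<i))

    G̃-lowers : LowersBy 0 E M̃
    G̃-lowers i j i<j = sandwich⇒zeroBlock spaces M̃ (quadratic-blockʳ spaces i j ([x,[h,x]ᵇ]≈0 k)
      (θ-distinct i j (λ eq → ≢-from-> i<j (≡-sym eq))) (λ p → ℕ.<⇒≱ i<j (ℕ.≤-trans (ℕ.n≤1+n _) (ℕ.≤-reflexive (≡-sym (θ-values.ratio j i p))))))

    G̃-raises* : RaisesBy 1 E* M̃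
    G̃-raises* i j 1+j<i = sandwich⇒zeroBlock spaces* M̃ (quadratic-block spaces* i j ([y,[y,h]ᵇ]≈0 k)
      (θ*-distinct i j (≢-from-> (ℕ.<-trans ℕ.≤-refl 1+j<i))) (λ p → ℕ.<-irrefl (≡-sym (θ*-values.ratio i j p)) 1+j<i))

    G̃-lowers* : LowersBy 0 E* M̃
    G̃-lowers* i j i<j = sandwich⇒zeroBlock spaces* M̃ (quadratic-block spaces* i j ([y,[y,h]ᵇ]≈0 k)
      (θ*-distinct i j (λ eq → ≢-from-> i<j (≡-sym eq))) (λ p → ℕ.<⇒≱ i<j (ℕ.≤-trans (ℕ.n≤1+n _) (ℕ.≤-reflexive (≡-sym (θ*-values.ratio i j p))))))

theorem9p9 : {c ℓ : Level} (F : Field c ℓ) (n d : ℕ) → 1 ≤ d →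
    (Φ : TDSystem F n d) (b : Field.Carrier F) →
    ¬ (Field._≈_ F b (Field.0# F)) →
    (∀ m → ¬ (Field._≈_ F (pow F b (suc m)) (Field.1# F))) →
    SerreType F Φ b →
    ∀ (κ : Kind) (k i : ℕ) → i ≤ d →
    MapsInto F (G F (TDSystem.A Φ) (TDSystem.A* Φ) b (suc k))
    (comp F Φ κ i) (GTarget F Φ κ i)
    × MapsInto F (G̃ F (TDSystem.A Φ) (TDSystem.A* Φ) b (suc k))
    (comp F Φ κ i) (G̃Target F Φ κ i)
theorem9p9 F n d 1≤d Φ b b≉0 bᵐ≉1 serreType κ k i i≤d =
  lowering (G-raises (suc k)) (G-lowers (suc k)) (G-raises* (suc k)) (G-lowers* (suc k)) κ i i≤d ,
  raising (G̃-raises (suc k)) (G̃-lowers (suc k)) (G̃-raises* (suc k)) (G̃-lowers* (suc k)) κ i i≤d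
  where
  open AlternatingAction F n d 1≤d Φ b b≉0 bᵐ≉1 serreType
  open Targets F Φ
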